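{- Let $G$ be a $3$-regular graph on $n$ vertices. If $H$ is any graph whose $(n-2)$-deck equals the $(n-2)$-deck of $G$, then $H$ is isomorphic to $G$. That is, every $3$-regular graph is $2$-reconstructible.
   Context: All graphs are finite and simple. For a graph $G$ on $n$ vertices and $k\le n$, the $k$-deck of $G$ is the multiset (of isomorphism classes) of the $\binom{n}{k}$ induced subgraphs of $G$ on $k$ vertices; its elements are called cards. A graph is $\ell$-reconstructible if it is determined up to isomorphism by its $(n-\ell)$-deck, i.e. by the multiset of induced subgraphs obtained by deleting $\ell$ vertices. -}

module Defs where

open import Data.Nat using (ℕ; _∸_)
open import Data.Bool using (Bool; true; false)
open import Data.Fin using (Fin)
open import Data.Fin.Subset using (Subset; _∈_; ∣_∣)
open import Data.Product using (Σ; Σ-syntax; _×_; proj₁)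
open import Data.List using (List; filter; length)
open import Data.List using () renaming (allFin to allFinL)
open import Data.Bool using (T)
open import Relation.Nullary.Decidable using (Dec)
open import Data.Bool.Properties using (T?)
open import Relation.Binary.PropositionalEquality using (_≡_)
open import Function.Bundles using (_↔_; Inverse)
open import Level using (0ℓ)

record Graph (n : ℕ) : Set where
  field
    adj   : Fin n → Fin n → Bool
    sym   : ∀ u v → adj u v ≡ adj v u
    irrefl : ∀ v → adj v v ≡ false
open Graph public

degree : ∀ {n} → Graph n → Fin n → ℕ
degree {n} G v = length (filter (λ u → T? (adj G v u)) (allFinL n))

Regular : ∀ {n} → ℕ → Graph n → Set
Regular r G = ∀ v → degree G v ≡ r

_≅_ : ∀ {n m} → Graph n → Graph m → Set
_≅_ {n} {m} G H =
  Σ[ f ∈ (Fin n ↔ Fin m) ] (∀ u v → adj H (Inverse.to f u) (Inverse.to f v) ≡ adj G u v)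

Members : ∀ {n} → Subset n → Set
Members {n} S = Σ[ v ∈ Fin n ] (v ∈ S)

InducedIso : ∀ {n m} → Graph n → Subset n → Graph m → Subset m → Set
InducedIso G S H T =
  Σ[ f ∈ (Members S ↔ Members T) ]
    (∀ u v → adj H (proj₁ (Inverse.to f u)) (proj₁ (Inverse.to f v)) ≡ adj G (proj₁ u) (proj₁ v))

KSubset : ℕ → ℕ → Set
KSubset n k = Σ[ S ∈ Subset n ] (∣ S ∣ ≡ k)

-- Two graphs have the same k-deck: the multisets of isomorphism classes
-- of induced k-vertex subgraphs coincide, i.e. there is a bijection
-- between the k-subsets of G and of H matching isomorphic cards.
SameDeck : ∀ {n m} → ℕ → Graph n → Graph m → Set
SameDeck {n} {m} k G H =
  Σ[ φ ∈ (KSubset n k ↔ KSubset m k) ]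
    (∀ S → InducedIso G (proj₁ S) H (proj₁ (Inverse.to φ S)))

{-# OPTIONS --safe #-}
-- Suppose that G is cubic and that H has the same deck but is not isomorphic to
-- G. By Kelly's lemma the deck determines the sum of (d - 3)² over all degrees
-- d, so H is cubic as well. Let K be the class of graphs isomorphic to G or H.
-- Deleting u and v from X in K leaves a card of the other graph, so there is a
-- Y in K, not isomorphic to X, that agrees with X off u and v. If u and v had
-- the same neighbours up to one exception each, Y would be isomorphic to X;
-- hence the graphs in K have girth at least 5. If u and v are adjacent, Y
-- arises from X by exchanging a neighbour of u with a neighbour of v.
--
-- Let g be the girth of K and Z a g-cycle. Exchanges along the edges of Z
-- permute the outer neighbours of Z arbitrarily, as the other possible
-- exchange would shorten Z. Hence a path off Z between two outer neighbours has
-- at least g - 3 edges, for these two can be attached to consecutive vertices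
-- of Z. If two such paths of equal length start with the same edge and have
-- different ends, an exchange at the edge where they diverge shortens one.
--
-- * There is no such path with g - 3 edges: by the last remark an outer
--   neighbour has at most two of them, so Z can be arranged in such a way that
--   one exchange destroys a g-cycle and creates none, but by Kelly's lemma all
--   graphs in K have equally many g-cycles.
-- * An exchange at the edge from Z to an outer neighbour w destroys Z, so it
--   creates a g-cycle, and this contains a path with g - 2 edges off Z from w to
--   one of the two outer neighbours next to w in the arrangement. So such paths
--   lead from w to three others; two of them start with the same edge, and
--   shortening one gives a path with g - 3 edges.

module Submission where

open import Defs
open import Data.Nat using (ℕ; _∸_)
open import Data.Nat
  using (zero; suc; _+_; _*_; _≤_; _<_; _≤?_; z≤n; s≤s; >-nonZero) renaming (_≟_ to _≟ℕ_)
open import Data.Nat.Properties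
  using (≤-refl; ≤-reflexive; ≤-trans; ≤-antisym; ≤-pred; ≤∧≢⇒<; <-irrefl; <⇒≱; ≰⇒>; suc-injective;
         ≡-irrelevant; m≤m+n; m≤n+m; m+n∸m≡n; m+[n∸m]≡n; ∸-monoˡ-≤; +-suc; +-comm; +-assoc;
         +-mono-≤; +-monoˡ-≤; +-monoʳ-≤; +-monoʳ-<; +-cancelˡ-≡; +-cancelˡ-≤; +-cancelʳ-≤;
         *-comm; *-distribˡ-+; *-monoʳ-≤; *-cancelʳ-≤; module ≤-Reasoning)
open import Data.Nat.ListAction using (sum)
open import Data.Nat.Tactic.RingSolver using (solve-∀)
open import Data.Bool using (Bool; true; false; T)
import Data.Bool.Properties as Bool
open import Data.Bool.Properties using (T?)
open import Data.Empty using (⊥; ⊥-elim)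
open import Data.Product using (∃; ∃₂; _×_; _,_; proj₁; proj₂)
open import Data.Sum using (_⊎_; inj₁; inj₂; [_,_]′)
open import Data.Fin using (Fin; zero; suc; _≟_)
open import Data.Fin.Properties using (any?; all?)
open import Data.Fin.Permutation using (transpose)
import Data.Fin.Permutation.Components as PC
open import Data.Fin.Subset using (Subset; inside; outside; ∣_∣; ∁)
  renaming (_∈_ to _∈ₛ_; _∉_ to _∉ₛ_; ⊥ to ∅)
open import Data.Fin.Subset.Properties
  using (∣p∣≤n; ∣p∣≡n⇒p≡⊤; ∈⊤; drop-there; ∉⊥; ∣⊥∣≡0; ∣∁p∣≡n∸∣p∣; x∉p⇒x∈∁p)
  renaming (_∈?_ to _∈ₛ?_)
open import Data.Vec using (Vec; []; _∷_; here; there; _[_]≔_; lookup; tabulate)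
import Data.Vec.Properties as Vec
open import Data.Vec.Properties
  using ([]=⇒lookup; lookup⇒[]=; []≔-updates; updateAt-minimal; lookup∘update′; lookup∘tabulate)
open import Data.Vec.Properties.WithK using ([]=-irrelevant)
open import Data.List
  using (List; []; _∷_; _++_; length; map; reverse; filter; allFin; concatMap; cartesianProduct)
open import Data.List.Properties
  using (∷-injectiveˡ; ∷-injectiveʳ; unfold-reverse; length-reverse; length-++; length-map; length-tabulate;
         ++-assoc; ++-identityʳ; map-++; map-injective)
open import Data.List.Membership.Propositional using (_∈_; _∉_)
open import Data.List.Membership.Propositional.Properties
  using (∈-++⁺ˡ; ∈-++⁺ʳ; ∈-++⁻; ∈-∃++; ∈-map⁺; ∈-map⁻; ∈-allFin; ∈-filter⁺; ∈-filter⁻;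
         ∈-cartesianProduct⁺; ∈-cartesianProduct⁻)
open import Data.List.Relation.Unary.Any using (here; there)
open import Data.List.Relation.Unary.All as All using (All; []; _∷_)
open import Data.List.Relation.Unary.All.Properties using (¬Any⇒All¬; All¬⇒¬Any) renaming (++⁺ to All-++⁺)
open import Data.List.Relation.Unary.AllPairs using ([]; _∷_)
open import Data.List.Relation.Unary.Unique.Propositional using (Unique)
open import Data.List.Relation.Unary.Unique.Propositional.Properties
  using (Unique[x∷xs]⇒x∉xs; allFin⁺; filter⁺; cartesianProduct⁺)
  renaming (map⁺ to Unique-map⁺; ++⁺ to Unique-++⁺)
open import Data.List.Relation.Binary.Subset.Propositional using (_⊆_)
open import Data.List.Relation.Binary.Permutation.Propositional
  using (_↭_; ↭-sym; ↭-trans; prep; swap; refl)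
open import Data.List.Relation.Binary.Permutation.Propositional.Properties
  using (↭-length; ↭-reverse; shift; ++-comm; ∈-resp-↭; ++⁺ˡ; ∷↭∷ʳ)
open import Function using (_∘_; id; case_of_; _↔_; Inverse; mk↔ₛ′)
open import Function.Construct.Identity using (↔-id)
open import Function.Construct.Composition using (_↔-∘_)
open import Function.Construct.Symmetry using (↔-sym)
open import Relation.Binary.Definitions using (DecidableEquality)
open import Relation.Binary.PropositionalEquality
  using (_≡_; _≢_; refl; trans; cong; cong₂; subst; subst₂; ≢-sym)
  renaming (sym to ≡-sym)
open import Relation.Nullary using (¬_; Dec; yes; no; contradiction; ¬?; _×-dec_)
open import Relation.Nullary.Decidable using (map′; decidable-stable; ¬¬-excluded-middle)

-- Around an edge `uv` the four outer neighbours can be split between the ends in three ways, up to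
-- interchanging `u` and `v`; one of them is the old graph, so an exchange has two possible
-- outcomes. The ends can be named so that a chosen neighbour stays at `u`; an argument then has to
-- exclude one outcome or profit from both. No minimal choice is made: cycles of length `5 + j` are
-- excluded from the whole class for one `j` after the other, until the girth would exceed the
-- number of vertices, which no cubic graph allows. The start 5 also serves the counting: five outer
-- neighbours are enough to choose one off four forbidden ones, and to see one of them joined to
-- three of the four others. With `g = 5 + j`, paths with `g - 3` and `g - 2` edges have `3 + j` and
-- `4 + j` vertices. The existence of such paths is not decided; as every claim about them ends in a
-- contradiction, case distinctions under double negation suffice. At the end the assumption of
-- non-isomorphism is removed by deciding isomorphism.

open Inverse using (to; from)

-- Lists, paths and cycles

module _ {A : Set} where

  Unique-↭ : {xs ys : List A} → xs ↭ ys → Unique xs → Unique ys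
  Unique-↭ refl u = u
  Unique-↭ (prep x p) (a ∷ u) =
    ¬Any⇒All¬ _ (All¬⇒¬Any a ∘ ∈-resp-↭ (↭-sym p)) ∷ Unique-↭ p u
  Unique-↭ (swap x y p) ((x≢y ∷ a) ∷ b ∷ u) =
    (≢-sym x≢y ∷ ¬Any⇒All¬ _ (All¬⇒¬Any b ∘ ∈-resp-↭ (↭-sym p))) ∷
    ¬Any⇒All¬ _ (All¬⇒¬Any a ∘ ∈-resp-↭ (↭-sym p)) ∷ Unique-↭ p u
  Unique-↭ (_↭_.trans p q) = Unique-↭ q ∘ Unique-↭ p

  Unique-∷ : {x : A} {xs : List A} → x ∉ xs → Unique xs → Unique (x ∷ xs)
  Unique-∷ x∉ u = ¬Any⇒All¬ _ x∉ ∷ u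

  Unique-++⁻ʳ : ∀ (xs : List A) {ys} → Unique (xs ++ ys) → Unique ys
  Unique-++⁻ʳ []       u       = u
  Unique-++⁻ʳ (x ∷ xs) (_ ∷ u) = Unique-++⁻ʳ xs u

  Unique-++⁻ˡ : ∀ (xs : List A) {ys} → Unique (xs ++ ys) → Unique xs
  Unique-++⁻ˡ []       u = []
  Unique-++⁻ˡ (x ∷ xs) u@(_ ∷ u′) =
    Unique-∷ (Unique[x∷xs]⇒x∉xs u ∘ ∈-++⁺ˡ) (Unique-++⁻ˡ xs u′)

  Unique⇒disjoint : ∀ (xs : List A) {ys x} → Unique (xs ++ ys) → x ∈ xs → x ∉ ys
  Unique⇒disjoint (x ∷ xs) u       (here refl) x∈ = Unique[x∷xs]⇒x∉xs u (∈-++⁺ʳ xs x∈)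
  Unique⇒disjoint (x ∷ xs) (_ ∷ u) (there p)   x∈ = Unique⇒disjoint xs u p x∈

  ∈⇒↭ : {x : A} {xs : List A} → x ∈ xs → ∃ λ ys → xs ↭ x ∷ ys
  ∈⇒↭ x∈ with ∈-∃++ x∈
  ... | p , q , refl = p ++ q , shift _ p q

  Unique-⊆⇒length≤ : {xs ys : List A} → Unique xs → xs ⊆ ys → length xs ≤ length ys
  Unique-⊆⇒length≤ {[]}     u sub = z≤n
  Unique-⊆⇒length≤ {x ∷ xs} u@(_ ∷ u′) sub with ∈⇒↭ (sub (here refl))
  ... | zs , ys↭ = ≤-trans (s≤s (Unique-⊆⇒length≤ u′ sub′)) (≤-reflexive (≡-sym (↭-length ys↭)))
    where
    sub′ : xs ⊆ zs
    sub′ z∈ with ∈-resp-↭ ys↭ (sub (there z∈))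
    ... | here refl = ⊥-elim (Unique[x∷xs]⇒x∉xs u z∈)
    ... | there z∈′ = z∈′

  -- Phrased with permutations because equal outer neighbours will be refuted by first moving them
  -- next to each other.
  noRepeat⇒Unique : ∀ (xs : List A) → (∀ {x ys} → ¬ (xs ↭ x ∷ x ∷ ys)) → Unique xs
  noRepeat⇒Unique []       _  = []
  noRepeat⇒Unique (x ∷ xs) ¬rep = Unique-∷
    (λ x∈ → let _ , σ = ∈⇒↭ x∈ in ¬rep (prep x σ))
    (noRepeat⇒Unique xs λ σ → ¬rep (↭-trans (prep x σ) (↭-trans (swap x _ refl) (prep _ (swap x _ refl)))))

  Unique-map-injective : ∀ {B : Set} {f : A → B} {xs x y} → Unique (map f xs) →
                         x ∈ xs → y ∈ xs → f x ≡ f y → x ≡ y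
  Unique-map-injective u       (here refl) (here refl) eq = refl
  Unique-map-injective {f = f} {_ ∷ xs} u (here refl) (there y∈) eq =
    ⊥-elim (Unique[x∷xs]⇒x∉xs u (subst (_∈ map f xs) (≡-sym eq) (∈-map⁺ f y∈)))
  Unique-map-injective {f = f} {_ ∷ xs} u (there x∈) (here refl) eq =
    ⊥-elim (Unique[x∷xs]⇒x∉xs u (subst (_∈ map f xs) eq (∈-map⁺ f x∈)))
  Unique-map-injective (_ ∷ u) (there x∈) (there y∈) eq = Unique-map-injective u x∈ y∈ eq

  map-∷ʳ⁻ : ∀ {B : Set} (f : A → B) xs {ys y} → map f xs ≡ ys ++ y ∷ [] →
            ∃₂ λ zs z → xs ≡ zs ++ z ∷ [] × map f zs ≡ ys × f z ≡ y
  map-∷ʳ⁻ f (x ∷ [])      {[]}     refl = [] , x , refl , refl , refl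
  map-∷ʳ⁻ f (x ∷ [])      {y ∷ []} ()
  map-∷ʳ⁻ f (x ∷ x′ ∷ xs) {[]}     ()
  map-∷ʳ⁻ f (x ∷ xs@(_ ∷ _)) {y ∷ ys} eq with map-∷ʳ⁻ f xs (∷-injectiveʳ eq)
  ... | zs , z , eq₀ , eq′ , fz = x ∷ zs , z , cong (x ∷_) eq₀ , cong₂ _∷_ (∷-injectiveˡ eq) eq′ , fz

  ∈-∷⁻ : ∀ {x y : A} {xs} → x ∈ y ∷ xs → x ≢ y → x ∈ xs
  ∈-∷⁻ (here x≡y) x≢y = ⊥-elim (x≢y x≡y)
  ∈-∷⁻ (there x∈) _   = x∈

  module _ (_≟A_ : DecidableEquality A) where

    open import Data.List.Membership.DecPropositional _≟A_ using (_∈?_)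

    abstract
      fresh : (xs bad : List A) → Unique xs → length bad < length xs → ∃ λ x → x ∈ xs × x ∉ bad
      fresh xs bad u lt with All.all? (_∈? bad) xs
      ... | yes all∈ = contradiction (≤-trans lt (Unique-⊆⇒length≤ u (All.lookup all∈))) (<-irrefl refl)
      ... | no ¬all∈ = find xs ¬all∈
        where
        find : ∀ ys → ¬ All (_∈ bad) ys → ∃ λ x → x ∈ ys × x ∉ bad
        find []       ¬all = contradiction [] ¬all
        find (y ∷ ys) ¬all with y ∈? bad
        ... | no  y∉ = y , here refl , y∉
        ... | yes y∈ with find ys (¬all ∘ (y∈ ∷_))
        ...   | x , x∈ , x∉ = x , there x∈ , x∉

  bringTwo : {xs : List A} {a b : A} → a ∈ xs → b ∈ xs → a ≢ b → ∃ λ ys → xs ↭ a ∷ b ∷ ys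
  bringTwo a∈ b∈ a≢b with ∈⇒↭ a∈
  ... | ys , p with ∈-resp-↭ p b∈
  ...   | here eq = ⊥-elim (a≢b (≡-sym eq))
  ...   | there b∈′ with ∈⇒↭ b∈′
  ...     | zs , q = zs , ↭-trans p (prep _ q)

-- A record instead of the bare equation, so that the graph and both vertices can be inferred from
-- the type.
record Adj {n} (X : Graph n) (a b : Fin n) : Set where
  constructor edge
  field adj≡true : adj X a b ≡ true
open Adj public

module _ {n : ℕ} where

  open import Data.List.Membership.DecPropositional (_≟_ {n}) public using (_∈?_)

  private
    V = Fin n
    variable
      X Y : Graph n
      a b c d u v : V
      l m : List V

  Adj-sym : Adj X a b → Adj X b a
  Adj-sym {X} {a} {b} (edge e) = edge (trans (Graph.sym X b a) e)

  Adj? : ∀ (X : Graph n) a b → Dec (Adj X a b)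
  Adj? X a b = map′ edge adj≡true (adj X a b Bool.≟ true)

  Adj⇒≢ : Adj X a b → a ≢ b
  Adj⇒≢ {X} {a} (edge e) refl with () ← trans (≡-sym e) (irrefl X a)

  data Path (X : Graph n) : V → V → List V → Set where
    stop : ∀ a → Path X a a (a ∷ [])
    _∷_ : Adj X a b → Path X b c l → Path X a c (a ∷ l)

  Path-head : Path X a b (c ∷ l) → a ≡ c
  Path-head (stop _)   = refl
  Path-head (_ ∷ _) = refl

  Path-uncons : Path X a b (c ∷ l) → a ≡ c × (a ≡ b ⊎ ∃ λ d → Adj X a d × Path X d b l)
  Path-uncons (stop _) = refl , inj₁ refl
  Path-uncons (e ∷ p)  = refl , inj₂ (_ , e , p)

  Path-start∈ : Path X a b l → a ∈ l
  Path-start∈ (stop _)   = here refl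
  Path-start∈ (_ ∷ _) = here refl

  Path-end∈ : Path X a b l → b ∈ l
  Path-end∈ (stop _)   = here refl
  Path-end∈ (_ ∷ p) = there (Path-end∈ p)

  Path-++ : Path X a b l → Adj X b c → Path X c d m → Path X a d (l ++ m)
  Path-++ (stop _)   e q = e ∷ q
  Path-++ (e′ ∷ p) e q = e′ ∷ Path-++ p e q

  Path-reverse : Path X a b l → Path X b a (reverse l)
  Path-reverse (stop _) = (stop _)
  Path-reverse {X} {a} {b} {a ∷ l} (e ∷ p) =
    subst (Path X b a) (≡-sym (unfold-reverse a l)) (Path-++ (Path-reverse p) (Adj-sym e) (stop a))

  Path-resp : (∀ {x y} → x ∈ l → y ∈ l → Adj X x y → Adj Y x y) → Path X a b l → Path Y a b l
  Path-resp f (stop a)  = stop a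
  Path-resp f (e ∷ p) = f (here refl) (there (Path-start∈ p)) e ∷
                        Path-resp (λ x∈ y∈ → f (there x∈) (there y∈)) p

  Path-split : ∀ p {x y q} → Path X a b (x ∷ p ++ y ∷ q) →
               ∃ λ c → Path X a c (x ∷ p) × Adj X c y × Path X y b (y ∷ q)
  Path-split []      (e ∷ r) with refl ← Path-head r = _ , stop _ , e , r
  Path-split (z ∷ p) (e ∷ r) with refl ← Path-head r with Path-split p r
  ... | c , s , e′ , t = c , (e ∷ s) , e′ , t

  Path-end-unique : Path X a b l → Path Y c d l → b ≡ d
  Path-end-unique (stop _)         (stop _)         = refl
  Path-end-unique (_ ∷ p@(stop _)) (_ ∷ q)          = Path-end-unique p q
  Path-end-unique (_ ∷ p@(_ ∷ _))  (_ ∷ q)          = Path-end-unique p q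

  Path-last : ∀ l → Path X a b (l ++ c ∷ []) → b ≡ c
  Path-last []          (stop _) = refl
  Path-last (_ ∷ [])    (_ ∷ p)  = Path-last [] p
  Path-last (_ ∷ l@(_ ∷ _)) (_ ∷ p) = Path-last l p

  Path-ends≢ : Path X a b l → Unique l → 2 ≤ length l → a ≢ b
  Path-ends≢ (stop _) u (s≤s ()) refl
  Path-ends≢ (e ∷ p)  u _        refl = Unique[x∷xs]⇒x∉xs u (Path-end∈ p)

  Path? : ∀ (X : Graph n) a b l → Dec (Path X a b l)
  Path? X a b [] = no λ ()
  Path? X a b (x ∷ []) with a ≟ x | b ≟ x
  ... | yes refl | yes refl = yes (stop _)
  ... | yes refl | no b≢    = no λ where (stop _) → b≢ refl
                                         (_ ∷ ())
  ... | no a≢    | _        = no λ p → a≢ (Path-head p)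
  Path? X a b (x ∷ y ∷ l) with a ≟ x | Adj? X x y | Path? X y b (y ∷ l)
  ... | no a≢    | _      | _      = no λ p → a≢ (Path-head p)
  ... | yes refl | no ¬e  | _      = no λ where (e ∷ p) → ¬e (subst (λ z → Adj X a z) (Path-head p) e)
  ... | yes refl | yes _  | no ¬p  = no λ where (e ∷ p) → ¬p (subst (λ z → Path X z b (y ∷ l)) (Path-head p) p)
  ... | yes refl | yes e  | yes p  = yes (e ∷ p)

  -- A cycle comes with a start and a direction, so a cycle on `k` vertices is represented by `2k`
  -- lists. Only numbers of such lists are ever compared, so the factor does no harm.
  Cyc : Graph n → List V → Set
  Cyc X l = 3 ≤ length l × Unique l × ∃₂ λ a b → Path X a b l × Adj X b a

  Cyc-rotate : ∀ p q → Cyc X (p ++ q) → Cyc X (q ++ p)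
  Cyc-rotate {X} [] q c = subst (Cyc X) (≡-sym (++-identityʳ q)) c
  Cyc-rotate {X} (x ∷ p) [] c = subst (Cyc X) (++-identityʳ (x ∷ p)) c
  Cyc-rotate (x ∷ p) (y ∷ q) (len , u , a , b , r , e) with Path-split p r
  ... | c , s , e′ , t =
    subst (3 ≤_) (↭-length σ) len , Unique-↭ σ u , _ , c , Path-++ t e s , e′
    where σ = ++-comm (x ∷ p) (y ∷ q)

  -- Distinct ends `a` and `b` take the place of the lower bound on the length.
  Cyc-intro : Path X a b m → Adj X u a → Adj X b u → a ≢ b → u ∉ m → Unique m → Cyc X (u ∷ m)
  Cyc-intro p@((stop _)) e e′ a≢b u∉ uq = ⊥-elim (a≢b refl)
  Cyc-intro p@(_ ∷ (stop _)) e e′ a≢b u∉ uq =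
    s≤s (s≤s (s≤s z≤n)) , Unique-∷ u∉ uq , _ , _ , e ∷ p , e′
  Cyc-intro p@(_ ∷ (_ ∷ _)) e e′ a≢b u∉ uq =
    s≤s (s≤s (s≤s z≤n)) , Unique-∷ u∉ uq , _ , _ , e ∷ p , e′

  Cyc-elim : Cyc X (u ∷ m) → ∃₂ λ a b →
             Path X a b m × Adj X u a × Adj X b u × a ≢ b × u ∉ m × Unique m
  Cyc-elim (len , uq@(_ ∷ uq′) , _ , _ , stop _ , e′) with s≤s () ← len
  Cyc-elim (len , uq@(_ ∷ uq′) , _ , _ , (e ∷ (stop _)) , e′) with s≤s (s≤s ()) ← len
  Cyc-elim (len , uq@(_ ∷ uq′) , _ , b , (e ∷ p@(_ ∷ q)) , e′) =
    _ , b , p , e , e′ , (λ { refl → Unique[x∷xs]⇒x∉xs uq′ (Path-end∈ q) }) , Unique[x∷xs]⇒x∉xs uq , uq′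

  -- The equivalence holds in all graphs at once, so that the rotated list can
  -- be moved to another graph and rotated back there.
  rotateTo : u ∈ l → ∃ λ m → l ↭ u ∷ m ×
             (∀ {X} → Cyc X l → Cyc X (u ∷ m)) × (∀ {X} → Cyc X (u ∷ m) → Cyc X l)
  rotateTo {u} u∈ with ∈-∃++ u∈
  ... | p , q , refl = q ++ p , ++-comm p (u ∷ q) , Cyc-rotate p (u ∷ q) , Cyc-rotate (u ∷ q) p

  Cyc? : ∀ (X : Graph n) l → Dec (Cyc X l)
  Cyc? X l = (3 ≤? length l) ×-dec unique? l ×-dec
    any? λ a → any? λ b → Path? X a b l ×-dec Adj? X b a
    where
    open import Data.List.Relation.Unary.Unique.DecPropositional (_≟_ {n}) using (unique?)

-- Cycles created by an exchange

record Nbr3 {n} (X : Graph n) (v a b c : Fin n) : Set where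
  constructor nbr3
  field
    ≢₁₂      : a ≢ b
    ≢₁₃      : a ≢ c
    ≢₂₃      : b ≢ c
    ~₁      : Adj X v a
    ~₂      : Adj X v b
    ~₃      : Adj X v c
    complete : ∀ {z} → Adj X v z → z ∈ a ∷ b ∷ c ∷ []
open Nbr3 public

record Agree {n} (X Y : Graph n) (u v : Fin n) : Set where
  constructor agreement
  field agrees : ∀ {x y} → x ≢ u → x ≢ v → y ≢ u → y ≢ v → adj Y x y ≡ adj X x y
open Agree public

module _ {n : ℕ} where

  private
    V = Fin n
    variable
      X Y : Graph n
      a b c d u v w x y z : V
      l m : List V

  Unique3 : a ≢ b → a ≢ c → b ≢ c → Unique (a ∷ b ∷ c ∷ [])
  Unique3 ≢₁₂ ≢₁₃ ≢₂₃ = (≢₁₂ ∷ ≢₁₃ ∷ []) ∷ (≢₂₃ ∷ []) ∷ [] ∷ []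

  Nbr3-unique : Nbr3 X v a b c → Unique (a ∷ b ∷ c ∷ [])
  Nbr3-unique N = Unique3 (≢₁₂ N) (≢₁₃ N) (≢₂₃ N)

  neighbour : Nbr3 X v a b c → x ∈ a ∷ b ∷ c ∷ [] → Adj X v x
  neighbour N (here refl)                 = ~₁ N
  neighbour N (there (here refl))         = ~₂ N
  neighbour N (there (there (here refl))) = ~₃ N

  abstract
    Nbr3-replace : Nbr3 X v a b c → x ≢ y → x ≢ z → y ≢ z →
                   Adj X v x → Adj X v y → Adj X v z → Nbr3 X v x y z
    Nbr3-replace {X} {v} {a} {b} {c} {x} {y} {z} N x≢y x≢z y≢z vx vy vz =
      nbr3 x≢y x≢z y≢z vx vy vz complete′
      where
      complete′ : ∀ {w} → Adj X v w → w ∈ x ∷ y ∷ z ∷ []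
      complete′ {w} vw with w ∈? (x ∷ y ∷ z ∷ [])
      ... | yes w∈ = w∈
      ... | no  w∉ = contradiction
        (Unique-⊆⇒length≤ {ys = a ∷ b ∷ c ∷ []} (Unique-∷ w∉ (Unique3 x≢y x≢z y≢z)) sub)
        λ { (s≤s (s≤s (s≤s ()))) }
        where
        sub : (w ∷ x ∷ y ∷ z ∷ []) ⊆ (a ∷ b ∷ c ∷ [])
        sub (here refl)                         = complete N vw
        sub (there (here refl))                 = complete N vx
        sub (there (there (here refl)))         = complete N vy
        sub (there (there (there (here refl)))) = complete N vz

    Nbr3-third : Nbr3 X v a b c → Adj X v x → Adj X v y → x ≢ y → ∃ λ z → Nbr3 X v x y z
    Nbr3-third {X} {v} {a} {b} {c} {x} {y} N vx vy x≢y
      with fresh _≟_ (a ∷ b ∷ c ∷ []) (x ∷ y ∷ []) (Nbr3-unique N) (s≤s (s≤s (s≤s z≤n)))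
    ... | z , z∈ , z∉ = z , Nbr3-replace N x≢y (λ { refl → z∉ (here refl) })
                              (λ { refl → z∉ (there (here refl)) }) vx vy (neighbour N z∈)

    Nbr3-extend : (∃ λ a → ∃₂ λ b c → Nbr3 X v a b c) → Adj X v x → ∃₂ λ y z → Nbr3 X v x y z
    Nbr3-extend {x = x} (a , b , c , N) vx
      with fresh _≟_ (a ∷ b ∷ c ∷ []) (x ∷ []) (Nbr3-unique N) (s≤s (s≤s z≤n))
    ... | y , y∈ , y∉ = y , Nbr3-third N vx (neighbour N y∈) λ { refl → y∉ (here refl) }

  Nbr3-swap : Nbr3 X v a b c → Nbr3 X v a c b
  Nbr3-swap N = Nbr3-replace N (≢₁₃ N) (≢₁₂ N) (≢-sym (≢₂₃ N)) (~₁ N) (~₃ N) (~₂ N)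

  Agree-sym : Agree X Y u v → Agree Y X u v
  Agree-sym (agreement f) = agreement λ p q r s → ≡-sym (f p q r s)

  Agree-swap : Agree X Y u v → Agree X Y v u
  Agree-swap (agreement f) = agreement λ p q r s → f q p s r

  ∉⇒≢ : x ∈ l → u ∉ l → x ≢ u
  ∉⇒≢ x∈ u∉ refl = u∉ x∈

  Adj-agree : Agree X Y u v → x ≢ u → x ≢ v → y ≢ u → y ≢ v → Adj X x y → Adj Y x y
  Adj-agree agree p q r s (edge e) = edge (trans (agrees agree p q r s) e)

  Path-agree : Agree X Y u v → u ∉ l → v ∉ l → Path X a b l → Path Y a b l
  Path-agree agree u∉ v∉ = Path-resp λ x∈ y∈ e →
    Adj-agree agree (∉⇒≢ x∈ u∉) (∉⇒≢ x∈ v∉) (∉⇒≢ y∈ u∉) (∉⇒≢ y∈ v∉) e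

  Cyc-agree : Agree X Y u v → u ∉ l → v ∉ l → Cyc X l → Cyc Y l
  Cyc-agree agree u∉ v∉ (len , uq , a , b , p , e) =
    len , uq , a , b , Path-agree agree u∉ v∉ p ,
    Adj-agree agree (∉⇒≢ b∈ u∉) (∉⇒≢ b∈ v∉) (∉⇒≢ a∈ u∉) (∉⇒≢ a∈ v∉) e
    where
    a∈ = Path-start∈ p
    b∈ = Path-end∈ p

  Girth≥ : ℕ → Graph n → Set
  Girth≥ g X = ∀ {l} → Cyc X l → g ≤ length l

  -- Y arises from X by exchanging the neighbour b of u with the neighbour c of v.
  record Switched (g : ℕ) (X Y : Graph n) (u v a b c d : V) : Set where
    field
      agree : Agree X Y u v
      Xu    : Nbr3 X u v a b
      Xv    : Nbr3 X v u c d
      Yu    : Nbr3 Y u v a c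
      Yv    : Nbr3 Y v u b d
      girthX : Girth≥ g X
  open Switched public

  Switched-flip : ∀ {g} → Switched g X Y u v a b c d → Switched g X Y v u d c b a
  Switched-flip S = record
    { agree = Agree-swap (agree S)
    ; Xu = Nbr3-swap (Xv S) ; Xv = Nbr3-swap (Xu S)
    ; Yu = Nbr3-swap (Yv S) ; Yv = Nbr3-swap (Yu S)
    ; girthX = girthX S }

  -- A path on the card without `u` and `v`: an exchange at these two vertices does not affect it.
  CardPath : Graph n → (u v p q : V) → ℕ → Set
  CardPath X u v p q k =
    ∃ λ l → Path X p q l × Unique l × u ∉ l × v ∉ l × length l ≡ k

  CardPath-reverse : ∀ {k p q} → CardPath X u v p q k → CardPath X u v q p k
  CardPath-reverse {X} (l , p , uq , u∉ , v∉ , len) =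
    reverse l , Path-reverse {X = X} p , Unique-↭ (↭-sym (↭-reverse l)) uq ,
    u∉ ∘ ∈-resp-↭ (↭-reverse l) , v∉ ∘ ∈-resp-↭ (↭-reverse l) ,
    trans (length-reverse l) len

  CardPath-swap : ∀ {k p q} → CardPath X u v p q k → CardPath X v u p q k
  CardPath-swap (l , p , uq , u∉ , v∉ , len) = l , p , uq , v∉ , u∉ , len

  -- A `g`-cycle through exactly one of `u` and `v` leaves `2 + k` vertices on the card, one through
  -- both leaves `1 + k`.
  module _ {g k : ℕ} (g≡ : g ≡ 3 + k) where

    private
      rotated : ∀ {Y : Graph n} → u ∈ l → Cyc Y l → length l ≡ g →
                ∃ λ m → Cyc Y (u ∷ m) × length (u ∷ m) ≡ g × (∀ {x} → x ∈ m → x ∈ l) ×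
                (∀ {X} → Cyc X (u ∷ m) → Cyc X l)
      rotated u∈ c len with rotateTo u∈
      ... | m , σ , fwd , bwd =
        m , fwd c , trans (≡-sym (↭-length σ)) len , ∈-resp-↭ (↭-sym σ) ∘ there , bwd

    -- A cycle of `Y` that avoids `v` enters and leaves `u` by the two other neighbours `a` and `c`.
    newCycle-throughOne : Switched g X Y u v a b c d → Cyc Y (u ∷ m) →
                          length (u ∷ m) ≡ g → v ∉ m → CardPath X u v a c (2 + k)
    newCycle-throughOne S cyc len v∉ with Cyc-elim cyc
    ... | h , t , p , uh , tu , h≢t , u∉ , uq
      with complete (Yu S) uh | complete (Yu S) (Adj-sym tu)
    ... | here refl | _ = ⊥-elim (v∉ (Path-start∈ p))
    ... | there _ | here refl = ⊥-elim (v∉ (Path-end∈ p))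
    ... | there (here refl) | there (here refl) = ⊥-elim (h≢t refl)
    ... | there (there (here refl)) | there (there (here refl)) = ⊥-elim (h≢t refl)
    ... | there (here refl) | there (there (here refl)) =
      _ , Path-agree (Agree-sym (agree S)) u∉ v∉ p , uq , u∉ , v∉ , suc-injective (trans len g≡)
    ... | there (there (here refl)) | there (here refl) = CardPath-reverse
      (_ , Path-agree (Agree-sym (agree S)) u∉ v∉ p , uq , u∉ , v∉ , suc-injective (trans len g≡))

    -- The rest of the cycle runs from `b` or `d` to `a` or `c`. In `X`, a path from `b` to `a`
    -- closes up at `u` and one from `d` to `c` at `v`, to a cycle with `g - 1` vertices; a path
    -- from `d` to `a` makes the cycle one of `X`.
    newCycle-consecutive : Switched g X Y u v a b c d → Cyc Y (u ∷ v ∷ m) →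
                           length (u ∷ v ∷ m) ≡ g → ¬ Cyc X (u ∷ v ∷ m) →
                           CardPath X u v b c (1 + k)
    newCycle-consecutive {m = []} S cyc len ¬cyc with () ← trans len g≡
    newCycle-consecutive {X = X} {u = u} {v} {a} {b} {c} {d} {m = m@(_ ∷ _)} S cyc len ¬cyc with Cyc-elim cyc
    ... | h , t , (vh ∷ p) , uv , tu , h≢t , u∉vm , uq@(_ ∷ uq′) =
      cases (complete (Yv S) vh) (complete (Yu S) (Adj-sym tu)) p′
      where
      v∉m : v ∉ m
      v∉m = Unique[x∷xs]⇒x∉xs uq
      u∉m : u ∉ m
      u∉m = u∉vm ∘ there
      p′ : Path X _ t m
      p′ = Path-agree (Agree-sym (agree S)) u∉m v∉m p
      short : ∀ {w} → ¬ Cyc X (w ∷ m)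
      short cyc′ = <-irrefl refl (≤-trans (≤-reflexive len) (girthX S cyc′))
      cases : ∀ {h′ t} → h′ ∈ u ∷ b ∷ d ∷ [] → t ∈ v ∷ a ∷ c ∷ [] → Path X h′ t m →
              CardPath X u v b c (1 + k)
      cases (here refl) _ q = ⊥-elim (u∉m (Path-start∈ q))
      cases (there _) (here refl) q = ⊥-elim (v∉m (Path-end∈ q))
      cases (there (here refl)) (there (here refl)) q =
        ⊥-elim (short (Cyc-intro q (~₃ (Xu S)) (Adj-sym (~₂ (Xu S))) (≢-sym (≢₂₃ (Xu S))) u∉m uq′))
      cases (there (there (here refl))) (there (there (here refl))) q =
        ⊥-elim (short (Cyc-intro q (~₃ (Xv S)) (Adj-sym (~₂ (Xv S))) (≢-sym (≢₂₃ (Xv S))) v∉m uq′))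
      cases (there (there (here refl))) (there (here refl)) q =
        ⊥-elim (¬cyc (Cyc-intro (~₃ (Xv S) ∷ q) (~₁ (Xu S)) (Adj-sym (~₂ (Xu S)))
          (∉⇒≢ (Path-end∈ q) v∉m ∘ ≡-sym) u∉vm uq))
      cases (there (here refl)) (there (there (here refl))) q =
        m , q , uq′ , u∉m , v∉m , suc-injective (suc-injective (trans len g≡))

    -- Each of the two arcs joins one of `a`, `c` to one of `b`, `d`. In `X`, an arc between `a` and
    -- `b` closes up at `u` and one between `c` and `d` at `v`, both too short. The remaining pairs
    -- `a`, `d` and `c`, `b` close up over the edge `uv`.
    newCycle-separated : Switched g X Y u v a b c d → ∀ m₁ {m₂} → m₁ ≢ [] → m₂ ≢ [] →
                         Cyc Y (u ∷ m₁ ++ v ∷ m₂) → length (u ∷ m₁ ++ v ∷ m₂) ≡ g → 3 ≤ g → ⊥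
    newCycle-separated S [] m₁≢[] = ⊥-elim (m₁≢[] refl)
    newCycle-separated S (_ ∷ _) {[]} _ m₂≢[] = ⊥-elim (m₂≢[] refl)
    newCycle-separated {X = X} {Y} {u} {v} {a} {b} {c} {d} S m₁@(x ∷ m₁′) {m₂@(y ∷ m₂′)} _ _ cyc len 3≤g
      with Cyc-elim cyc
    ... | h , t , p , uh , tu , h≢t , u∉ , uq with refl ← Path-head p with Path-split m₁′ p
    ...   | t₁ , p₁ , t₁v , (vh₂ ∷ p₂) =
      cases (complete (Yu S) uh) (complete (Yu S) (Adj-sym tu))
            (complete (Yv S) (Adj-sym t₁v)) (complete (Yv S) vh₂)
            (Path-agree (Agree-sym (agree S)) u∉₁ v∉₁ p₁)
            (Path-agree (Agree-sym (agree S)) u∉₂ v∉₂ p₂)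
            h≢t (λ eq → Unique⇒disjoint m₁ uq (Path-end∈ p₁)
                          (there (subst (_∈ m₂) (≡-sym eq) (Path-start∈ p₂))))
      where
      u∉₁ : u ∉ m₁
      u∉₁ = u∉ ∘ ∈-++⁺ˡ
      u∉₂ : u ∉ m₂
      u∉₂ = u∉ ∘ ∈-++⁺ʳ m₁ ∘ there
      uq₁ = Unique-++⁻ˡ m₁ uq
      v∉₁ : v ∉ m₁
      v∉₁ v∈ = Unique⇒disjoint m₁ uq v∈ (here refl)
      uq₂ : Unique (v ∷ m₂)
      uq₂ = Unique-++⁻ʳ m₁ uq
      v∉₂ : v ∉ m₂
      v∉₂ = Unique[x∷xs]⇒x∉xs uq₂
      total : 2 + (length m₁ + length m₂) ≡ g
      total = trans (cong suc (trans (≡-sym (+-suc (length m₁) (length m₂))) (≡-sym (length-++ m₁)))) len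

      -- The two arcs of the cycle would close up to two cycles of X of total
      -- length g + 2.
      tooShort : g ≤ 2 + length m₁ → g ≤ 2 + length m₂ → ⊥
      tooShort le₁ le₂ = <-irrefl refl (≤-trans 3≤g (+-cancelʳ-≤ g g 2 (begin
        g + g                               ≤⟨ +-mono-≤ le₁ le₂ ⟩
        2 + length m₁ + (2 + length m₂)     ≡⟨ regroup (length m₁) (length m₂) ⟩
        2 + (2 + (length m₁ + length m₂))   ≡⟨ cong (2 +_) total ⟩
        2 + g                               ∎)))
        where
        open ≤-Reasoning
        regroup : ∀ i j → 2 + i + (2 + j) ≡ 2 + (2 + (i + j))
        regroup = solve-∀

      short : ∀ {w} → ¬ Cyc X (w ∷ m₁)
      short cyc′ = <-irrefl refl (≤-trans (begin
        2 + length m₁                   ≤⟨ s≤s (s≤s (m≤m+n _ _)) ⟩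
        2 + (length m₁ + length m₂)     ≡⟨ total ⟩
        g                               ∎) (girthX S cyc′))
        where open ≤-Reasoning

      around : ∀ {w w′ p q m} → Path X p q m → Adj X w w′ → Adj X w′ p → Adj X w q →
               w ∉ m → w′ ∉ m → Unique m → g ≤ 2 + length m
      around {w} {w′} {m = m} r ww′ w′p wq w∉ w′∉ um =
        girthX S (Cyc-intro (w′p ∷ r) ww′ (Adj-sym wq) (∉⇒≢ (Path-end∈ r) w′∉ ∘ ≡-sym)
          (λ { (here eq) → Adj⇒≢ ww′ eq ; (there w∈) → w∉ w∈ }) (Unique-∷ w′∉ um))

      uv : Adj X u v
      uv = ~₁ (Xu S)
      vu : Adj X v u
      vu = ~₁ (Xv S)

      cases : ∀ {h t t₁ h₂} → h ∈ v ∷ a ∷ c ∷ [] → t ∈ v ∷ a ∷ c ∷ [] →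
              t₁ ∈ u ∷ b ∷ d ∷ [] → h₂ ∈ u ∷ b ∷ d ∷ [] →
              Path X h t₁ m₁ → Path X h₂ t m₂ → h ≢ t → t₁ ≢ h₂ → ⊥
      cases (here refl) _ _ _ q₁ q₂ _ _ = v∉₁ (Path-start∈ q₁)
      cases _ (here refl) _ _ q₁ q₂ _ _ = v∉₂ (Path-end∈ q₂)
      cases _ _ (here refl) _ q₁ q₂ _ _ = u∉₁ (Path-end∈ q₁)
      cases _ _ _ (here refl) q₁ q₂ _ _ = u∉₂ (Path-start∈ q₂)
      cases (there (here refl)) _ (there (here refl)) _ q₁ q₂ _ _ =
        short (Cyc-intro q₁ (~₂ (Xu S)) (Adj-sym (~₃ (Xu S))) (≢₂₃ (Xu S)) u∉₁ uq₁)
      cases (there (there (here refl))) _ (there (there (here refl))) _ q₁ q₂ _ _ =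
        short (Cyc-intro q₁ (~₂ (Xv S)) (Adj-sym (~₃ (Xv S))) (≢₂₃ (Xv S)) v∉₁ uq₁)
      cases (there (here refl)) (there (here refl)) _ _ _ _ h≢t _ = h≢t refl
      cases (there (there (here refl))) (there (there (here refl))) _ _ _ _ h≢t _ = h≢t refl
      cases _ _ (there (here refl)) (there (here refl)) _ _ _ t₁≢h₂ = t₁≢h₂ refl
      cases _ _ (there (there (here refl))) (there (there (here refl))) _ _ _ t₁≢h₂ = t₁≢h₂ refl
      cases (there (here refl)) (there (there (here refl))) (there (there (here refl))) (there (here refl)) q₁ q₂ _ _ =
        tooShort (around q₁ vu (~₂ (Xu S)) (~₃ (Xv S)) v∉₁ u∉₁ uq₁)
                 (around q₂ vu (~₃ (Xu S)) (~₂ (Xv S)) v∉₂ u∉₂ (Unique-++⁻ʳ (v ∷ []) uq₂))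
      cases (there (there (here refl))) (there (here refl)) (there (here refl)) (there (there (here refl))) q₁ q₂ _ _ =
        tooShort (around q₁ uv (~₂ (Xv S)) (~₃ (Xu S)) u∉₁ v∉₁ uq₁)
                 (around q₂ uv (~₃ (Xv S)) (~₂ (Xu S)) u∉₂ v∉₂ (Unique-++⁻ʳ (v ∷ []) uq₂))

    abstract
      -- Since the number of `g`-cycles does not change, an exchange that destroys one must produce
      -- one of these paths.
      newCycle : Switched g X Y u v a b c d → Cyc Y l → length l ≡ g → ¬ Cyc X l →
                 CardPath X u v a c (2 + k) ⊎ CardPath X u v b d (2 + k) ⊎ CardPath X u v b c (1 + k)
      newCycle {u = u} {v} {l = l} S cyc len ¬cyc with u ∈? l
      ... | no u∉ with v ∈? l
      ...   | no v∉  = ⊥-elim (¬cyc (Cyc-agree (Agree-sym (agree S)) u∉ v∉ cyc))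
      ...   | yes v∈ with rotated v∈ cyc len
      ...     | m , cyc′ , len′ , m⊆l , _ =
        inj₂ (inj₁ (CardPath-reverse (CardPath-swap (newCycle-throughOne (Switched-flip S) cyc′ len′ (u∉ ∘ m⊆l)))))
      newCycle {u = u} {v} {l = l} S cyc len ¬cyc | yes u∈ with rotated u∈ cyc len
      ... | m , cyc′ , len′ , _ , back with v ∈? m
      ...   | no v∉ = inj₁ (newCycle-throughOne S cyc′ len′ v∉)
      ...   | yes v∈ with ∈-∃++ v∈
      ...     | [] , m₂ , refl = inj₂ (inj₂ (newCycle-consecutive S cyc′ len′ (¬cyc ∘ back)))
      ...     | m₁@(_ ∷ _) , [] , refl = inj₂ (inj₂ (CardPath-reverse (CardPath-swap
        (newCycle-consecutive (Switched-flip S) (Cyc-rotate (u ∷ m₁) (v ∷ []) cyc′)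
          (trans (↭-length (++-comm (v ∷ []) (u ∷ m₁))) len′)
          (¬cyc ∘ back ∘ Cyc-rotate (v ∷ []) (u ∷ m₁))))))
      ...     | m₁@(_ ∷ _) , (_ ∷ _) , refl =
        ⊥-elim (newCycle-separated S m₁ (λ ()) (λ ()) cyc′ len′
          (≤-trans (m≤m+n 3 _) (≤-reflexive (≡-sym g≡))))

-- A shortest cycle

module Core {n : ℕ} (j : ℕ) (K : Graph n → Set)
  (cubic : ∀ {X} → K X → ∀ v → ∃ λ a → ∃₂ λ b c → Nbr3 X v a b c)
  (girth : ∀ {X} → K X → Girth≥ (5 + j) X)
  (switch : ∀ {X u v a b c d} → K X → Nbr3 X u v a b → Nbr3 X v u c d →
            a ≢ c → a ≢ d → b ≢ c → b ≢ d →
            ∃ λ Y → K Y × Agree X Y u v ×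
            ((Nbr3 Y u v a c × Nbr3 Y v u b d) ⊎ (Nbr3 Y u v a d × Nbr3 Y v u b c)))
  -- Equality of the numbers of `g`-cycles in the form in which it is applied: an exchange that
  -- creates none destroys none. The bound makes a `g`-cycle fit on a card.
  (sameCount : 5 + j + 2 ≤ n → ∀ {X Y} → K X → K Y →
               (∀ {l} → length l ≡ 5 + j → Cyc Y l → Cyc X l) →
               ∀ {l} → length l ≡ 5 + j → Cyc X l → Cyc Y l)
  where

  private
    g : ℕ
    g = 5 + j
    V = Fin n
    variable
      X Y : Graph n
      a b c d e s u v w x y z : V
      l m vs ws : List V

  noTriangle : K X → Adj X u v → Adj X u a → Adj X v a → ⊥
  noTriangle kX uv ua va = contradiction
    (girth kX (Cyc-intro (va ∷ stop _) uv (Adj-sym ua) (Adj⇒≢ va)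
      (λ { (here eq) → Adj⇒≢ uv eq ; (there (here eq)) → Adj⇒≢ ua eq })
      (Unique-∷ (λ { (here eq) → Adj⇒≢ va eq }) ([] ∷ []))))
    λ { (s≤s (s≤s (s≤s ()))) }

  switchEdge : K X → Nbr3 X u v a b → Nbr3 X v u c d →
               ∃ λ Y → K Y × (Switched g X Y u v a b c d ⊎ Switched g X Y u v a b d c)
  switchEdge {X} {u} {v} {a} {b} {c} {d} kX Nu Nv
    with switch kX Nu Nv a≢c a≢d b≢c b≢d
    where
    a≢c : a ≢ c
    a≢c refl = noTriangle kX (~₁ Nu) (~₂ Nu) (~₂ Nv)
    a≢d : a ≢ d
    a≢d refl = noTriangle kX (~₁ Nu) (~₂ Nu) (~₃ Nv)
    b≢c : b ≢ c
    b≢c refl = noTriangle kX (~₁ Nu) (~₃ Nu) (~₂ Nv)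
    b≢d : b ≢ d
    b≢d refl = noTriangle kX (~₁ Nu) (~₃ Nu) (~₃ Nv)
  ... | Y , kY , ag , inj₁ (Nu′ , Nv′) = Y , kY , inj₁ record
    { agree = ag ; Xu = Nu ; Xv = Nv ; Yu = Nu′ ; Yv = Nv′ ; girthX = girth kX }
  ... | Y , kY , ag , inj₂ (Nu′ , Nv′) = Y , kY , inj₂ record
    { agree = ag ; Xu = Nu ; Xv = Nbr3-swap Nv ; Yu = Nu′ ; Yv = Nv′ ; girthX = girth kX }

  -- Lengths of paths are counted in vertices throughout.
  OffPath : Graph n → List V → V → V → List V → Set
  OffPath X vs w w′ l = Path X w w′ l × Unique l × (∀ {z} → z ∈ l → z ∉ vs)

  OffPath-reverse : OffPath X vs a b l → OffPath X vs b a (reverse l)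
  OffPath-reverse {l = l} (p , uq , off) =
    Path-reverse p , Unique-↭ (↭-sym (↭-reverse l)) uq , off ∘ ∈-resp-↭ (↭-reverse l)

  -- The outer neighbours of a shortest cycle and their rearrangement.

  outer : K X → Cyc X vs → length vs ≡ g → v ∈ vs →
          ∃ λ w → Adj X v w × w ∉ vs × (∀ {w′} → Adj X v w′ → w′ ∉ vs → w′ ≡ w)
  outer {X} {vs} {v} kX cyc len v∈ with rotateTo v∈
  ... | m , σ , fwd , _ with Cyc-elim (fwd cyc)
  ... | h , t , p , vh , tv , h≢t , v∉ , uq with cubic kX v
  ... | _ , _ , _ , N₀ with Nbr3-third N₀ vh (Adj-sym tv) h≢t
  ... | w , N = w , ~₃ N , w∉ , only
    where
    inZ : ∀ {z} → z ∈ m → z ∈ vs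
    inZ = ∈-resp-↭ (↭-sym σ) ∘ there

    -- If the third neighbour of `v` lay on the cycle, the edge to it would be a chord and cut off a
    -- cycle with fewer than `g` vertices.
    w∉m : w ∉ m
    w∉m w∈ with ∈-∃++ w∈
    ... | [] , q , refl = ≢₁₃ N (Path-head p)
    ... | p₀@(_ ∷ p₀′) , [] , refl with Path-split p₀′ p
    ...   | _ , _ , _ , stop _ = ≢₂₃ N refl
    w∉m w∈ | p₀@(_ ∷ p₀′) , q@(_ ∷ q′) , refl with Path-split p₀′ p
    ...   | c , r , cw , _ = <-irrefl refl (begin-strict
      1 + length (p₀ ++ w ∷ [])        ≡⟨ cong suc (length-++ p₀) ⟩
      1 + (length p₀ + 1)              <⟨ s≤s (+-monoʳ-< (length p₀) (s≤s (s≤s z≤n))) ⟩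
      1 + (length p₀ + length (w ∷ q)) ≡⟨ cong suc (length-++ p₀) ⟨
      length (v ∷ p₀ ++ w ∷ q)         ≡⟨ ↭-length σ ⟨
      length vs                        ≡⟨ len ⟩
      g                                ≤⟨ girth kX (Cyc-intro (Path-++ r cw (stop w)) vh (Adj-sym (~₃ N)) (≢₁₃ N)
                                            (v∉ ∘ sub) (Unique-++⁻ˡ (p₀ ++ w ∷ []) (subst Unique (≡-sym (++-assoc p₀ (w ∷ []) q)) uq))) ⟩
      1 + length (p₀ ++ w ∷ [])        ∎)
      where
      open ≤-Reasoning hiding (stop)
      sub : ∀ {z} → z ∈ p₀ ++ w ∷ [] → z ∈ p₀ ++ w ∷ q
      sub {z} z∈ = subst (z ∈_) (++-assoc p₀ (w ∷ []) q) (∈-++⁺ˡ z∈)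

    w∉ : w ∉ vs
    w∉ w∈ with ∈-resp-↭ σ w∈
    ... | here eq  = Adj⇒≢ (~₃ N) (≡-sym eq)
    ... | there w∈m = w∉m w∈m

    only : ∀ {w′} → Adj X v w′ → w′ ∉ vs → w′ ≡ w
    only vw′ w′∉ with complete N vw′
    ... | here refl                 = ⊥-elim (w′∉ (inZ (Path-start∈ p)))
    ... | there (here refl)         = ⊥-elim (w′∉ (inZ (Path-end∈ p)))
    ... | there (there (here refl)) = refl

  -- The entries of zs are the vertices of the cycle vs₀, up to rotation, each
  -- paired with its neighbour off the cycle.
  module Arrangements (X₀ : Graph n) (vs₀ : List V) (len₀ : length vs₀ ≡ g) where

    -- `cyc` ties the order of `zs` to the cyclic order, and `same` freezes all adjacencies off the
    -- cycle, so that a path off the cycle survives every rearrangement.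
    record Arranged (zs : List (V × V)) : Set where
      field
        graph  : Graph n
        inK    : K graph
        cyc    : Cyc graph (map proj₁ zs)
        perm   : map proj₁ zs ↭ vs₀
        spokes : All (λ z → Adj graph (proj₁ z) (proj₂ z) × proj₂ z ∉ vs₀) zs
        same   : ∀ {x y} → x ∉ vs₀ → y ∉ vs₀ → adj graph x y ≡ adj X₀ x y
    open Arranged public

    Attainable : List V → Set
    Attainable ws = ∃ λ zs → Arranged zs × map proj₂ zs ≡ ws

    private
      variable
        zs : List (V × V)
        ws′ : List V
        z₁ z₂ : V × V

    Arranged-rotate : ∀ z → Arranged (z ∷ zs) → Arranged (zs ++ z ∷ [])
    Arranged-rotate {zs} z A = record
      { graph = graph A ; inK = inK A ; same = same A
      ; cyc    = subst (Cyc (graph A)) (≡-sym (map-++ proj₁ zs (z ∷ [])))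
                   (Cyc-rotate (proj₁ z ∷ []) (map proj₁ zs) (cyc A))
      ; perm   = subst (_↭ vs₀) (≡-sym (map-++ proj₁ zs (z ∷ [])))
                   (↭-trans (++-comm (map proj₁ zs) (proj₁ z ∷ [])) (perm A))
      ; spokes = All-++⁺ (All.tail (spokes A)) (All.head (spokes A) ∷ []) }

    Attainable-rotate : ∀ p q → Attainable (p ++ q) → Attainable (q ++ p)
    Attainable-rotate [] q R = subst Attainable (≡-sym (++-identityʳ q)) R
    Attainable-rotate (w ∷ p) q (z ∷ zs , A , eq) with refl ← ∷-injectiveˡ eq =
      subst Attainable (++-assoc q (w ∷ []) p)
        (Attainable-rotate p (q ++ w ∷ []) (zs ++ z ∷ [] , Arranged-rotate z A ,
          trans (map-++ proj₂ zs (z ∷ [])) (trans (cong (_++ w ∷ []) (∷-injectiveʳ eq)) (++-assoc p q (w ∷ [])))))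

    Arranged-length : Arranged zs → length (map proj₁ zs) ≡ g
    Arranged-length A = trans (↭-length (perm A)) len₀

    frontSwitch : ∀ {v₁ v₂ w₁ w₂ zs} (A : Arranged ((v₁ , w₁) ∷ (v₂ , w₂) ∷ zs)) →
      ∃₂ λ h t → Path (graph A) h t (map proj₁ zs) × Adj (graph A) t v₁ ×
      ∃ λ (A′ : Arranged ((v₁ , w₂) ∷ (v₂ , w₁) ∷ zs)) →
      Switched g (graph A) (graph A′) v₁ v₂ t w₁ w₂ h
    frontSwitch {v₁} {v₂} {w₁} {w₂} {zs} A with spokes A | Cyc-elim (cyc A)
    ... | (v₁w₁ , w₁∉) ∷ (v₂w₂ , w₂∉) ∷ sp | _ , t , q , v₁v₂ , tv₁ , v₂≢t , v₁∉ , uq@(_ ∷ uq′)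
      with Path-uncons q
    ... | refl , inj₁ v₂≡t = ⊥-elim (v₂≢t v₂≡t)
    ... | refl , inj₂ (h , v₂h , p) with cubic (inK A) v₁ | cubic (inK A) v₂
    ... | _ , _ , _ , M₁ | _ , _ , _ , M₂ = choose (switchEdge (inK A) N₁ N₂)
      where
      X₁ = graph A
      inZ : ∀ {z} → z ∈ v₁ ∷ v₂ ∷ map proj₁ zs → z ∈ vs₀
      inZ = ∈-resp-↭ (perm A)
      ∈Z≢∉Z : ∀ {z z′} → z ∈ v₁ ∷ v₂ ∷ map proj₁ zs → z′ ∉ vs₀ → z ≢ z′
      ∈Z≢∉Z z∈ z′∉ refl = z′∉ (inZ z∈)
      h∈ : _ ∈ v₁ ∷ v₂ ∷ map proj₁ zs
      h∈ = there (there (Path-start∈ p))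
      t∈ : t ∈ v₁ ∷ v₂ ∷ map proj₁ zs
      t∈ = there (there (Path-end∈ p))
      v₁∉zs : v₁ ∉ map proj₁ zs
      v₁∉zs = v₁∉ ∘ there
      v₂∉zs : v₂ ∉ map proj₁ zs
      v₂∉zs = Unique[x∷xs]⇒x∉xs uq
      N₁ : Nbr3 X₁ v₁ v₂ t w₁
      N₁ = Nbr3-replace M₁ v₂≢t (∈Z≢∉Z (there (here refl)) w₁∉) (∈Z≢∉Z t∈ w₁∉) v₁v₂ (Adj-sym tv₁) v₁w₁
      N₂ : Nbr3 X₁ v₂ v₁ w₂ _
      N₂ = Nbr3-replace M₂ (∈Z≢∉Z (here refl) w₂∉) (∉⇒≢ (Path-start∈ p) v₁∉zs ∘ ≡-sym)
             (≢-sym (∈Z≢∉Z h∈ w₂∉)) (Adj-sym v₁v₂) v₂w₂ v₂h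
      -- v₁ cannot become adjacent to both neighbours of the edge v₁v₂ on the
      -- cycle, since that would close a cycle of length g - 1.
      choose : (∃ λ Y → K Y × (Switched g X₁ Y v₁ v₂ t w₁ w₂ _ ⊎ Switched g X₁ Y v₁ v₂ t w₁ _ w₂)) → _
      choose (Y , kY , inj₁ S) = _ , t , p , tv₁ , record
        { graph = Y ; inK = kY ; perm = perm A
        ; cyc    = Cyc-intro (~₃ (Yv S) ∷ Path-agree ag v₁∉zs v₂∉zs p)
                     (~₁ (Yu S)) (Adj-sym (~₂ (Yu S))) v₂≢t v₁∉ uq
        ; spokes = (~₃ (Yu S) , w₂∉) ∷ (~₂ (Yv S) , w₁∉) ∷ All.tabulate λ {z} z∈ →
                     let e , off = All.lookup sp z∈ in
                     Adj-agree ag (∉⇒≢ (∈-map⁺ proj₁ z∈) v₁∉zs) (∉⇒≢ (∈-map⁺ proj₁ z∈) v₂∉zs)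
                       (≢-sym (∈Z≢∉Z (here refl) off)) (≢-sym (∈Z≢∉Z (there (here refl)) off)) e , off
        ; same   = λ x∉ y∉ → trans
                     (agrees ag (off-v₁ x∉) (off-v₂ x∉) (off-v₁ y∉) (off-v₂ y∉)) (same A x∉ y∉)
        } , S
        where
        ag = agree S
        off-v₁ : ∀ {z} → z ∉ vs₀ → z ≢ v₁
        off-v₁ z∉ = ≢-sym (∈Z≢∉Z (here refl) z∉)
        off-v₂ : ∀ {z} → z ∉ vs₀ → z ≢ v₂
        off-v₂ z∉ = ≢-sym (∈Z≢∉Z (there (here refl)) z∉)
      choose (Y , kY , inj₂ S) = ⊥-elim (<-irrefl refl (≤-trans
        (≤-reflexive (Arranged-length A))
        (girth kY (Cyc-intro (Path-agree ag v₁∉zs v₂∉zs p) (~₃ (Yu S)) (Adj-sym (~₂ (Yu S)))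
          (≢-sym (≢₂₃ (Yu S))) v₁∉zs uq′))))
        where
        ag = agree S

    Attainable-swap : Attainable (a ∷ b ∷ ws) → Attainable (b ∷ a ∷ ws)
    Attainable-swap (z₁ ∷ z₂ ∷ zs , A , eq)
      with refl ← ∷-injectiveˡ eq | refl ← ∷-injectiveˡ (∷-injectiveʳ eq)
      with frontSwitch A
    ... | _ , _ , _ , _ , A′ , _ = _ , A′ , cong (λ ws → _ ∷ _ ∷ ws) (∷-injectiveʳ (∷-injectiveʳ eq))

    Attainable-↭ : ws ↭ ws′ → Attainable ws → Attainable ws′
    Attainable-↭ {ws} {ws′} σ R =
      subst Attainable (++-identityʳ ws′) (go σ [] (subst Attainable (≡-sym (++-identityʳ ws)) R))
      where
      -- Only adjacent entries at the front can be swapped directly. To permute the tail, the head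
      -- is rotated to the end and waits there; `p` collects such entries.
      go : ∀ {ws ws′} → ws ↭ ws′ → ∀ p → Attainable (ws ++ p) → Attainable (ws′ ++ p)
      go refl p R = R
      go (prep {ws} {ws′} w σ) p R =
        Attainable-rotate (ws′ ++ p) (w ∷ [])
          (subst Attainable (≡-sym (++-assoc ws′ p (w ∷ [])))
            (go σ (p ++ w ∷ []) (subst Attainable (++-assoc ws p (w ∷ []))
              (Attainable-rotate (w ∷ []) (ws ++ p) R))))
      go (swap {ws} {ws′} x y σ) p R =
        Attainable-rotate (ws′ ++ p) (y ∷ x ∷ [])
          (subst Attainable (≡-sym (++-assoc ws′ p (y ∷ x ∷ [])))
            (go σ (p ++ y ∷ x ∷ []) (subst Attainable (++-assoc ws p (y ∷ x ∷ []))
              (Attainable-rotate (y ∷ x ∷ []) (ws ++ p) (Attainable-swap R)))))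
      go (_↭_.trans σ τ) p R = go τ p (go σ p R)

    OffPath-arranged : (A : Arranged zs) → OffPath X₀ vs₀ a b l → OffPath (graph A) vs₀ a b l
    OffPath-arranged A (p , uq , off) =
      Path-resp (λ x∈ y∈ e → edge (trans (same A (off x∈) (off y∈)) (adj≡true e))) p , uq , off

    OffPath-original : (A : Arranged zs) → OffPath (graph A) vs₀ a b l → OffPath X₀ vs₀ a b l
    OffPath-original A (p , uq , off) =
      Path-resp (λ x∈ y∈ e → edge (trans (≡-sym (same A (off x∈) (off y∈))) (adj≡true e))) p , uq , off

    -- Two outer neighbours can be attached to consecutive vertices of the cycle.
    OffPath-length : Attainable ws → a ∈ ws → b ∈ ws → a ≢ b →
                     OffPath X₀ vs₀ a b l → g ≤ 2 + length l
    OffPath-length R a∈ b∈ a≢b off with bringTwo a∈ b∈ a≢b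
    ... | _ , σ with Attainable-↭ σ R
    ... | z₁ ∷ z₂ ∷ _ , A , eq
      with refl ← ∷-injectiveˡ eq | refl ← ∷-injectiveˡ (∷-injectiveʳ eq)
      with spokes A | Cyc-elim (cyc A) | OffPath-arranged A off
    ... | (v₁a , _) ∷ (v₂b , _) ∷ _ | _ , _ , p , v₁v₂ , _ , _ , v₁∉ , _ | q , uq , out
      with refl ← Path-head p =
      girth (inK A) (Cyc-intro (v₁a ∷ q) (Adj-sym v₁v₂) (Adj-sym v₂b)
        (λ { refl → out (Path-end∈ q) v₁∈ })
        (λ { (here eq) → v₁∉ (here (≡-sym eq)) ; (there v₂∈) → out v₂∈ (∈-resp-↭ (perm A) (there (here refl))) })
        (Unique-∷ (λ v₁∈q → out v₁∈q v₁∈) uq))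
      where
      v₁∈ = ∈-resp-↭ (perm A) (here refl)

    -- A common outer neighbour of two consecutive vertices of the cycle forms a triangle with them.
    Attainable-noRepeat : ¬ Attainable (a ∷ a ∷ ws)
    Attainable-noRepeat (z₁ ∷ z₂ ∷ _ , A , eq)
      with refl ← ∷-injectiveˡ eq | eq₂ ← ∷-injectiveˡ (∷-injectiveʳ eq)
      with spokes A | Cyc-elim (cyc A)
    ... | (v₁a , _) ∷ (v₂a , _) ∷ _ | _ , _ , p , v₁v₂ , _ with refl ← Path-head p =
      noTriangle (inK A) v₁v₂ v₁a (subst (Adj (graph A) _) eq₂ v₂a)

    Attainable-unique : ∀ ws → Attainable ws → Unique ws
    Attainable-unique ws R = noRepeat⇒Unique ws λ σ → Attainable-noRepeat (Attainable-↭ σ R)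

    -- The cycle and two distinct outer neighbours fit into the graph; this is the bound under which
    -- Kelly's lemma counts `g`-cycles.
    room : Arranged (z₁ ∷ z₂ ∷ zs) → g + 2 ≤ n
    room {z₁} {z₂} A with spokes A | Attainable-unique _ (_ , A , refl)
    ... | (_ , w₁∉) ∷ (_ , w₂∉) ∷ _ | (w₁≢w₂ ∷ _) ∷ _ = begin
      g + 2                                       ≡⟨ +-comm g 2 ⟩
      2 + g                                       ≡⟨ cong (2 +_) len₀ ⟨
      length (proj₂ z₁ ∷ proj₂ z₂ ∷ vs₀)          ≤⟨ Unique-⊆⇒length≤ distinct (λ {v} _ → ∈-allFin v) ⟩
      length (allFin n)                           ≡⟨ length-tabulate id ⟩
      n                                           ∎
      where
      open ≤-Reasoning hiding (stop)
      distinct : Unique (proj₂ z₁ ∷ proj₂ z₂ ∷ vs₀)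
      distinct = Unique-∷ (λ { (here eq) → w₁≢w₂ eq ; (there w₁∈) → w₁∉ w₁∈ })
        (Unique-∷ w₂∉ (Unique-↭ (perm A) (proj₁ (proj₂ (cyc A)))))

    spoke∈ : (A : Arranged zs) → v ∈ vs₀ → Adj (graph A) v w → w ∉ vs₀ → (v , w) ∈ zs
    spoke∈ {zs} {v} {w} A v∈ vw w∉ = locate (∈-map⁻ proj₁ (∈-resp-↭ (↭-sym (perm A)) v∈))
      where
      off : ∀ {z} → z ∉ vs₀ → z ∉ map proj₁ zs
      off z∉ = z∉ ∘ ∈-resp-↭ (perm A)
      sameSpoke : ∀ {w₁} → Adj (graph A) v w₁ × w₁ ∉ vs₀ →
                  (∃ λ w → Adj (graph A) v w × w ∉ map proj₁ zs ×
                           (∀ {w′} → Adj (graph A) v w′ → w′ ∉ map proj₁ zs → w′ ≡ w)) → w₁ ≡ w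
      sameSpoke (vw₁ , w₁∉) (_ , _ , _ , only) = trans (only vw₁ (off w₁∉)) (≡-sym (only vw (off w∉)))
      locate : (∃ λ z → z ∈ zs × v ≡ proj₁ z) → (v , w) ∈ zs
      locate ((_ , w₁) , z∈ , refl) = subst (λ w → (v , w) ∈ zs) (sameSpoke (All.lookup (spokes A) z∈)
        (outer (inK A) (cyc A) (Arranged-length A) (∈-map⁺ proj₁ z∈))) z∈

    initial : K X₀ → Cyc X₀ vs₀ → ∃ λ (A : ∃ Arranged) → graph (proj₂ A) ≡ X₀
    initial kX cyc₀ with spread vs₀ id
      where
      spread : ∀ vs → (∀ {v} → v ∈ vs → v ∈ vs₀) → ∃ λ zs → map proj₁ zs ≡ vs ×
               All (λ z → Adj X₀ (proj₁ z) (proj₂ z) × proj₂ z ∉ vs₀) zs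
      spread []       _   = [] , refl , []
      spread (v ∷ vs) sub =
        let w , vw , w∉ , _ = outer kX cyc₀ len₀ (sub (here refl))
            zs , eq , sp    = spread vs (sub ∘ there)
        in (v , w) ∷ zs , cong (v ∷_) eq , (vw , w∉) ∷ sp
    ... | zs , refl , sp = (zs , record
      { graph = X₀ ; inK = kX ; cyc = cyc₀ ; perm = refl ; spokes = sp ; same = λ _ _ → refl }) , refl

  -- Shortening paths off the cycle.

  record Arm (X : Graph n) (vs : List V) (k : ℕ) (w w′ : V) : Set where
    constructor arm
    field
      {foot}    : V
      foot∈     : foot ∈ vs
      foot~     : Adj X foot w′
      {route}   : List V
      offPath   : OffPath X vs w w′ route
      routeLen  : length route ≡ k

  -- Refers to a single graph and not to arrangements of `X₀`: the exchanges that shorten a path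
  -- take place off the cycle, which is the part that an arrangement keeps fixed.
  Near : Graph n → List V → ℕ → Set
  Near X vs k = ∃₂ λ v w → ∃ λ w′ → v ∈ vs × Adj X v w × w ≢ w′ × Arm X vs k w w′

  Near-length : ∀ {k} → K X → Cyc X vs → length vs ≡ g → Near X vs k → g ≤ 2 + k
  Near-length {X} {vs} kX cycX len (v , w , w′ , v∈ , vw , w≢w′ , arm f∈ fw′ off@(p , _ , out) refl)
    with Arrangements.initial X vs len kX cycX
  ... | (zs , A) , refl = OffPath-length (zs , A , refl)
    (∈-map⁺ proj₂ (spoke∈ A v∈ vw (out (Path-start∈ p)))) (∈-map⁺ proj₂ (spoke∈ A f∈ fw′ (out (Path-end∈ p)))) w≢w′ off
    where open Arrangements X vs len

  diverge : ∀ (p q : V) r₁ r₂ → length r₁ ≡ length r₂ → r₁ ≢ r₂ →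
            ∃ λ pre → ∃₂ λ p′ q′ → ∃₂ λ z₁ z₂ → ∃₂ λ s₁ s₂ →
            p ∷ q ∷ r₁ ≡ pre ++ p′ ∷ q′ ∷ z₁ ∷ s₁ × p ∷ q ∷ r₂ ≡ pre ++ p′ ∷ q′ ∷ z₂ ∷ s₂ × z₁ ≢ z₂
  diverge p q []         []         len r₁≢r₂ = ⊥-elim (r₁≢r₂ refl)
  diverge p q (z₁ ∷ r₁) (z₂ ∷ r₂) len r₁≢r₂ with z₁ ≟ z₂
  ... | no  z₁≢z₂ = [] , p , q , z₁ , z₂ , r₁ , r₂ , refl , refl , z₁≢z₂
  ... | yes refl with diverge q z₁ r₁ r₂ (suc-injective len) (λ { refl → r₁≢r₂ refl })
  ...   | pre , p′ , q′ , y₁ , y₂ , s₁ , s₂ , eq₁ , eq₂ , y₁≢y₂ =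
    p ∷ pre , p′ , q′ , y₁ , y₂ , s₁ , s₂ , cong (p ∷_) eq₁ , cong (p ∷_) eq₂ , y₁≢y₂

  -- If c is the predecessor of p on v ∷ pre ++ p ∷ q ∷ z ∷ s, the switch at pq
  -- lets the path skip q.
  shortcut : ∀ {k p q c p″ z z′ s w′} pre → Switched g X Y p q c p″ z z′ → v ∈ vs →
             Path X v c (v ∷ pre) → Path X z w′ (z ∷ s) → u ∈ vs → Adj X u w′ →
             Unique (pre ++ p ∷ q ∷ z ∷ s) → (∀ {x} → x ∈ pre ++ p ∷ q ∷ z ∷ s → x ∉ vs) →
             length (pre ++ p ∷ q ∷ z ∷ s) ≡ suc k → Near Y vs k
  shortcut {X} {Y} {v} {vs} {u} {k} {p} {q} {c} {p″} {z} {z′} {s} {w′} pre S v∈ path₁ path₂ u∈ uw′ uq out len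
    with Path-uncons (Path-++ {X = Y} path₁′ (Adj-sym (~₂ (Yu S))) (~₃ (Yu S) ∷ path₂′))
    where
    uq₂ : Unique (p ∷ q ∷ z ∷ s)
    uq₂ = Unique-++⁻ʳ pre uq
    v≢ : ∀ {x} → x ∈ pre ++ p ∷ q ∷ z ∷ s → x ≢ v
    v≢ x∈ refl = out x∈ v∈
    p∈ : p ∈ p ∷ q ∷ z ∷ s
    p∈ = here refl
    q∈ : q ∈ p ∷ q ∷ z ∷ s
    q∈ = there (here refl)
    path₁′ : Path Y v c (v ∷ pre)
    path₁′ = Path-agree (agree S)
      (λ { (here eq) → v≢ (∈-++⁺ʳ pre p∈) eq ; (there p∈pre) → Unique⇒disjoint pre uq p∈pre p∈ })
      (λ { (here eq) → v≢ (∈-++⁺ʳ pre q∈) eq ; (there q∈pre) → Unique⇒disjoint pre uq q∈pre q∈ }) path₁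
    path₂′ : Path Y z w′ (z ∷ s)
    path₂′ = Path-agree (agree S) (Unique[x∷xs]⇒x∉xs uq₂ ∘ there)
      (Unique[x∷xs]⇒x∉xs (Unique-++⁻ʳ (p ∷ []) uq₂)) path₂
  ... | _ , inj₁ refl = ⊥-elim (out (∈-++⁺ʳ pre (there (there (Path-end∈ path₂)))) v∈)
  ... | _ , inj₂ (h , vh , r) =
    v , h , w′ , v∈ , vh , Path-ends≢ r uq′ long ,
    arm u∈ (Adj-agree (agree S) (u≢ p∈) (u≢ q∈) (∉⇒≢ w′∈ (Unique[x∷xs]⇒x∉xs uq₂ ∘ there)) (∉⇒≢ w′∈ (Unique[x∷xs]⇒x∉xs (Unique-++⁻ʳ (p ∷ []) uq₂))) uw′)
      (r , uq′ , out ∘ ∈-resp-↭ (↭-sym σ) ∘ there)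
      (suc-injective (trans (≡-sym (↭-length σ)) len))
    where
    l′ = pre ++ p ∷ z ∷ s
    σ : pre ++ p ∷ q ∷ z ∷ s ↭ q ∷ l′
    σ = ↭-trans (++⁺ˡ pre (swap p q refl)) (shift q pre (p ∷ z ∷ s))
    uq′ : Unique l′
    uq′ = Unique-++⁻ʳ (q ∷ []) (Unique-↭ σ uq)
    uq₂ : Unique (p ∷ q ∷ z ∷ s)
    uq₂ = Unique-++⁻ʳ pre uq
    long : 2 ≤ length l′
    long = ≤-trans (s≤s (s≤s z≤n)) (≤-trans (m≤n+m (length (p ∷ z ∷ s)) (length pre))
             (≤-reflexive (≡-sym (length-++ pre))))
    p∈ : p ∈ p ∷ q ∷ z ∷ s
    p∈ = here refl
    q∈ : q ∈ p ∷ q ∷ z ∷ s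
    q∈ = there (here refl)
    u≢ : ∀ {x} → x ∈ p ∷ q ∷ z ∷ s → u ≢ x
    u≢ x∈ refl = out (∈-++⁺ʳ pre x∈) u∈
    w′∈ : w′ ∈ z ∷ s
    w′∈ = Path-end∈ path₂

  -- At the edge `pq` before the paths part, `p` keeps its predecessor `c` on them, which is `v` if
  -- `pre` is empty, and receives `z₁` or `z₂` from `q`. Either outcome lets one of the two paths
  -- skip `q`. The cycle survives because `p` and `q` lie off it.
  shortenAt : ∀ {k w₁ w₂ p q z₁ z₂ s₁ s₂} → K X → Cyc X vs → v ∈ vs → Adj X v w → ∀ pre →
              (α : Arm X vs (suc k) w w₁) (β : Arm X vs (suc k) w w₂) →
              Arm.route α ≡ pre ++ p ∷ q ∷ z₁ ∷ s₁ → Arm.route β ≡ pre ++ p ∷ q ∷ z₂ ∷ s₂ → z₁ ≢ z₂ →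
              ∃ λ Y → K Y × Cyc Y vs × Near Y vs k
  shortenAt {X} {vs} {v} {w} {k} {w₁} {w₂} {p} {q} {z₁} {z₂} {s₁} {s₂} kX cycX v∈ vw pre
    (arm f₁∈ f₁~ (path₁ , uq₁ , out₁) len₁) (arm f₂∈ f₂~ (path₂ , uq₂ , out₂) len₂) refl refl z₁≢z₂ =
    split (Path-split pre (vw ∷ path₁)) (Path-split pre (vw ∷ path₂))
    where
    p∉ : p ∉ vs
    p∉ = out₁ (∈-++⁺ʳ pre (here refl))
    q∉ : q ∉ vs
    q∉ = out₁ (∈-++⁺ʳ pre (there (here refl)))
    q∉v∷pre : q ∉ v ∷ pre
    q∉v∷pre (here refl) = q∉ v∈
    q∉v∷pre (there q∈)  = Unique⇒disjoint pre uq₁ q∈ (there (here refl))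
    p≢ : ∀ {z s} → Unique (p ∷ q ∷ z ∷ s) → p ≢ z
    p≢ uq refl = Unique[x∷xs]⇒x∉xs uq (there (here refl))
    split : (∃ λ c → Path X v c (v ∷ pre) × Adj X c p × Path X p w₁ (p ∷ q ∷ z₁ ∷ s₁)) →
            (∃ λ c → Path X v c (v ∷ pre) × Adj X c p × Path X p w₂ (p ∷ q ∷ z₂ ∷ s₂)) →
            ∃ λ Y → K Y × Cyc Y vs × Near Y vs k
    split (c , t , cp , pq ∷ qz₁ ∷ t₁) (_ , _ , _ , _ ∷ qz₂ ∷ t₂)
      with refl ← Path-head t₁ | refl ← Path-head t₂
      with cubic kX p | cubic kX q
    ... | _ , _ , _ , M | _ , _ , _ , M′
      with Nbr3-third M pq (Adj-sym cp) (λ { refl → q∉v∷pre (Path-end∈ t) })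
    ...   | p″ , N with switchEdge kX N (Nbr3-replace M′ (p≢ (Unique-++⁻ʳ pre uq₁)) (p≢ (Unique-++⁻ʳ pre uq₂))
                                          z₁≢z₂ (Adj-sym pq) qz₁ qz₂)
    ...     | Y , kY , inj₁ S = Y , kY , Cyc-agree (agree S) p∉ q∉ cycX , shortcut pre S v∈ t t₁ f₁∈ f₁~ uq₁ out₁ len₁
    ...     | Y , kY , inj₂ S = Y , kY , Cyc-agree (agree S) p∉ q∉ cycX , shortcut pre S v∈ t t₂ f₂∈ f₂~ uq₂ out₂ len₂

  shorten : ∀ {k w₁ w₂ r₁ r₂} → K X → Cyc X vs → v ∈ vs → Adj X v w →
            (α : Arm X vs (suc k) w w₁) (β : Arm X vs (suc k) w w₂) →
            Arm.route α ≡ w ∷ x ∷ r₁ → Arm.route β ≡ w ∷ x ∷ r₂ → w₁ ≢ w₂ →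
            ∃ λ Y → K Y × Cyc Y vs × Near Y vs k
  shorten {w = w} {x = x} {r₁ = r₁} {r₂} kX cycX v∈ vw
    α@(arm _ _ (path₁ , _) len₁) β@(arm _ _ (path₂ , _) len₂) refl refl w₁≢w₂
    with diverge w x r₁ r₂ (suc-injective (suc-injective (trans len₁ (≡-sym len₂))))
           (λ { refl → w₁≢w₂ (Path-end-unique path₁ path₂) })
  ... | pre , _ , _ , _ , _ , _ , _ , eq₁ , eq₂ , z₁≢z₂ = shortenAt kX cycX v∈ vw pre α β eq₁ eq₂ z₁≢z₂

  secondStep : ∀ {k} → v ∈ vs → Nbr3 X w v x y → w ≢ z → (α : Arm X vs k w z) →
               (∃ λ r → Arm.route α ≡ w ∷ x ∷ r) ⊎ (∃ λ r → Arm.route α ≡ w ∷ y ∷ r)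
  secondStep v∈ N w≢z (arm _ _ (stop _ , _) _) = ⊥-elim (w≢z refl)
  secondStep v∈ N w≢z (arm _ _ (e ∷ stop _ , _ , out) _) with complete N e
  ... | here refl                 = ⊥-elim (out (there (here refl)) v∈)
  ... | there (here refl)         = inj₁ (_ , refl)
  ... | there (there (here refl)) = inj₂ (_ , refl)
  secondStep v∈ N w≢z (arm _ _ (e ∷ (_ ∷ _) , _ , out) _) with complete N e
  ... | here refl                 = ⊥-elim (out (there (here refl)) v∈)
  ... | there (here refl)         = inj₁ (_ , refl)
  ... | there (there (here refl)) = inj₂ (_ , refl)

  -- Among three arms starting at w two leave w along the same edge.
  threeArms : ∀ {k w₁ w₂ w₃} → K X → Cyc X vs → v ∈ vs → Adj X v w →
              w ≢ w₁ → w ≢ w₂ → w ≢ w₃ → w₁ ≢ w₂ → w₁ ≢ w₃ → w₂ ≢ w₃ →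
              Arm X vs (suc k) w w₁ → Arm X vs (suc k) w w₂ → Arm X vs (suc k) w w₃ →
              ∃ λ Y → K Y × Cyc Y vs × Near Y vs k
  threeArms {X} {vs} {v} {w} kX cycX v∈ vw w≢₁ w≢₂ w≢₃ ≢₁₂ ≢₁₃ ≢₂₃ α β γ with Nbr3-extend (cubic kX w) (Adj-sym vw)
  ... | _ , _ , N with secondStep v∈ N w≢₁ α | secondStep v∈ N w≢₂ β | secondStep v∈ N w≢₃ γ
  ...   | inj₁ (_ , p) | inj₁ (_ , q) | _ = shorten kX cycX v∈ vw α β p q ≢₁₂
  ...   | inj₂ (_ , p) | inj₂ (_ , q) | _ = shorten kX cycX v∈ vw α β p q ≢₁₂
  ...   | inj₁ (_ , p) | inj₂ _ | inj₁ (_ , q) = shorten kX cycX v∈ vw α γ p q ≢₁₃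
  ...   | inj₂ (_ , p) | inj₁ _ | inj₂ (_ , q) = shorten kX cycX v∈ vw α γ p q ≢₁₃
  ...   | inj₁ _ | inj₂ (_ , p) | inj₂ (_ , q) = shorten kX cycX v∈ vw β γ p q ≢₂₃
  ...   | inj₂ _ | inj₁ (_ , p) | inj₁ (_ , q) = shorten kX cycX v∈ vw β γ p q ≢₂₃

  -- The path passes from the cycle at gate to exit and then stays off the cycle.
  record LastVisit (X : Graph n) (vs : List V) (z : V) (l : List V) : Set where
    field
      before    : List V
      gate      : V
      {exit}    : V
      after     : List V
      split     : l ≡ before ++ gate ∷ exit ∷ after
      gate∈     : gate ∈ vs
      gate~exit : Adj X gate exit
      tail      : Path X exit z (exit ∷ after)
      off       : ∀ {x} → x ∈ exit ∷ after → x ∉ vs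

  lastVisit : Path X a z l → z ∉ vs → (∀ {x} → x ∈ l → x ∉ vs) ⊎ LastVisit X vs z l
  lastVisit (stop _) z∉ = inj₁ λ { (here refl) → z∉ }
  lastVisit {vs = vs} (_∷_ {a} e p) z∉ with lastVisit p z∉
  ... | inj₂ L = inj₂ record
    { before = a ∷ before ; gate = gate ; after = after ; split = cong (a ∷_) split
    ; gate∈ = gate∈ ; gate~exit = gate~exit ; tail = tail ; off = off }
    where open LastVisit L
  ... | inj₁ off with a ∈? vs
  ...   | no a∉  = inj₁ λ { (here refl) → a∉ ; (there x∈) → off x∈ }
  lastVisit {vs = vs} (_∷_ {a} e p@(stop _)) z∉ | inj₁ off | yes a∈ = inj₂ record
    { before = [] ; gate = a ; after = _ ; split = refl ; gate∈ = a∈ ; gate~exit = e ; tail = p ; off = off }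
  lastVisit {vs = vs} (_∷_ {a} e p@(_ ∷ _)) z∉ | inj₁ off | yes a∈ = inj₂ record
    { before = [] ; gate = a ; after = _ ; split = refl ; gate∈ = a∈ ; gate~exit = e ; tail = p ; off = off }

  -- Here `p` vertices precede the last vertex on the cycle and `q` follow the exit. The part off
  -- the cycle takes `1 + q`, at least `g - 2`, of the `g - 1` vertices, so the path must leave the
  -- cycle at its first vertex.
  lastVisit-first : ∀ {p q} → p + (2 + q) ≡ 4 + j → 2 + j ≤ q → p ≡ 0 × q ≡ 2 + j
  lastVisit-first {zero}  {q} eq le = refl , suc-injective (suc-injective eq)
  lastVisit-first {suc p} {q} eq le = contradiction (begin-strict
    4 + j             <⟨ s≤s (s≤s (s≤s le)) ⟩
    3 + q             ≤⟨ m≤n+m (3 + q) p ⟩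
    p + (3 + q)       ≡⟨ +-suc p (2 + q) ⟩
    suc p + (2 + q)   ≡⟨ eq ⟩
    4 + j             ∎) (<-irrefl refl)
    where open ≤-Reasoning hiding (stop)

  -- With `g - 2` vertices in all, the part off the cycle leaves no place for a vertex on it.
  lastVisit-never : ∀ {p q} → p + (2 + q) ≡ 3 + j → 2 + j ≤ q → ⊥
  lastVisit-never {p} {q} eq le = <-irrefl refl (begin-strict
    3 + j         <⟨ s≤s (s≤s le) ⟩
    2 + q         ≤⟨ m≤n+m (2 + q) p ⟩
    p + (2 + q)   ≡⟨ eq ⟩
    3 + j         ∎)
    where open ≤-Reasoning hiding (stop)

  -- Paths between outer neighbours.

  module _ (X₀ : Graph n) (vs₀ : List V) (len₀ : length vs₀ ≡ g) where
    open Arrangements X₀ vs₀ len₀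
    open LastVisit

    private
      variable
        zs : List (V × V)

    -- As the path avoids `u`, it cannot leave the cycle by the spoke to `z`. Its final part
    -- therefore joins two different outer neighbours, and the bound on such paths applies.
    exit-far : (A : Arranged zs) → (u , z) ∈ zs → u ∉ l → Unique l → (L : LastVisit (graph A) vs₀ z l) →
               (gate L , exit L) ∈ zs × exit L ≢ z ×
               OffPath X₀ vs₀ (exit L) z (exit L ∷ after L) × g ≤ 3 + length (after L)
    exit-far {zs} {u} {z} A uz∈ u∉ uq L =
      ge∈ , exit≢z , offPath ,
      OffPath-length (zs , A , refl) (∈-map⁺ proj₂ ge∈) (∈-map⁺ proj₂ uz∈) exit≢z offPath
      where
      ge∈ = spoke∈ A (gate∈ L) (gate~exit L) (off L (here refl))
      gate∈l : gate L ∈ _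
      gate∈l = subst (gate L ∈_) (≡-sym (split L)) (∈-++⁺ʳ (before L) (here refl))
      exit≢z : exit L ≢ z
      exit≢z eq = u∉ (subst (_∈ _)
        (cong proj₁ (Unique-map-injective (Attainable-unique _ (zs , A , refl)) ge∈ uz∈ eq)) gate∈l)
      offPath = OffPath-original A
        (tail L , Unique-++⁻ʳ (gate L ∷ []) (Unique-++⁻ʳ (before L) (subst Unique (split L) uq)) , off L)

    -- Taken in `X₀`, but since the path stays off the cycle it is present in every arrangement.
    record Chord (k : ℕ) (a b : V) : Set where
      constructor chord
      field
        {route}  : List V
        offPath  : OffPath X₀ vs₀ a b route
        routeLen : length route ≡ k

    Chord-sym : ∀ {k} → Chord k a b → Chord k b a
    Chord-sym (chord {l} o len) = chord (OffPath-reverse o) (trans (length-reverse l) len)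

    -- Translates a path found by `newCycle`: by its length it leaves the cycle at once, and the
    -- only way off the cycle at `x` leads to `w`.
    arc⇒Chord : (A : Arranged zs) → (x , w) ∈ zs → (u , z) ∈ zs → u ∉ l → z ∉ vs₀ →
                Path (graph A) x z l → Unique l → length l ≡ 4 + j → Chord (3 + j) w z
    arc⇒Chord {zs} {x} {w} A xw∈ uz∈ u∉ z∉ p uq len with lastVisit {vs = vs₀} p z∉
    ... | inj₁ out = ⊥-elim (out (Path-start∈ p) (∈-resp-↭ (perm A) (∈-map⁺ proj₁ xw∈)))
    ... | inj₂ L with exit-far A uz∈ u∉ uq L
    ...   | ge∈ , _ , o , far
      with lastVisit-first (trans (≡-sym (length-++ (before L))) (trans (cong length (≡-sym (split L))) len))
             (≤-pred (≤-pred (≤-pred far)))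
    ...     | b≡0 , a≡ =
      subst (λ w → Chord (3 + j) w _)
        (cong proj₂ (Unique-map-injective {f = proj₁} (proj₁ (proj₂ (cyc A))) ge∈ xw∈ (≡-sym x≡gate)))
        (chord o (cong suc a≡))
      where
      empty : ∀ (xs : List V) → length xs ≡ 0 → xs ≡ []
      empty [] _ = refl
      x≡gate : x ≡ gate L
      x≡gate = Path-head (subst (Path _ x _) (trans (split L) (cong (_++ _) (empty (before L) b≡0))) p)

    Chord-arranged : ∀ {k} (A : Arranged zs) → graph A ≡ X₀ → a ∈ map proj₂ zs → b ∈ map proj₂ zs →
                     Chord k a b → Arm X₀ vs₀ k a b
    Chord-arranged A refl a∈ b∈ (chord o len) with ∈-map⁻ proj₂ b∈
    ... | (v , _) , z∈ , refl = arm (∈-resp-↭ (perm A) (∈-map⁺ proj₁ z∈)) (proj₁ (All.lookup (spokes A) z∈)) o len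

    bringFour : Unique ws → a ∈ ws → e ∈ ws → b ∈ ws → d ∈ ws → e ≢ a → b ≢ a → b ≢ e → d ≢ a → d ≢ e → d ≢ b →
                ∃ λ rest → ws ↭ e ∷ b ∷ d ∷ rest ++ a ∷ []
    bringFour uq a∈ e∈ b∈ d∈ e≢a b≢a b≢e d≢a d≢e d≢b with ∈⇒↭ a∈
    ... | r₁ , σ₁ with ∈⇒↭ (∈-∷⁻ (∈-resp-↭ σ₁ e∈) e≢a)
    ... | r₂ , σ₂ with ∈⇒↭ (∈-∷⁻ (∈-resp-↭ σ₂ (∈-∷⁻ (∈-resp-↭ σ₁ b∈) b≢a)) b≢e)
    ... | r₃ , σ₃ with ∈⇒↭ (∈-∷⁻ (∈-resp-↭ σ₃ (∈-∷⁻ (∈-resp-↭ σ₂ (∈-∷⁻ (∈-resp-↭ σ₁ d∈) d≢a)) d≢e)) d≢b)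
    ... | r₄ , σ₄ = r₄ , ↭-trans σ₁ (↭-trans (prep _ (↭-trans σ₂ (prep _ (↭-trans σ₃ (prep _ σ₄))))) (∷↭∷ʳ _ _))

    -- Exchanging e and b destroys the g-cycle through the chord from a to e;
    -- a new g-cycle would need one of the three excluded chords.
    exchange : Attainable (e ∷ b ∷ d ∷ ws ++ a ∷ []) → e ≢ b → a ≢ e → Chord (3 + j) a e →
               ¬ Chord (3 + j) a b → ¬ Chord (3 + j) e d → ¬ Chord (3 + j) e b → ⊥
    exchange {e} {b} {d} {ws} {a} (z₁ ∷ z₂ ∷ z₃ ∷ zs , A , eq) e≢b a≢e (chord {l} ae len) ¬ab ¬ed ¬eb
      with refl ← ∷-injectiveˡ eq | refl ← ∷-injectiveˡ (∷-injectiveʳ eq)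
         | refl ← ∷-injectiveˡ (∷-injectiveʳ (∷-injectiveʳ eq))
      with map-∷ʳ⁻ proj₂ zs (∷-injectiveʳ (∷-injectiveʳ (∷-injectiveʳ eq)))
    ... | mid , (v₄ , _) , refl , _ , refl with frontSwitch A
    ... | h , t , p , tv₁ , A′ , S
      with refl ← Path-head p
         | refl ← Path-last (proj₁ z₃ ∷ map proj₁ mid) (subst (λ l → Path (graph A) h t (proj₁ z₃ ∷ l)) (map-++ proj₁ mid _) p)
      with spokes A
    ... | (v₁e , e∉) ∷ (_ , b∉) ∷ _ ∷ sp =
      lost (sameCount (room A) (inK A) (inK A′) gained (cong (2 +_) len) doomed)
      where
      v₁ = proj₁ z₁
      v₂ = proj₁ z₂
      v₃ = proj₁ z₃
      zs′ = z₁ ∷ z₂ ∷ z₃ ∷ mid ++ (t , a) ∷ []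
      ta∈ : (t , a) ∈ zs′
      ta∈ = there (there (there (∈-++⁺ʳ mid (here refl))))
      on : ∀ {z} → z ∈ zs′ → proj₁ z ∈ vs₀
      on z∈ = ∈-resp-↭ (perm A) (∈-map⁺ proj₁ z∈)

      gained : ∀ {l} → length l ≡ g → Cyc (graph A′) l → Cyc (graph A) l
      gained {l} len cyc = decidable-stable (Cyc? (graph A) l) λ ¬c → none (newCycle refl S cyc len ¬c)
        where
        -- The first path starts at `t`, which carries `a`; the second ends at `v₃`, which carries
        -- `d`; the third is too short to visit the cycle.
        none : CardPath (graph A) v₁ v₂ t b (4 + j) ⊎ CardPath (graph A) v₁ v₂ e v₃ (4 + j) ⊎
               CardPath (graph A) v₁ v₂ e b (3 + j) → ⊥
        none (inj₁ (_ , p , uq , _ , v₂∉ , len)) =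
          ¬ab (arc⇒Chord A ta∈ (there (here refl)) v₂∉ b∉ p uq len)
        none (inj₂ (inj₁ P)) with CardPath-reverse P
        ... | _ , p , uq , v₁∉ , _ , len =
          ¬ed (Chord-sym (arc⇒Chord A (there (there (here refl))) (here refl) v₁∉ e∉ p uq len))
        none (inj₂ (inj₂ (_ , p , uq , _ , v₂∉ , len))) with lastVisit {vs = vs₀} p b∉
        ... | inj₁ out = ¬eb (chord (OffPath-original A (p , uq , out)) len)
        ... | inj₂ L =
          lastVisit-never (trans (≡-sym (length-++ (before L))) (trans (cong length (≡-sym (split L))) len))
            (≤-pred (≤-pred (≤-pred (proj₂ (proj₂ (proj₂ (exit-far A (there (here refl)) v₂∉ uq L)))))))

      ae′ : OffPath (graph A) vs₀ a e l
      ae′ = OffPath-arranged A ae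
      route : Path (graph A) t e (t ∷ l)
      route = proj₁ (All.lookup sp (∈-++⁺ʳ mid (here refl))) ∷ proj₁ ae′
      out : ∀ {z} → z ∈ l → z ∉ vs₀
      out = proj₂ (proj₂ ae)

      doomed : Cyc (graph A) (v₁ ∷ t ∷ l)
      doomed = Cyc-intro route (Adj-sym tv₁) (Adj-sym v₁e)
        (λ { refl → out (Path-end∈ (proj₁ ae)) (on ta∈) })
        (λ { (here eq) → Adj⇒≢ tv₁ (≡-sym eq) ; (there v₁∈) → out v₁∈ (on (here refl)) })
        (Unique-∷ (λ t∈l → out t∈l (on ta∈)) (proj₁ (proj₂ ae)))

      lost : ¬ Cyc (graph A′) (v₁ ∷ t ∷ l)
      lost c with Cyc-elim c
      ... | _ , _ , p′ , _ , ev₁ , _ with refl ← Path-end-unique p′ route with complete (Yu S) (Adj-sym ev₁)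
      ...   | here refl                 = e∉ (on (there (here refl)))
      ...   | there (here refl)         = e∉ (on ta∈)
      ...   | there (there (here refl)) = e≢b refl

    -- `X₀` is itself one of the arranged graphs here, so the ends of a chord are attached to the
    -- cycle in `X₀`, as shortening requires.
    module Spread (kX : K X₀) (cycX : Cyc X₀ vs₀) (zs : List (V × V)) (A : Arranged zs) (A≡ : graph A ≡ X₀) where

      ws₀ = map proj₂ zs

      ws₀-attainable : Attainable ws₀
      ws₀-attainable = zs , A , refl

      ws₀-unique : Unique ws₀
      ws₀-unique = Attainable-unique ws₀ ws₀-attainable

      ws₀-length : length ws₀ ≡ g
      ws₀-length = trans (length-map proj₂ zs) (trans (≡-sym (length-map proj₁ zs)) (Arranged-length A))

      outer∈ : v ∈ vs₀ → Adj X₀ v w → w ∉ vs₀ → w ∈ ws₀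
      outer∈ v∈ vw w∉ = ∈-map⁺ proj₂ (spoke∈ A v∈ (subst (λ X → Adj X _ _) (≡-sym A≡) vw) w∉)

      threeChords : ∀ {k} → w ∈ ws₀ → x ∈ ws₀ → y ∈ ws₀ → z ∈ ws₀ → w ≢ x → w ≢ y → w ≢ z →
                    x ≢ y → x ≢ z → y ≢ z → Chord (suc k) w x → Chord (suc k) w y →
                    Chord (suc k) w z → ∃ λ Y → K Y × Cyc Y vs₀ × Near Y vs₀ k
      threeChords w∈ x∈ y∈ z∈ w≢x w≢y w≢z x≢y x≢z y≢z wx wy wz with ∈-map⁻ proj₂ w∈
      ... | (u , _) , uw∈ , refl =
        threeArms kX cycX (∈-resp-↭ (perm A) (∈-map⁺ proj₁ uw∈))
          (subst (λ X → Adj X _ _) A≡ (proj₁ (All.lookup (spokes A) uw∈)))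
          w≢x w≢y w≢z x≢y x≢z y≢z (arms x∈ wx) (arms y∈ wy) (arms z∈ wz)
        where
        arms : ∀ {k x} → x ∈ ws₀ → Chord k _ x → Arm X₀ vs₀ k _ x
        arms x∈ = Chord-arranged A A≡ w∈ x∈

      private
        B : V → V → Set
        B = Chord (3 + j)

      B-degree≤2 : w ∈ ws₀ → x ∈ ws₀ → y ∈ ws₀ → z ∈ ws₀ → w ≢ x → w ≢ y → w ≢ z →
                   x ≢ y → x ≢ z → y ≢ z → B w x → B w y → B w z → ⊥
      B-degree≤2 w∈ x∈ y∈ z∈ w≢x w≢y w≢z x≢y x≢z y≢z wx wy wz =
        tooShort (threeChords w∈ x∈ y∈ z∈ w≢x w≢y w≢z x≢y x≢z y≢z wx wy wz)
        where
        tooShort : ¬ (∃ λ Y → K Y × Cyc Y vs₀ × Near Y vs₀ (2 + j))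
        tooShort (_ , kY , cycY , near) = <-irrefl refl (Near-length kY cycY len₀ near)

      -- By `B-degree≤2` there is at most one `B`-neighbour besides `x`. Whether it exists is not
      -- decided, hence the double negation; if it does not, `x` is listed twice.
      otherNeighbour : w ∈ ws₀ → x ∈ ws₀ → w ≢ x → B w x →
                       ¬ ¬ ∃ λ y → ∀ {z} → z ∈ ws₀ → w ≢ z → B w z → z ∈ x ∷ y ∷ []
      otherNeighbour {w} {x} w∈ x∈ w≢x wx none =
        ¬¬-excluded-middle {A = ∃ λ y → y ∈ ws₀ × w ≢ y × x ≢ y × B w y} λ where
          (no ¬y) → none (x , λ {z} z∈ w≢z wz → only¹ ¬y z z∈ w≢z wz)
          (yes (y , y∈ , w≢y , x≢y , wy)) → none (y , λ {z} z∈ w≢z wz → only² y y∈ w≢y x≢y wy z z∈ w≢z wz)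
        where
        only¹ : ¬ (∃ λ y → y ∈ ws₀ × w ≢ y × x ≢ y × B w y) → ∀ z → z ∈ ws₀ → w ≢ z → B w z → z ∈ x ∷ x ∷ []
        only¹ ¬y z z∈ w≢z wz with x ≟ z
        ... | yes refl = here refl
        ... | no x≢z   = ⊥-elim (¬y (z , z∈ , w≢z , x≢z , wz))
        only² : ∀ y → y ∈ ws₀ → w ≢ y → x ≢ y → B w y → ∀ z → z ∈ ws₀ → w ≢ z → B w z → z ∈ x ∷ y ∷ []
        only² y y∈ w≢y x≢y wy z z∈ w≢z wz with x ≟ z | y ≟ z
        ... | yes refl | _        = here refl
        ... | no _     | yes refl = there (here refl)
        ... | no x≢z   | no y≢z   =
          ⊥-elim (B-degree≤2 w∈ x∈ y∈ z∈ w≢x w≢y w≢z x≢y x≢z y≢z wx wy wz)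

      five : 5 ≤ length ws₀
      five = ≤-trans (m≤m+n 5 j) (≤-reflexive (≡-sym ws₀-length))

      noChord : a ∈ ws₀ → e ∈ ws₀ → a ≢ e → ¬ B a e
      noChord {a} {e} a∈ e∈ a≢e ae =
        otherNeighbour a∈ e∈ a≢e ae λ (a′ , onlyA) →
        otherNeighbour e∈ a∈ (≢-sym a≢e) (Chord-sym ae) λ (e′ , onlyE) →
        conclude a′ onlyA e′ onlyE
        where
        conclude : ∀ a′ → (∀ {z} → z ∈ ws₀ → a ≢ z → B a z → z ∈ e ∷ a′ ∷ []) →
                   ∀ e′ → (∀ {z} → z ∈ ws₀ → e ≢ z → B e z → z ∈ a ∷ e′ ∷ []) → ⊥
        -- The cyclic order will be `a`, `e`, `b`, `d`, so `b` must not be joined to `a` or `e`, nor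
        -- `d` to `e`; a path between `a` and `d` is harmless. Each choice avoids four of at least
        -- five outer neighbours.
        conclude a′ onlyA e′ onlyE
          with fresh _≟_ ws₀ (a ∷ e ∷ a′ ∷ e′ ∷ []) ws₀-unique five
        ... | b , b∈ , b∉ with fresh _≟_ ws₀ (a ∷ e ∷ e′ ∷ b ∷ []) ws₀-unique five
        ...   | d , d∈ , d∉ = final (bringFour ws₀-unique a∈ e∈ b∈ d∈ (≢-sym a≢e)
            (≢-sym a≢b) (≢-sym e≢b) (≢-sym a≢d) (≢-sym e≢d) λ { refl → d∉ (there (there (there (here refl)))) })
          where
          a≢b : a ≢ b
          a≢b refl = b∉ (here refl)
          e≢b : e ≢ b
          e≢b refl = b∉ (there (here refl))
          a≢d : a ≢ d
          a≢d refl = d∉ (here refl)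
          e≢d : e ≢ d
          e≢d refl = d∉ (there (here refl))
          ¬ab : ¬ B a b
          ¬ab ab with onlyA b∈ a≢b ab
          ... | here refl         = e≢b refl
          ... | there (here refl) = b∉ (there (there (here refl)))
          ¬ed : ¬ B e d
          ¬ed ed with onlyE d∈ e≢d ed
          ... | here refl         = a≢d refl
          ... | there (here refl) = d∉ (there (there (here refl)))
          ¬eb : ¬ B e b
          ¬eb eb with onlyE b∈ e≢b eb
          ... | here refl         = a≢b refl
          ... | there (here refl) = b∉ (there (there (there (here refl))))
          final : (∃ λ rest → ws₀ ↭ e ∷ b ∷ d ∷ rest ++ a ∷ []) → ⊥
          final (rest , σ) = exchange (Attainable-↭ σ ws₀-attainable) e≢b a≢e ae ¬ab ¬ed ¬eb

      -- The detour runs along the cycle up to its last visit, then off the cycle to x, and on to w.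
      detour : ∀ {zs′} (A′ : Arranged zs′) → ws₀ ↭ map proj₂ zs′ → w ∈ map proj₂ zs′ → w ∉ vs₀ → s ∈ vs₀ →
               Path (graph A′) s x l → Unique l → w ∉ l → x ∉ vs₀ → Adj (graph A′) x w →
               ∃ λ (L : LastVisit (graph A′) vs₀ x l) → 2 + j ≤ length (after L) × (gate L , exit L) ∈ zs′ ×
               Chord (2 + length (after L)) (exit L) w
      detour {w} {s} {x} {l} {zs′} A′ σ w∈ w∉vs s∈ p uq w∉l x∉ xw with lastVisit {vs = vs₀} p x∉
      ... | inj₁ out = ⊥-elim (out (Path-start∈ p) s∈)
      ... | inj₂ L = L , far , ge∈ , ch
        where
        tail⊆ : ∀ {z} → z ∈ exit L ∷ after L → z ∈ l
        tail⊆ {z} z∈ = subst (z ∈_) (≡-sym (split L)) (∈-++⁺ʳ (before L) (there z∈))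
        ge∈ : (gate L , exit L) ∈ zs′
        ge∈ = spoke∈ A′ (gate∈ L) (gate~exit L) (off L (here refl))
        exit≢w : exit L ≢ w
        exit≢w refl = w∉l (tail⊆ (here refl))
        ew : OffPath X₀ vs₀ (exit L) w ((exit L ∷ after L) ++ w ∷ [])
        ew = OffPath-original A′
          ( Path-++ (tail L) xw (stop w)
          , Unique-++⁺ (Unique-++⁻ʳ (gate L ∷ []) (Unique-++⁻ʳ (before L) (subst Unique (split L) uq))) ([] ∷ [])
              (λ { (z∈ , here refl) → w∉l (tail⊆ z∈) })
          , λ z∈ → [ off L , (λ { (here refl) → w∉vs }) ]′ (∈-++⁻ (exit L ∷ after L) z∈))
        len≡ : length ((exit L ∷ after L) ++ w ∷ []) ≡ 2 + length (after L)
        len≡ = trans (length-++ (exit L ∷ after L)) (cong suc (+-comm _ 1))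
        ch : Chord (2 + length (after L)) (exit L) w
        ch = chord ew len≡
        e∈ : exit L ∈ map proj₂ zs′
        e∈ = ∈-map⁺ proj₂ ge∈
        far′ : g ≤ 2 + (2 + length (after L))
        far′ = subst (λ k → g ≤ 2 + k) len≡ (OffPath-length (_ , A′ , refl) e∈ w∈ exit≢w ew)
        -- The general bound only gives `1 + j`; equality would be a chord with `3 + j` vertices,
        -- which `noChord` excludes.
        far : 2 + j ≤ length (after L)
        far = ≤∧≢⇒< (≤-pred (≤-pred (≤-pred (≤-pred far′)))) λ eq →
          noChord (∈-resp-↭ (↭-sym σ) e∈) (∈-resp-↭ (↭-sym σ) w∈) exit≢w
            (subst (λ k → Chord (2 + k) (exit L) w) (≡-sym eq) ch)

      -- The exchange separates `v₁` from `t` and so destroys the cycle. A new one would contain a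
      -- path from `v₂` to `x`, from `t` to `y` or from `t` to `x`. Prolonged to `w`, the first
      -- becomes a chord from `p` and the second a chord from `q`; the third is too short.
      cut : ∀ {v₁ v₂ p q t mid Y} (A′ : Arranged ((v₁ , w) ∷ (v₂ , p) ∷ mid ++ (t , q) ∷ [])) →
            ws₀ ↭ map proj₂ ((v₁ , w) ∷ (v₂ , p) ∷ mid ++ (t , q) ∷ []) →
            K Y → Switched g (graph A′) Y v₁ w v₂ t x y → x ∉ vs₀ → y ∉ vs₀ →
            ¬ Chord (4 + j) p w → ¬ Chord (4 + j) q w → ⊥
      cut {w} {x} {y} {v₁} {v₂} {p} {q} {t} {mid} {Y} A′ σ kY S x∉ y∉ ¬pw ¬qw =
        destroyed (sameCount (room A′) (inK A′) kY gained (Arranged-length A′) (cyc A′))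
        where
        zs′ = (v₁ , w) ∷ (v₂ , p) ∷ mid ++ (t , q) ∷ []
        tq∈ : (t , q) ∈ zs′
        tq∈ = there (there (∈-++⁺ʳ mid (here refl)))
        on : ∀ {z} → z ∈ zs′ → proj₁ z ∈ vs₀
        on z∈ = ∈-resp-↭ (perm A′) (∈-map⁺ proj₁ z∈)
        w∉ : w ∉ vs₀
        w∉ = proj₂ (All.lookup (spokes A′) (here refl))

        direct : ∀ {s r z l} → (s , r) ∈ zs′ → z ∉ vs₀ → Adj (graph A′) z w → Path (graph A′) s z l →
                 Unique l → w ∉ l → length l ≡ 4 + j → Chord (4 + j) r w
        direct {s} {r} {z} {l} sr∈ z∉ zw path uq w∉l len
          with L , far , ge∈ , c ← detour A′ σ (here refl) w∉ (on sr∈) path uq w∉l z∉ zw =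
          subst₂ (λ k r → Chord (2 + k) r w) (proj₂ ends)
            (cong proj₂ (Unique-map-injective {f = proj₁} (proj₁ (proj₂ (cyc A′))) ge∈ sr∈ (≡-sym s≡gate))) c
          where
          ends : length (before L) ≡ 0 × length (after L) ≡ 2 + j
          ends = lastVisit-first (trans (≡-sym (length-++ (before L))) (trans (cong length (≡-sym (split L))) len)) far
          empty : ∀ (xs : List V) → length xs ≡ 0 → xs ≡ []
          empty [] _ = refl
          s≡gate : s ≡ gate L
          s≡gate = Path-head (subst (Path _ s z) (trans (split L) (cong (_++ _) (empty (before L) (proj₁ ends)))) path)

        gained : ∀ {l} → length l ≡ g → Cyc Y l → Cyc (graph A′) l
        gained {l} len cycY = decidable-stable (Cyc? (graph A′) l) λ ¬c → none (newCycle refl S cycY len ¬c)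
          where
          none : CardPath (graph A′) v₁ w v₂ x (4 + j) ⊎ CardPath (graph A′) v₁ w t y (4 + j) ⊎
                 CardPath (graph A′) v₁ w t x (3 + j) → ⊥
          none (inj₁ (_ , path , uq , _ , w∉l , len)) =
            ¬pw (direct (there (here refl)) x∉ (Adj-sym (~₂ (Xv S))) path uq w∉l len)
          none (inj₂ (inj₁ (_ , path , uq , _ , w∉l , len))) =
            ¬qw (direct tq∈ y∉ (Adj-sym (~₃ (Xv S))) path uq w∉l len)
          none (inj₂ (inj₂ (_ , path , uq , _ , w∉l , len)))
            with L , far , _ ← detour A′ σ (here refl) w∉ (on tq∈) path uq w∉l x∉ (Adj-sym (~₂ (Xv S))) =
            lastVisit-never (trans (≡-sym (length-++ (before L))) (trans (cong length (≡-sym (split L))) len)) far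

        destroyed : ¬ Cyc Y (map proj₁ zs′)
        destroyed c = contra (Cyc-elim c)
          where
          contra : (∃₂ λ a b → Path Y a b (v₂ ∷ map proj₁ (mid ++ (t , q) ∷ [])) × Adj Y v₁ a × Adj Y b v₁ × a ≢ b ×
                    v₁ ∉ v₂ ∷ map proj₁ (mid ++ (t , q) ∷ []) × Unique (v₂ ∷ map proj₁ (mid ++ (t , q) ∷ []))) → ⊥
          contra (a , b , path , _ , bv₁ , a≢b , _)
            with refl ← Path-head path
               | refl ← Path-last (v₂ ∷ map proj₁ mid) (subst (λ l → Path Y a b (v₂ ∷ l)) (map-++ proj₁ mid _) path)
            with complete (Yu S) (Adj-sym bv₁)
          ... | here refl                 = w∉ (on tq∈)
          ... | there (here refl)         = a≢b refl
          ... | there (there (here refl)) = x∉ (on tq∈)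

      -- `x` and `y` are arranged on either side of `w`, and the exchange takes place at the edge
      -- from the cycle to `w`. Its two outcomes differ only in the names of the other neighbours of
      -- `w`.
      oneOfTwo : w ∈ ws₀ → x ∈ ws₀ → y ∈ ws₀ → w ≢ x → w ≢ y → x ≢ y →
                 ¬ Chord (4 + j) w x → ¬ ¬ Chord (4 + j) w y
      oneOfTwo {w} {x} {y} w∈ x∈ y∈ w≢x w≢y x≢y ¬wx ¬wy = arrange (∈⇒↭ w∈)
        where
        place : ∀ {zs′ rest} → ws₀ ↭ w ∷ x ∷ rest ++ y ∷ [] → Arranged zs′ → map proj₂ zs′ ≡ w ∷ x ∷ rest ++ y ∷ [] → ⊥
        place {(v₁ , _) ∷ (v₂ , _) ∷ zs″} σ A′ eq
          with refl ← ∷-injectiveˡ eq | refl ← ∷-injectiveˡ (∷-injectiveʳ eq)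
          with map-∷ʳ⁻ proj₂ zs″ (∷-injectiveʳ (∷-injectiveʳ eq))
        ... | mid , (t , _) , refl , _ , refl = finish (Cyc-elim (cyc A′))
          where
          zs′ = (v₁ , w) ∷ (v₂ , x) ∷ mid ++ (t , y) ∷ []
          σ′ : ws₀ ↭ map proj₂ zs′
          σ′ = subst (ws₀ ↭_) (≡-sym eq) σ
          v₁w : Adj (graph A′) v₁ w × w ∉ vs₀
          v₁w = All.lookup (spokes A′) (here refl)
          on : ∀ {z} → z ∈ zs′ → proj₁ z ∈ vs₀
          on z∈ = ∈-resp-↭ (perm A′) (∈-map⁺ proj₁ z∈)
          offCycle : ∀ {z} → Adj (graph A′) w z → v₁ ≢ z → z ∉ vs₀
          offCycle wz v₁≢z z∈ = v₁≢z (cong proj₁ (Unique-map-injective {f = proj₂}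
            (Attainable-unique _ (_ , A′ , refl)) (here refl) (spoke∈ A′ z∈ (Adj-sym wz) (proj₂ v₁w)) refl))
          switched : ∀ {c d} → Nbr3 (graph A′) w v₁ c d →
                     (∃ λ Y → K Y × (Switched g (graph A′) Y v₁ w v₂ t c d ⊎ Switched g (graph A′) Y v₁ w v₂ t d c)) → ⊥
          switched N (_ , kY , inj₁ S) = cut A′ σ′ kY S (offCycle (~₂ N) (≢₁₂ N)) (offCycle (~₃ N) (≢₁₃ N))
            (¬wx ∘ Chord-sym) (¬wy ∘ Chord-sym)
          switched N (_ , kY , inj₂ S) = cut A′ σ′ kY S (offCycle (~₃ N) (≢₁₃ N)) (offCycle (~₂ N) (≢₁₂ N))
            (¬wx ∘ Chord-sym) (¬wy ∘ Chord-sym)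
          finish : (∃₂ λ a b → Path (graph A′) a b (v₂ ∷ map proj₁ (mid ++ (t , y) ∷ [])) × Adj (graph A′) v₁ a ×
                    Adj (graph A′) b v₁ × a ≢ b × v₁ ∉ v₂ ∷ map proj₁ (mid ++ (t , y) ∷ []) ×
                    Unique (v₂ ∷ map proj₁ (mid ++ (t , y) ∷ []))) → ⊥
          finish (a , b , path , v₁a , bv₁ , a≢b , _)
            with refl ← Path-head path
               | refl ← Path-last (v₂ ∷ map proj₁ mid)
                          (subst (λ l → Path (graph A′) a b (v₂ ∷ l)) (map-++ proj₁ mid _) path)
            with c , d , N ← Nbr3-extend (cubic (inK A′) w) (Adj-sym (proj₁ v₁w)) =
            switched N (switchEdge (inK A′) (Nbr3-replace (proj₂ (proj₂ (proj₂ (cubic (inK A′) v₁))))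
              (λ { refl → proj₂ v₁w (on (there (here refl))) })
              (λ { refl → proj₂ v₁w (on (there (there (∈-++⁺ʳ mid (here refl))))) })
              a≢b (proj₁ v₁w) v₁a (Adj-sym bv₁)) N)

        arrange : (∃ λ rest → ws₀ ↭ w ∷ rest) → ⊥
        arrange (r₁ , σ₁) with ∈⇒↭ (∈-∷⁻ (∈-resp-↭ σ₁ x∈) (≢-sym w≢x))
        ... | r₂ , σ₂ with ∈⇒↭ (∈-∷⁻ (∈-resp-↭ σ₂ (∈-∷⁻ (∈-resp-↭ σ₁ y∈) (≢-sym w≢y))) (≢-sym x≢y))
        ... | r₃ , σ₃ = attained (Attainable-↭ σ ws₀-attainable)
          where
          σ : ws₀ ↭ w ∷ x ∷ r₃ ++ y ∷ []
          σ = ↭-trans σ₁ (prep w (↭-trans σ₂ (prep x (↭-trans σ₃ (∷↭∷ʳ y r₃)))))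
          attained : Attainable (w ∷ x ∷ r₃ ++ y ∷ []) → ⊥
          attained (_ , A′ , eq) = place σ A′ eq

  -- Brings `noChord` into the form that applies to the new graph after a shortening.
  Near-far : K X → Cyc X vs → length vs ≡ g → ¬ Near X vs (3 + j)
  Near-far {X} {vs} kX cycX len (v , a , e , v∈ , va , a≢e , arm f∈ fe off@(path , _ , out) rlen) =
    go (Arrangements.initial X vs len kX cycX)
    where
    go : (∃ λ (A : ∃ (Arrangements.Arranged X vs len)) → Arrangements.graph (proj₂ A) ≡ X) → ⊥
    go ((zs , A) , A≡) = noChord
      (outer∈ v∈ va (out (Path-start∈ path))) (outer∈ f∈ fe (out (Path-end∈ path))) a≢e (chord off rlen)
      where open Spread X vs len kX cycX zs A A≡

  noCycle : K X → Cyc X vs → length vs ≡ g → ⊥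
  noCycle {X} {vs} kX cycX len = start (Arrangements.initial X vs len kX cycX)
    where
    start : (∃ λ (A : ∃ (Arrangements.Arranged X vs len)) → Arrangements.graph (proj₂ A) ≡ X) → ⊥
    start ((zs , A) , A≡) = go ws₀ ws₀-unique five id
      where
      open Spread X vs len kX cycX zs A A≡
      go : ∀ ws → Unique ws → 5 ≤ length ws → ws ⊆ ws₀ → ⊥
      go (_ ∷ [])             _ (s≤s ())
      go (_ ∷ _ ∷ [])         _ (s≤s (s≤s ()))
      go (_ ∷ _ ∷ _ ∷ [])     _ (s≤s (s≤s (s≤s ())))
      go (_ ∷ _ ∷ _ ∷ _ ∷ []) _ (s≤s (s≤s (s≤s (s≤s ()))))
      -- By `oneOfTwo` at most one of `p`, `q`, `r`, `s` has no chord to `w`. The cases go by the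
      -- first that has none; the other three contradict `Near-far` after a shortening.
      go (w ∷ p ∷ q ∷ r ∷ s ∷ _) ((w≢p ∷ w≢q ∷ w≢r ∷ w≢s ∷ _) ∷ (p≢q ∷ p≢r ∷ p≢s ∷ _) ∷ (q≢r ∷ q≢s ∷ _) ∷ (r≢s ∷ _) ∷ _) _ sub =
        ¬¬-excluded-middle λ where
          (no ¬p) → oneOfTwo w∈ p∈ q∈ w≢p w≢q p≢q ¬p λ cq → oneOfTwo w∈ p∈ r∈ w≢p w≢r p≢r ¬p λ cr →
            oneOfTwo w∈ p∈ s∈ w≢p w≢s p≢s ¬p λ cs → three q∈ r∈ s∈ w≢q w≢r w≢s q≢r q≢s r≢s cq cr cs
          (yes cp) → ¬¬-excluded-middle λ where
            (no ¬q) → oneOfTwo w∈ q∈ r∈ w≢q w≢r q≢r ¬q λ cr → oneOfTwo w∈ q∈ s∈ w≢q w≢s q≢s ¬q λ cs →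
              three p∈ r∈ s∈ w≢p w≢r w≢s p≢r p≢s r≢s cp cr cs
            (yes cq) → ¬¬-excluded-middle λ where
              (no ¬r) → oneOfTwo w∈ r∈ s∈ w≢r w≢s r≢s ¬r λ cs → three p∈ q∈ s∈ w≢p w≢q w≢s p≢q p≢s q≢s cp cq cs
              (yes cr) → three p∈ q∈ r∈ w≢p w≢q w≢r p≢q p≢r q≢r cp cq cr
        where
        w∈ = sub (here refl)
        p∈ = sub (there (here refl))
        q∈ = sub (there (there (here refl)))
        r∈ = sub (there (there (there (here refl))))
        s∈ = sub (there (there (there (there (here refl)))))
        three : ∀ {x y z} → x ∈ ws₀ → y ∈ ws₀ → z ∈ ws₀ → w ≢ x → w ≢ y → w ≢ z → x ≢ y → x ≢ z → y ≢ z →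
                Chord X vs len (4 + j) w x → Chord X vs len (4 + j) w y → Chord X vs len (4 + j) w z → ⊥
        three x∈ y∈ z∈ w≢x w≢y w≢z x≢y x≢z y≢z wx wy wz =
          near (threeChords w∈ x∈ y∈ z∈ w≢x w≢y w≢z x≢y x≢z y≢z wx wy wz)
          where
          near : ¬ (∃ λ Y → K Y × Cyc Y vs × Near Y vs (3 + j))
          near (_ , kY , cycY , nearY) = Near-far kY cycY len nearY

-- Cards and bijections of the vertices

module _ {n : ℕ} where

  private
    variable
      X Y Z : Graph n
      S : Subset n
      u v x y z : Fin n

  to∘from : (F : Fin n ↔ Fin n) → ∀ x → to F (from F x) ≡ x
  to∘from F x = Inverse.strictlyInverseˡ F x

  from∘to : (F : Fin n ↔ Fin n) → ∀ x → from F (to F x) ≡ x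
  from∘to F x = Inverse.strictlyInverseʳ F x

  to-injective : (F : Fin n ↔ Fin n) → to F x ≡ to F y → x ≡ y
  to-injective F eq = trans (≡-sym (from∘to F _)) (trans (cong (from F) eq) (from∘to F _))

  ≅-refl : X ≅ X
  ≅-refl = ↔-id _ , λ _ _ → refl

  ≅-sym : X ≅ Y → Y ≅ X
  ≅-sym {Y = Y} (F , p) = ↔-sym F , λ u v →
    trans (≡-sym (p (from F u) (from F v))) (cong₂ (adj Y) (to∘from F u) (to∘from F v))

  ≅-trans : X ≅ Y → Y ≅ Z → X ≅ Z
  ≅-trans (F , p) (F′ , p′) = F′ ↔-∘ F , λ u v → trans (p′ _ _) (p u v)

  pullback : Graph n → Fin n ↔ Fin n → Graph n
  pullback X F = record
    { adj    = λ x y → adj X (to F x) (to F y)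
    ; sym    = λ x y → Graph.sym X (to F x) (to F y)
    ; irrefl = λ x → irrefl X (to F x) }

  pullback-≅ : ∀ X F → pullback X F ≅ X
  pullback-≅ X F = F , λ _ _ → refl

  fromList : List (Fin n) → Subset n
  fromList []      = ∅
  fromList (x ∷ l) = fromList l [ x ]≔ inside

  ∈-fromList⁺ : ∀ {l} → x ∈ l → x ∈ₛ fromList l
  ∈-fromList⁺ {x} {y ∷ l} x∈ with x ≟ y
  ... | yes refl = []≔-updates (fromList l) x
  ∈-fromList⁺ {x} {y ∷ l} (here x≡y)  | no x≢y = ⊥-elim (x≢y x≡y)
  ∈-fromList⁺ {x} {y ∷ l} (there x∈) | no x≢y = updateAt-minimal x y (fromList l) x≢y (∈-fromList⁺ x∈)

  ∈-fromList⁻ : ∀ l → x ∈ₛ fromList l → x ∈ l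
  ∈-fromList⁻ []      x∈ = ⊥-elim (∉⊥ x∈)
  ∈-fromList⁻ {x} (y ∷ l) x∈ with x ≟ y
  ... | yes refl = here refl
  ... | no x≢y   = there (∈-fromList⁻ l (lookup⇒[]= x (fromList l)
    (trans (≡-sym (lookup∘update′ x≢y (fromList l) inside)) ([]=⇒lookup x∈))))

∣insert∣ : ∀ {n} (p : Subset n) x → x ∉ₛ p → ∣ p [ x ]≔ inside ∣ ≡ suc ∣ p ∣
∣insert∣ (inside ∷ p)  zero    x∉ = ⊥-elim (x∉ here)
∣insert∣ (outside ∷ p) zero    x∉ = refl
∣insert∣ (inside ∷ p)  (suc x) x∉ = cong suc (∣insert∣ p x (x∉ ∘ there))
∣insert∣ (outside ∷ p) (suc x) x∉ = ∣insert∣ p x (x∉ ∘ there)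

∣fromList∣ : ∀ {n} {l : List (Fin n)} → Unique l → ∣ fromList l ∣ ≡ length l
∣fromList∣ {n} {[]}    u = ∣⊥∣≡0 n
∣fromList∣ {l = x ∷ l} u@(_ ∷ u′) =
  trans (∣insert∣ (fromList l) x (Unique[x∷xs]⇒x∉xs u ∘ ∈-fromList⁻ l)) (cong suc (∣fromList∣ u′))

missingOne : ∀ {n} (S : Subset n) → suc ∣ S ∣ ≡ n → ∃ λ u → u ∉ₛ S × (∀ {z} → z ∉ₛ S → z ≡ u)
missingOne (outside ∷ S) eq = zero , (λ ()) , only
  where
  only : ∀ {z} → z ∉ₛ outside ∷ S → z ≡ zero
  only {zero}  _  = refl
  only {suc z} z∉ = ⊥-elim (z∉ (there (subst (z ∈ₛ_) (≡-sym (∣p∣≡n⇒p≡⊤ (suc-injective eq))) ∈⊤)))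
missingOne (inside ∷ S) eq with missingOne S (suc-injective eq)
... | u , u∉ , only = suc u , u∉ ∘ drop-there , only′
  where
  only′ : ∀ {z} → z ∉ₛ inside ∷ S → z ≡ suc u
  only′ {zero}  z∉ = ⊥-elim (z∉ here)
  only′ {suc z} z∉ = cong suc (only (z∉ ∘ there))

missingTwo : ∀ {n} (S : Subset n) → 2 + ∣ S ∣ ≡ n →
             ∃₂ λ u v → u ≢ v × u ∉ₛ S × v ∉ₛ S × (∀ {z} → z ∉ₛ S → z ≡ u ⊎ z ≡ v)
missingTwo (outside ∷ S) eq with missingOne S (suc-injective eq)
... | v , v∉ , only = zero , suc v , (λ ()) , (λ ()) , v∉ ∘ drop-there , only′
  where
  only′ : ∀ {z} → z ∉ₛ outside ∷ S → z ≡ zero ⊎ z ≡ suc v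
  only′ {zero}  _  = inj₁ refl
  only′ {suc z} z∉ = inj₂ (cong suc (only (z∉ ∘ there)))
missingTwo (inside ∷ S) eq with missingTwo S (suc-injective eq)
... | u , v , u≢v , u∉ , v∉ , only =
  suc u , suc v , (λ { refl → u≢v refl }) , u∉ ∘ drop-there , v∉ ∘ drop-there , only′
  where
  only′ : ∀ {z} → z ∉ₛ inside ∷ S → z ≡ suc u ⊎ z ≡ suc v
  only′ {zero}  z∉ = ⊥-elim (z∉ here)
  only′ {suc z} z∉ = [ inj₁ ∘ cong suc , inj₂ ∘ cong suc ]′ (only (z∉ ∘ there))

Members-≡ : ∀ {n} {S : Subset n} {s t : Members S} → proj₁ s ≡ proj₁ t → s ≡ t
Members-≡ {s = _ , p} {t = _ , q} refl = cong (_ ,_) ([]=-irrelevant p q)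

module _ {n : ℕ} where

  private
    V = Fin n

  -- Off the card, `u` goes to `u′` and the other missing vertex to `v′`. The decision is an
  -- argument, so that both directions can be compared by cases on it.
  patch : ∀ {S T : Subset n} (f : Members S → Members T) (u u′ v′ : V) (z : V) → Dec (z ∈ₛ S) → V
  patch f u u′ v′ z (yes z∈) = proj₁ (f (z , z∈))
  patch f u u′ v′ z (no _) with z ≟ u
  ... | yes _ = u′
  ... | no _  = v′

  patch-∈ : ∀ {S T : Subset n} (f : Members S → Members T) {u u′ v′ z} (d : Dec (z ∈ₛ S)) (z∈ : z ∈ₛ S) →
            patch f u u′ v′ z d ≡ proj₁ (f (z , z∈))
  patch-∈ f (yes p) z∈ = cong (proj₁ ∘ f) (Members-≡ refl)
  patch-∈ f (no ∉)  z∈ = ⊥-elim (∉ z∈)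

  patch-inverse : ∀ {S T : Subset n} (f : Members S → Members T) (f⁻¹ : Members T → Members S) →
                  (∀ s → f⁻¹ (f s) ≡ s) → ∀ {u v u′ v′} → u′ ≢ v′ → u′ ∉ₛ T → v′ ∉ₛ T →
                  (∀ {z} → z ∉ₛ S → z ≡ u ⊎ z ≡ v) → ∀ z (d : Dec (z ∈ₛ S)) (d′ : Dec (patch f u u′ v′ z d ∈ₛ T)) →
                  patch f⁻¹ u′ u v (patch f u u′ v′ z d) d′ ≡ z
  patch-inverse f f⁻¹ inv u′≢v′ u′∉ v′∉ out z (yes z∈) d′ =
    trans (patch-∈ f⁻¹ d′ (proj₂ (f (z , z∈)))) (cong proj₁ (inv (z , z∈)))
  patch-inverse f f⁻¹ inv {u} {v} {u′} {v′} u′≢v′ u′∉ v′∉ out z (no z∉) d′ with z ≟ u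
  patch-inverse f f⁻¹ inv {u} {v} {u′} {v′} u′≢v′ u′∉ v′∉ out z (no z∉) (yes ∈T) | yes refl = ⊥-elim (u′∉ ∈T)
  patch-inverse f f⁻¹ inv {u} {v} {u′} {v′} u′≢v′ u′∉ v′∉ out z (no z∉) (no _) | yes refl with u′ ≟ u′
  ... | yes _  = refl
  ... | no u′≢ = ⊥-elim (u′≢ refl)
  patch-inverse f f⁻¹ inv {u} {v} {u′} {v′} u′≢v′ u′∉ v′∉ out z (no z∉) (yes ∈T) | no z≢u = ⊥-elim (v′∉ ∈T)
  patch-inverse f f⁻¹ inv {u} {v} {u′} {v′} u′≢v′ u′∉ v′∉ out z (no z∉) (no _) | no z≢u with v′ ≟ u′ | out z∉
  ... | yes v′≡u′ | _         = ⊥-elim (u′≢v′ (≡-sym v′≡u′))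
  ... | no _      | inj₁ z≡u  = ⊥-elim (z≢u z≡u)
  ... | no _      | inj₂ z≡v  = ≡-sym z≡v

  record CardMap (G H : Graph n) (S T : Subset n) : Set where
    field
      F         : V ↔ V
      into      : ∀ {z} → z ∈ₛ S → to F z ∈ₛ T
      preserves : ∀ {x y} → x ∈ₛ S → y ∈ₛ S → adj H (to F x) (to F y) ≡ adj G x y

  abstract
    -- Along a bijection of all vertices a whole graph can be pulled back, and then two graphs agree
    -- on a card literally and not only up to isomorphism.
    extendCard : ∀ {G H : Graph n} {S T} → 2 + ∣ S ∣ ≡ n → 2 + ∣ T ∣ ≡ n → InducedIso G S H T → CardMap G H S T
    extendCard {G} {H} {S} {T} ∣S∣ ∣T∣ (f , iso) with missingTwo S ∣S∣ | missingTwo T ∣T∣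
    ... | u , v , u≢v , u∉ , v∉ , outS | u′ , v′ , u′≢v′ , u′∉ , v′∉ , outT = record
      { F = mk↔ₛ′ F F⁻¹
          (λ y → patch-inverse (from f) (to f) (Inverse.strictlyInverseˡ f) u≢v u∉ v∉ outT y (y ∈ₛ? T) (F⁻¹ y ∈ₛ? S))
          (λ z → patch-inverse (to f) (from f) (Inverse.strictlyInverseʳ f) u′≢v′ u′∉ v′∉ outS z (z ∈ₛ? S) (F z ∈ₛ? T))
      ; into = λ {z} z∈ → subst (_∈ₛ T) (≡-sym (F-∈ z∈)) (proj₂ (to f (z , z∈)))
      ; preserves = λ {x} {y} x∈ y∈ → trans (cong₂ (adj H) (F-∈ x∈) (F-∈ y∈)) (iso (x , x∈) (y , y∈)) }
      where
      F : V → V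
      F z = patch (to f) u u′ v′ z (z ∈ₛ? S)
      F⁻¹ : V → V
      F⁻¹ y = patch (from f) u′ u v y (y ∈ₛ? T)
      F-∈ : ∀ {z} (z∈ : z ∈ₛ S) → F z ≡ proj₁ (to f (z , z∈))
      F-∈ {z} z∈ = patch-∈ (to f) (z ∈ₛ? S) z∈

  InducedIso-sym : ∀ {G H : Graph n} {S T} → InducedIso G S H T → InducedIso H T G S
  InducedIso-sym {H = H} (f , iso) = ↔-sym f , λ u v →
    trans (≡-sym (iso (from f u) (from f v)))
      (cong₂ (λ s t → adj H (proj₁ s) (proj₁ t)) (Inverse.strictlyInverseˡ f u) (Inverse.strictlyInverseˡ f v))

  SameDeck-sym : ∀ {k} {G H : Graph n} → SameDeck k G H → SameDeck k H G
  SameDeck-sym {G = G} {H} (φ , iso) = ↔-sym φ , λ T → InducedIso-sym {G = G} {H} {proj₁ (from φ T)} {proj₁ T}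
    (subst (λ T′ → InducedIso G (proj₁ (from φ T)) H (proj₁ T′)) (Inverse.strictlyInverseˡ φ T) (iso (from φ T)))

  module _ {G H : Graph n} (2≤n : 2 ≤ n) (deck : SameDeck (n ∸ 2) G H) where

    private
      complementary : ∀ {k} → k ≡ n ∸ 2 → 2 + k ≡ n
      complementary refl = m+[n∸m]≡n 2≤n

    cardMap : ∀ S → CardMap G H (proj₁ S) (proj₁ (to (proj₁ deck) S))
    cardMap S = extendCard {G = G} {H} (complementary (proj₂ S)) (complementary (proj₂ (to (proj₁ deck) S))) (proj₂ deck S)

    abstract
      deckMate : ∀ {u v} → u ≢ v → ∃ λ (F : V ↔ V) → ∀ {x y} → x ≢ u → x ≢ v → y ≢ u → y ≢ v →
                 adj H (to F x) (to F y) ≡ adj G x y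
      deckMate {u} {v} u≢v = CardMap.F C , λ x≢u x≢v y≢u y≢v → CardMap.preserves C (inS x≢u x≢v) (inS y≢u y≢v)
        where
        p : Subset n
        p = fromList (u ∷ v ∷ [])
        S : KSubset n (n ∸ 2)
        S = ∁ p , trans (∣∁p∣≡n∸∣p∣ p) (cong (n ∸_) (∣fromList∣ ((u≢v ∷ []) ∷ [] ∷ [])))
        C : CardMap G H (∁ p) (proj₁ (to (proj₁ deck) S))
        C = cardMap S
        inS : ∀ {x} → x ≢ u → x ≢ v → x ∈ₛ ∁ p
        inS x≢u x≢v = x∉p⇒x∈∁p λ x∈ → case ∈-fromList⁻ (u ∷ v ∷ []) x∈ of λ where
          (here x≡u)         → x≢u x≡u
          (there (here x≡v)) → x≢v x≡v

-- Degree counts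

bit : Bool → ℕ
bit true  = 1
bit false = 0

bit-injective : ∀ {p q} → bit p ≡ bit q → p ≡ q
bit-injective {true}  {true}  _ = refl
bit-injective {false} {false} _ = refl

bit-double : ∀ {p q} → bit p + bit p ≡ bit q + bit q → p ≡ q
bit-double {true}  {true}  _ = refl
bit-double {false} {false} _ = refl

bits-both : ∀ p {p′ q′} → bit p + bit p ≡ bit p′ + bit q′ → p′ ≡ p × q′ ≡ p
bits-both true  {true}  {true}  _ = refl , refl
bits-both true  {true}  {false} ()
bits-both true  {false} {true}  ()
bits-both true  {false} {false} ()
bits-both false {false} {false} _ = refl , refl

bits-crossed : ∀ {p q p′ q′} → bit p + bit q ≡ bit p′ + bit q′ → p ≢ p′ → p′ ≡ q × q′ ≡ p
bits-crossed {true}  {_}     {true}          _  p≢p′ = ⊥-elim (p≢p′ refl)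
bits-crossed {false} {_}     {false}         _  p≢p′ = ⊥-elim (p≢p′ refl)
bits-crossed {true}  {false} {false} {true}  _  _    = refl , refl
bits-crossed {false} {true}  {true}  {false} _  _    = refl , refl

module _ {A : Set} where

  length-filter-T? : (f : A → Bool) → ∀ l → length (filter (T? ∘ f) l) ≡ sum (map (bit ∘ f) l)
  length-filter-T? f []      = refl
  length-filter-T? f (x ∷ l) with f x
  ... | true  = cong suc (length-filter-T? f l)
  ... | false = length-filter-T? f l

  sum-map-+ : (f g : A → ℕ) → ∀ l → sum (map (λ x → f x + g x) l) ≡ sum (map f l) + sum (map g l)
  sum-map-+ f g []      = refl
  sum-map-+ f g (x ∷ l) = trans (cong (f x + g x +_) (sum-map-+ f g l)) (regroup (f x) (g x) _ _)
    where
    regroup : ∀ a b c d → a + b + (c + d) ≡ a + c + (b + d)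
    regroup = solve-∀

  sum-map-cong : (f g : A → ℕ) → ∀ l → (∀ {x} → x ∈ l → f x ≡ g x) → sum (map f l) ≡ sum (map g l)
  sum-map-cong f g []      eq = refl
  sum-map-cong f g (x ∷ l) eq = cong₂ _+_ (eq (here refl)) (sum-map-cong f g l (eq ∘ there))

  sum-changeOne : (f g : A → ℕ) → ∀ {l u} → Unique l → u ∈ l → (∀ {x} → x ≢ u → f x ≡ g x) →
                  sum (map f l) + g u ≡ sum (map g l) + f u
  sum-changeOne f g {x ∷ l} uq (here refl) eq =
    trans (cong (λ s → f x + s + g x) (sum-map-cong f g l λ y∈ → eq λ { refl → Unique[x∷xs]⇒x∉xs uq y∈ }))
          (regroup (f x) (sum (map g l)) (g x))
    where
    regroup : ∀ a b c → a + b + c ≡ c + b + a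
    regroup = solve-∀
  sum-changeOne f g {x ∷ l} {u} uq@(_ ∷ uq′) (there u∈) eq = trans (+-assoc (f x) _ (g u))
    (trans (cong₂ _+_ (eq λ { refl → Unique[x∷xs]⇒x∉xs uq u∈ }) (sum-changeOne f g uq′ u∈ eq))
           (≡-sym (+-assoc (g x) _ (f u))))

module _ {n : ℕ} where

  private
    V = Fin n
    variable
      X Y : Graph n
      a b c d u v w x y z : V

  ∑ : (V → ℕ) → ℕ
  ∑ f = sum (map f (allFin n))

  degree-∑ : ∀ (X : Graph n) v → degree X v ≡ ∑ (bit ∘ adj X v)
  degree-∑ X v = length-filter-T? (adj X v) (allFin n)

  ∑-changeOne : (f g : V → ℕ) → (∀ {x} → x ≢ u → f x ≡ g x) → ∑ f ≡ ∑ g → f u ≡ g u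
  ∑-changeOne {u} f g eq ∑≡ = ≡-sym (+-cancelˡ-≡ (∑ g) _ _
    (trans (cong (_+ g u) (≡-sym ∑≡)) (sum-changeOne f g (allFin⁺ n) (∈-allFin u) eq)))

  ∑-changeTwo : (f g : V → ℕ) → u ≢ v → (∀ {x} → x ≢ u → x ≢ v → f x ≡ g x) → ∑ f ≡ ∑ g →
                f u + f v ≡ g u + g v
  ∑-changeTwo {u} {v} f g u≢v eq ∑≡ = combine (sum-changeOne f h (allFin⁺ n) (∈-allFin u) f≡h)
                                              (sum-changeOne h g (allFin⁺ n) (∈-allFin v) h≡g)
    where
    h : V → ℕ
    h x with x ≟ u
    ... | yes _ = g u
    ... | no _  = f x
    f≡h : ∀ {x} → x ≢ u → f x ≡ h x
    f≡h {x} x≢u with x ≟ u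
    ... | yes x≡u = ⊥-elim (x≢u x≡u)
    ... | no _    = refl
    h≡g : ∀ {x} → x ≢ v → h x ≡ g x
    h≡g {x} x≢v with x ≟ u
    ... | yes refl = refl
    ... | no x≢u   = eq x≢u x≢v
    hu : h u ≡ g u
    hu with u ≟ u
    ... | yes _  = refl
    ... | no u≢u = ⊥-elim (u≢u refl)
    hv : h v ≡ f v
    hv = ≡-sym (f≡h (≢-sym u≢v))
    combine : ∑ f + h u ≡ ∑ h + f u → ∑ h + g v ≡ ∑ g + h v → f u + f v ≡ g u + g v
    combine e₁ e₂ = ≡-sym (+-cancelˡ-≡ (∑ g + ∑ h) _ _
      (trans (swap₁ (∑ g) (∑ h) (g u) (g v)) (trans (cong₂ _+_
        (trans (cong₂ _+_ (≡-sym ∑≡) (≡-sym hu)) e₁) (trans e₂ (cong (∑ g +_) hv))) (swap₂ (∑ g) (∑ h) (f u) (f v)))))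
      where
      swap₁ : ∀ a b c d → a + b + (c + d) ≡ (a + c) + (b + d)
      swap₁ = solve-∀
      swap₂ : ∀ a b c d → (b + c) + (a + d) ≡ a + b + (c + d)
      swap₂ = solve-∀

  Regular-∑ : Regular 3 X → Regular 3 Y → ∀ u → ∑ (bit ∘ adj X u) ≡ ∑ (bit ∘ adj Y u)
  Regular-∑ {X} {Y} rX rY u =
    trans (≡-sym (degree-∑ X u)) (trans (trans (rX u) (≡-sym (rY u))) (degree-∑ Y u))

  module Balance {X Y : Graph n} (rX : Regular 3 X) (rY : Regular 3 Y) {u v : V} (u≢v : u ≢ v)
                 (ag : Agree X Y u v) where

    -- `z` has degree 3 in both graphs and the same neighbours apart from `u` and `v`.
    balance : z ≢ u → z ≢ v → bit (adj X z u) + bit (adj X z v) ≡ bit (adj Y z u) + bit (adj Y z v)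
    balance {z} z≢u z≢v = ∑-changeTwo (bit ∘ adj X z) (bit ∘ adj Y z) u≢v
      (λ x≢u x≢v → cong bit (≡-sym (agrees ag z≢u z≢v x≢u x≢v))) (Regular-∑ {X} {Y} rX rY z)

    -- The degrees of `u` and `v` add up to 6 in both graphs. By `balance` the other vertices
    -- contribute equally, and the edge `uv` contributes twice.
    sameEdge : adj X u v ≡ adj Y u v
    sameEdge = bit-double (subst₂ _≡_ (both X) (both Y) (∑-changeTwo (pair X) (pair Y) u≢v balance
      (trans (total X rX) (≡-sym (total Y rY)))))
      where
      pair : Graph n → V → ℕ
      pair Z z = bit (adj Z z u) + bit (adj Z z v)
      both : ∀ Z → pair Z u + pair Z v ≡ bit (adj Z u v) + bit (adj Z u v)
      both Z rewrite irrefl Z u | irrefl Z v | Graph.sym Z v u = cong (bit (adj Z u v) +_) (+-comm _ 0)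
      total : ∀ Z → Regular 3 Z → ∑ (pair Z) ≡ 6
      total Z r = trans (sum-map-+ (λ z → bit (adj Z z u)) (λ z → bit (adj Z z v)) (allFin n)) (cong₂ _+_ (column u) (column v))
        where
        column : ∀ w → ∑ (λ z → bit (adj Z z w)) ≡ 3
        column w = trans (sum-map-cong _ (bit ∘ adj Z w) (allFin n) (λ _ → cong bit (Graph.sym Z _ w)))
                     (trans (≡-sym (degree-∑ Z w)) (r w))

-- Exchanging two vertices

module _ {n : ℕ} where

  private
    V = Fin n
    variable
      X Y : Graph n
      a b c d u v w x y z : V

  Adj⇒T : Adj X u v → T (adj X u v)
  Adj⇒T (edge e) rewrite e = _

  T⇒Adj : T (adj X u v) → Adj X u v
  T⇒Adj {X} {u} {v} t with adj X u v in eq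
  ... | true = edge eq

  neighbours : Graph n → V → List V
  neighbours X v = filter (λ u → T? (adj X v u)) (allFin n)

  neighbours-unique : ∀ X v → Unique (neighbours X v)
  neighbours-unique X v = filter⁺ (λ u → T? (adj X v u)) (allFin⁺ n)

  ∈-neighbours⁺ : ∀ X {v u} → Adj X v u → u ∈ neighbours X v
  ∈-neighbours⁺ X {v} {u} e = ∈-filter⁺ (λ u → T? (adj X v u)) (∈-allFin u) (Adj⇒T e)

  ∈-neighbours⁻ : ∀ X {v u} → u ∈ neighbours X v → Adj X v u
  ∈-neighbours⁻ X {v} u∈ = T⇒Adj (proj₂ (∈-filter⁻ (λ u → T? (adj X v u)) {xs = allFin n} u∈))

  degree-≤ : ((F , _) : X ≅ Y) → ∀ v → degree X v ≤ degree Y (to F v)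
  degree-≤ {X} {Y} (F , iso) v = ≤-trans (≤-reflexive (≡-sym (length-map (to F) (neighbours X v))))
    (Unique-⊆⇒length≤ (Unique-map⁺ (to-injective F) (neighbours-unique X v)) sub)
    where
    sub : map (to F) (neighbours X v) ⊆ neighbours Y (to F v)
    sub y∈ with ∈-map⁻ (to F) y∈
    ... | x , x∈ , refl = ∈-neighbours⁺ Y (edge (trans (iso v x) (adj≡true (∈-neighbours⁻ X {v} x∈))))

  Regular-≅ : ∀ {r} → X ≅ Y → Regular r Y → Regular r X
  Regular-≅ {X} {Y} I@(F , _) rY v = ≤-antisym
    (≤-trans (degree-≤ {X} {Y} I v) (≤-reflexive (rY _)))
    (≤-trans (≤-reflexive (≡-sym (rY (to F v))))
      (subst (λ w → degree Y (to F v) ≤ degree X w) (from∘to F v) (degree-≤ {Y} {X} (≅-sym {X = X} {Y} I) (to F v))))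

  abstract
    Regular⇒Nbr3 : Regular 3 X → ∀ v → ∃ λ a → ∃₂ λ b c → Nbr3 X v a b c
    Regular⇒Nbr3 {X} r v = go (neighbours X v) (r v) (neighbours-unique X v) (∈-neighbours⁻ X) (∈-neighbours⁺ X)
      where
      go : ∀ l → length l ≡ 3 → Unique l → (∀ {u} → u ∈ l → Adj X v u) → (∀ {u} → Adj X v u → u ∈ l) →
           ∃ λ a → ∃₂ λ b c → Nbr3 X v a b c
      go (a ∷ b ∷ c ∷ []) _ ((a≢b ∷ a≢c ∷ []) ∷ (b≢c ∷ []) ∷ _) sound complete = a , b , c , record
        { ≢₁₂ = a≢b ; ≢₁₃ = a≢c ; ≢₂₃ = b≢c
        ; ~₁ = sound (here refl) ; ~₂ = sound (there (here refl)) ; ~₃ = sound (there (there (here refl)))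
        ; complete = complete }

  ¬Adj⇒false : ¬ Adj X u v → adj X u v ≡ false
  ¬Adj⇒false {X} {u} {v} ¬e with adj X u v in eq
  ... | true  = ⊥-elim (¬e (edge eq))
  ... | false = refl

  Nbr3⇒false : Nbr3 X v a b c → z ≢ a → z ≢ b → z ≢ c → adj X z v ≡ false
  Nbr3⇒false {X = X} {v} {z = z} N z≢a z≢b z≢c = ¬Adj⇒false {X} {z} {v} λ e → none (complete N (Adj-sym e))
    where
    none : z ∈ _ ∷ _ ∷ _ ∷ [] → ⊥
    none (here eq)                 = z≢a eq
    none (there (here eq))         = z≢b eq
    none (there (there (here eq))) = z≢c eq

  abstract
    matched-≅ : Agree X Y u v → adj X u v ≡ adj Y u v →
                (∀ {z} → z ≢ u → z ≢ v → adj Y z u ≡ adj X z u × adj Y z v ≡ adj X z v) → X ≅ Y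
    matched-≅ {X} {Y} {u} {v} ag uv rows = ↔-id _ , same
      where
      same : ∀ x y → adj Y x y ≡ adj X x y
      same x y with x ≟ u | x ≟ v | y ≟ u | y ≟ v
      ... | yes refl | _        | yes refl | _        = trans (irrefl Y u) (≡-sym (irrefl X u))
      ... | yes refl | _        | no _     | yes refl = ≡-sym uv
      ... | yes refl | _        | no y≢u   | no y≢v   = trans (Graph.sym Y u y) (trans (proj₁ (rows y≢u y≢v)) (Graph.sym X y u))
      ... | no _     | yes refl | yes refl | _        = trans (Graph.sym Y v u) (trans (≡-sym uv) (Graph.sym X u v))
      ... | no _     | yes refl | no _     | yes refl = trans (irrefl Y v) (≡-sym (irrefl X v))
      ... | no _     | yes refl | no y≢u   | no y≢v   = trans (Graph.sym Y v y) (trans (proj₂ (rows y≢u y≢v)) (Graph.sym X y v))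
      ... | no x≢u   | no x≢v   | yes refl | _        = proj₁ (rows x≢u x≢v)
      ... | no x≢u   | no x≢v   | no _     | yes refl = proj₂ (rows x≢u x≢v)
      ... | no x≢u   | no x≢v   | no y≢u   | no y≢v   = agrees ag x≢u x≢v y≢u y≢v

  transpose-left : ∀ (u v : V) → PC.transpose u v u ≡ v
  transpose-left u v with u ≟ u
  ... | yes _  = refl
  ... | no u≢u = ⊥-elim (u≢u refl)

  transpose-right : ∀ (u v : V) → PC.transpose u v v ≡ u
  transpose-right u v with v ≟ u
  ... | yes refl = refl
  ... | no _ with v ≟ v
  ...   | yes _  = refl
  ...   | no v≢v = ⊥-elim (v≢v refl)

  transpose-fixed : z ≢ u → z ≢ v → PC.transpose u v z ≡ z
  transpose-fixed {z} {u} {v} z≢u z≢v with z ≟ u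
  ... | yes z≡u = ⊥-elim (z≢u z≡u)
  ... | no _ with z ≟ v
  ...   | yes z≡v = ⊥-elim (z≢v z≡v)
  ...   | no _    = refl

  swapEnds : Graph n → V → V → Graph n
  swapEnds Y u v = pullback Y (transpose u v)

  module SwapEnds (Y : Graph n) (u v : V) where

    swapEnds-≅ : swapEnds Y u v ≅ Y
    swapEnds-≅ = pullback-≅ Y (transpose u v)

    swapEnds-agree : Agree X Y u v → Agree X (swapEnds Y u v) u v
    swapEnds-agree ag = agreement λ x≢u x≢v y≢u y≢v →
      trans (cong₂ (adj Y) (transpose-fixed x≢u x≢v) (transpose-fixed y≢u y≢v)) (agrees ag x≢u x≢v y≢u y≢v)

    swapEnds-edge : adj (swapEnds Y u v) u v ≡ adj Y u v
    swapEnds-edge = trans (cong₂ (adj Y) (transpose-left u v) (transpose-right u v)) (Graph.sym Y v u)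

    swapEnds-u : z ≢ u → z ≢ v → adj (swapEnds Y u v) z u ≡ adj Y z v
    swapEnds-u z≢u z≢v = cong₂ (adj Y) (transpose-fixed z≢u z≢v) (transpose-left u v)

    swapEnds-v : z ≢ u → z ≢ v → adj (swapEnds Y u v) z v ≡ adj Y z u
    swapEnds-v z≢u z≢v = cong₂ (adj Y) (transpose-fixed z≢u z≢v) (transpose-right u v)

  -- The bits form a table: rows for `a` and `b`, columns for `u` and `v`. With both row sums and a
  -- column sum preserved, the table stays as it is or its columns are exchanged.
  fourBits : ∀ p {q r s p′ q′ r′ s′} → bit p + bit q ≡ bit p′ + bit q′ → bit r + bit s ≡ bit r′ + bit s′ →
             bit p + bit r ≡ bit p′ + bit r′ →
             (p′ ≡ p × q′ ≡ q × r′ ≡ r × s′ ≡ s) ⊎ (p′ ≡ q × q′ ≡ p × r′ ≡ s × s′ ≡ r)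
  fourBits p {r = r} {p′ = p′} {r′ = r′} pq rs pr with p Bool.≟ p′
  ... | yes refl with refl ← bit-injective {r} {r′} (+-cancelˡ-≡ (bit p) _ _ pr) =
    inj₁ (refl , ≡-sym (bit-injective (+-cancelˡ-≡ (bit p) _ _ pq)) , refl ,
          ≡-sym (bit-injective (+-cancelˡ-≡ (bit r) _ _ rs)))
  ... | no p≢p′ with bits-crossed pq p≢p′ | bits-crossed pr p≢p′
  ...   | p′≡q , q′≡p | p′≡r , r′≡p with bits-crossed rs (λ r≡r′ → p≢p′ (trans (≡-sym r′≡p) (trans (≡-sym r≡r′) (≡-sym p′≡r))))
  ...     | r′≡s , s′≡r = inj₂ (p′≡q , q′≡p , r′≡s , s′≡r)

  -- The card without u and v leaves only the choice of exchanging u and v.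
  abstract
    twins-≅ : Regular 3 X → Regular 3 Y → u ≢ v → Agree X Y u v →
              a ≢ u → a ≢ v → b ≢ u → b ≢ v →
              (∀ {z} → z ≢ u → z ≢ v → z ≢ a → z ≢ b → adj X z u ≡ adj X z v) → X ≅ Y
    twins-≅ {X} {Y} {u} {v} {a} {b} rX rY u≢v ag a≢u a≢v b≢u b≢v twin = conclude
      where
      open Balance {X = X} {Y = Y} rX rY u≢v ag
      open SwapEnds Y u v

      -- A vertex adjacent to both or to neither of `u` and `v` leaves no choice: its sum 2 or 0
      -- determines both bits.
      common : ∀ {z} → z ≢ u → z ≢ v → z ≢ a → z ≢ b → adj Y z u ≡ adj X z u × adj Y z v ≡ adj X z u
      common {z} z≢u z≢v z≢a z≢b = bits-both (adj X z u)
        (trans (cong (λ q → bit (adj X z u) + bit q) (twin z≢u z≢v z≢a z≢b)) (balance z≢u z≢v))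

      row : ∀ {z} → z ≢ a → z ≢ b → bit (adj X u z) ≡ bit (adj Y u z)
      row {z} z≢a z≢b with z ≟ u | z ≟ v
      ... | yes refl | _        = cong bit (trans (irrefl X u) (≡-sym (irrefl Y u)))
      ... | no _     | yes refl = cong bit sameEdge
      ... | no z≢u   | no z≢v   = cong bit (trans (Graph.sym X u z)
        (trans (≡-sym (proj₁ (common z≢u z≢v z≢a z≢b))) (Graph.sym Y z u)))

      flip : ∀ (Z : Graph n) z → bit (adj Z u z) ≡ bit (adj Z z u)
      flip Z z = cong bit (Graph.sym Z u z)

      unswapped : adj Y a u ≡ adj X a u → adj Y a v ≡ adj X a v → adj Y b u ≡ adj X b u → adj Y b v ≡ adj X b v → X ≅ Y
      unswapped au av bu bv = matched-≅ {X} {Y} ag sameEdge rows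
        where
        rows : ∀ {z} → z ≢ u → z ≢ v → adj Y z u ≡ adj X z u × adj Y z v ≡ adj X z v
        rows {z} z≢u z≢v with z ≟ a | z ≟ b
        ... | yes refl | _        = au , av
        ... | no _     | yes refl = bu , bv
        ... | no z≢a   | no z≢b   = let p , q = common z≢u z≢v z≢a z≢b in p , trans q (twin z≢u z≢v z≢a z≢b)

      swapped : adj Y a u ≡ adj X a v → adj Y a v ≡ adj X a u → adj Y b u ≡ adj X b v → adj Y b v ≡ adj X b u → X ≅ Y
      swapped au av bu bv = ≅-trans {X = X} {Y = swapEnds Y u v} {Z = Y}
        (matched-≅ {X} {swapEnds Y u v} (swapEnds-agree ag) (trans sameEdge (≡-sym swapEnds-edge))
          λ z≢u z≢v → let p , q = rows z≢u z≢v in trans (swapEnds-u z≢u z≢v) q , trans (swapEnds-v z≢u z≢v) p)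
        swapEnds-≅
        where
        rows : ∀ {z} → z ≢ u → z ≢ v → adj Y z u ≡ adj X z v × adj Y z v ≡ adj X z u
        rows {z} z≢u z≢v with z ≟ a | z ≟ b
        ... | yes refl | _        = au , av
        ... | no _     | yes refl = bu , bv
        ... | no z≢a   | no z≢b   = let p , q = common z≢u z≢v z≢a z≢b in trans p (twin z≢u z≢v z≢a z≢b) , q

      conclude : X ≅ Y
      conclude with a ≟ b
      ... | yes refl = unswapped p≡ q≡ p≡ q≡
        where
        p≡ : adj Y a u ≡ adj X a u
        p≡ = ≡-sym (bit-injective (trans (≡-sym (flip X a)) (trans
          (∑-changeOne (bit ∘ adj X u) (bit ∘ adj Y u) (λ z≢a → row z≢a z≢a) (Regular-∑ {X = X} {Y = Y} rX rY u)) (flip Y a))))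
        q≡ : adj Y a v ≡ adj X a v
        q≡ = ≡-sym (bit-injective (+-cancelˡ-≡ (bit (adj X a u)) _ _
          (trans (balance a≢u a≢v) (cong (λ p → bit p + bit (adj Y a v)) p≡))))
      ... | no a≢b with fourBits (adj X a u) (balance a≢u a≢v) (balance b≢u b≢v)
                        (trans (≡-sym (cong₂ _+_ (flip X a) (flip X b)))
                          (trans (∑-changeTwo (bit ∘ adj X u) (bit ∘ adj Y u) a≢b row (Regular-∑ {X = X} {Y = Y} rX rY u))
                                 (cong₂ _+_ (flip Y a) (flip Y b))))
      ...   | inj₁ (au , av , bu , bv) = unswapped au av bu bv
      ...   | inj₂ (au , av , bu , bv) = swapped au av bu bv

-- Girth and exchanges

module Mates {n : ℕ} (K : Graph n → Set) (regular : ∀ X → K X → Regular 3 X)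
  (K-resp-≅ : ∀ X Y → X ≅ Y → K Y → K X)
  (mate : ∀ X {u v} → K X → u ≢ v → ∃ λ Y → K Y × Agree X Y u v × ¬ X ≅ Y) where

  private
    V = Fin n
    variable
      X Y : Graph n
      a b c d p q r s u v w x y z : V
      l : List V

  K-cubic : K X → ∀ v → ∃ λ a → ∃₂ λ b c → Nbr3 X v a b c
  K-cubic {X} kX = Regular⇒Nbr3 {X = X} (regular _ kX)

  triangle-free : K X → Adj X u v → Adj X u w → Adj X v w → ⊥
  triangle-free {X} {u} {v} {w} kX uv uw vw
    with Nbr3-third (proj₂ (proj₂ (proj₂ (K-cubic kX u)))) uv uw (Adj⇒≢ vw)
       | Nbr3-third (proj₂ (proj₂ (proj₂ (K-cubic kX v)))) (Adj-sym uv) vw (Adj⇒≢ uw)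
       | mate _ kX (Adj⇒≢ uv)
  ... | a , N | b , M | Y , kY , ag , X≇Y =
    X≇Y (twins-≅ {X = X} {Y} (regular _ kX) (regular _ kY) (Adj⇒≢ uv) ag
      (≢-sym (Adj⇒≢ (~₃ N))) (≢-sym (≢₁₃ N)) (≢-sym (≢₁₃ M)) (≢-sym (Adj⇒≢ (~₃ M))) twin)
    where
    twin : ∀ {z} → z ≢ u → z ≢ v → z ≢ a → z ≢ b → adj X z u ≡ adj X z v
    twin {z} z≢u z≢v z≢a z≢b with z ≟ w
    ... | yes refl = trans (adj≡true (Adj-sym uw)) (≡-sym (adj≡true (Adj-sym vw)))
    ... | no z≢w   = trans (Nbr3⇒false N z≢v z≢w z≢a) (≡-sym (Nbr3⇒false M z≢u z≢w z≢b))

  -- With two common neighbours, `u` and `v` have one further neighbour each. These must differ from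
  -- `u` and `v`, which holds because an edge `uv` would make a triangle.
  square-free : K X → Adj X u x → Adj X x v → Adj X v y → Adj X y u → u ≢ v → x ≢ y → ⊥
  square-free {X} {u} {x} {v} {y} kX ux xv vy yu u≢v x≢y
    with Nbr3-third (proj₂ (proj₂ (proj₂ (K-cubic kX u)))) ux (Adj-sym yu) x≢y
       | Nbr3-third (proj₂ (proj₂ (proj₂ (K-cubic kX v)))) (Adj-sym xv) vy x≢y
       | mate _ kX u≢v
  ... | a , N | b , M | Y , kY , ag , X≇Y =
    X≇Y (twins-≅ {X = X} {Y} (regular _ kX) (regular _ kY) u≢v ag
      (≢-sym (Adj⇒≢ (~₃ N))) (λ { refl → ¬uv (~₃ N) })
      (λ { refl → ¬uv (Adj-sym (~₃ M)) }) (≢-sym (Adj⇒≢ (~₃ M))) twin)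
    where
    ¬uv : ¬ Adj X u v
    ¬uv uv = triangle-free kX ux uv xv
    twin : ∀ {z} → z ≢ u → z ≢ v → z ≢ a → z ≢ b → adj X z u ≡ adj X z v
    twin {z} z≢u z≢v z≢a z≢b with z ≟ x | z ≟ y
    ... | yes refl | _        = trans (adj≡true (Adj-sym ux)) (≡-sym (adj≡true xv))
    ... | no _     | yes refl = trans (adj≡true yu) (≡-sym (adj≡true (Adj-sym vy)))
    ... | no z≢x   | no z≢y   = trans (Nbr3⇒false N z≢x z≢y z≢a) (≡-sym (Nbr3⇒false M z≢x z≢y z≢b))

  girth≥5 : K X → Girth≥ 5 X
  girth≥5 kX {[]}                      (() , _)
  girth≥5 kX {_ ∷ []}                  (s≤s () , _)
  girth≥5 kX {_ ∷ _ ∷ []}              (s≤s (s≤s ()) , _)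
  girth≥5 kX {_ ∷ _ ∷ _ ∷ _ ∷ _ ∷ _}   _ = s≤s (s≤s (s≤s (s≤s (s≤s z≤n))))
  girth≥5 kX {_ ∷ _ ∷ _ ∷ []} (_ , _ , _ , _ , uv ∷ vw ∷ stop _ , wu) =
    ⊥-elim (triangle-free kX uv (Adj-sym wu) vw)
  girth≥5 kX {_ ∷ _ ∷ _ ∷ _ ∷ []}
    (_ , ((_ ∷ u≢v ∷ _) ∷ (_ ∷ x≢y ∷ _) ∷ _) , _ , _ , ux ∷ xv ∷ vy ∷ stop _ , yu) =
    ⊥-elim (square-free kX ux xv vy yu u≢v x≢y)

  Nbr3-same : Nbr3 X u a b c → Nbr3 Y u a b c → adj Y z u ≡ adj X z u
  Nbr3-same {X = X} {u} {Y = Y} {z = z} N M with Adj? X u z | Adj? Y u z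
  ... | yes e | yes e′ = trans (adj≡true (Adj-sym e′)) (≡-sym (adj≡true (Adj-sym e)))
  ... | yes e | no ¬e′ = ⊥-elim (¬e′ (neighbour M (complete N e)))
  ... | no ¬e | yes e′ = ⊥-elim (¬e (neighbour N (complete M e′)))
  ... | no ¬e | no ¬e′ = trans (¬Adj⇒false {X = Y} (¬e′ ∘ Adj-sym)) (≡-sym (¬Adj⇒false {X = X} (¬e ∘ Adj-sym)))

  module _ {X u v a b c d} (kX : K X) (Nu : Nbr3 X u v a b) (Nv : Nbr3 X v u c d)
           (a≢c : a ≢ c) (a≢d : a ≢ d) (b≢c : b ≢ c) (b≢d : b ≢ d) where

    Exchanged : Set
    Exchanged = ∃ λ Y → K Y × Agree X Y u v ×
                ((Nbr3 Y u v a c × Nbr3 Y v u b d) ⊎ (Nbr3 Y u v a d × Nbr3 Y v u b c))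

    private
      u≢v : u ≢ v
      u≢v = Adj⇒≢ (~₁ Nu)

      ends : List V
      ends = a ∷ b ∷ c ∷ d ∷ []

      ends≢u : r ∈ ends → r ≢ u
      ends≢u (here refl)                         = ≢-sym (Adj⇒≢ (~₂ Nu))
      ends≢u (there (here refl))                 = ≢-sym (Adj⇒≢ (~₃ Nu))
      ends≢u (there (there (here refl)))         = ≢-sym (≢₁₂ Nv)
      ends≢u (there (there (there (here refl)))) = ≢-sym (≢₁₃ Nv)

      ends≢v : r ∈ ends → r ≢ v
      ends≢v (here refl)                         = ≢-sym (≢₁₂ Nu)
      ends≢v (there (here refl))                 = ≢-sym (≢₁₃ Nu)
      ends≢v (there (there (here refl)))         = ≢-sym (Adj⇒≢ (~₂ Nv))
      ends≢v (there (there (there (here refl)))) = ≢-sym (Adj⇒≢ (~₃ Nv))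

      ends-degree : r ∈ ends → bit (adj X r u) + bit (adj X r v) ≡ 1
      ends-degree {r} r∈ = go r∈
        where
        eq : ∀ {p q} → adj X r u ≡ p → adj X r v ≡ q → bit (adj X r u) + bit (adj X r v) ≡ bit p + bit q
        eq = cong₂ (λ p q → bit p + bit q)
        go : r ∈ ends → bit (adj X r u) + bit (adj X r v) ≡ 1
        go (here refl) = eq (adj≡true (Adj-sym (~₂ Nu))) (Nbr3⇒false Nv (ends≢u r∈) a≢c a≢d)
        go (there (here refl)) = eq (adj≡true (Adj-sym (~₃ Nu))) (Nbr3⇒false Nv (ends≢u r∈) b≢c b≢d)
        go (there (there (here refl))) =
          eq (Nbr3⇒false Nu (ends≢v r∈) (≢-sym a≢c) (≢-sym b≢c)) (adj≡true (Adj-sym (~₂ Nv)))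
        go (there (there (there (here refl)))) =
          eq (Nbr3⇒false Nu (ends≢v r∈) (≢-sym a≢d) (≢-sym b≢d)) (adj≡true (Adj-sym (~₃ Nv)))

      module Partner {Y} (kY : K Y) (ag : Agree X Y u v) (X≇Y : ¬ X ≅ Y) where

        open Balance {X = X} {Y = Y} (regular _ kX) (regular _ kY) u≢v ag
        open SwapEnds Y u v

        Y′ : Graph n
        Y′ = swapEnds Y u v

        kY′ : K Y′
        kY′ = K-resp-≅ Y′ Y swapEnds-≅ kY

        ag′ : Agree X Y′ u v
        ag′ = swapEnds-agree ag

        uv : Adj Y u v
        uv = edge (trans (≡-sym sameEdge) (adj≡true (~₁ Nu)))

        in-ends : r ≢ u → r ≢ v → Adj Y r u → r ∈ ends
        in-ends {r} r≢u r≢v ru with r ∈? ends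
        ... | yes r∈ = r∈
        ... | no r∉ with () ← trans
          (≡-sym (cong₂ (λ p q → bit p + bit q)
            (Nbr3⇒false Nu r≢v (λ { refl → r∉ (here refl) }) (λ { refl → r∉ (there (here refl)) }))
            (Nbr3⇒false Nv r≢u (λ { refl → r∉ (there (there (here refl))) })
                               (λ { refl → r∉ (there (there (there (here refl)))) }))))
          (trans (balance r≢u r≢v) (cong (λ p → bit p + bit (adj Y r v)) (adj≡true ru)))

        other : Nbr3 Y u v p q → r ∈ ends → r ≢ p → r ≢ q → Adj Y v r
        other {r = r} N r∈ r≢p r≢q = Adj-sym (edge (bit-injective (trans
          (cong (λ p → bit p + bit (adj Y r v)) (≡-sym (Nbr3⇒false N (ends≢v r∈) r≢p r≢q)))
          (trans (≡-sym (balance (ends≢u r∈) (ends≢v r∈))) (ends-degree r∈)))))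

        others : Nbr3 Y u v p q → r ∈ ends → s ∈ ends → r ≢ s → r ≢ p → r ≢ q → s ≢ p → s ≢ q → Nbr3 Y v u r s
        others N r∈ s∈ r≢s r≢p r≢q s≢p s≢q = Nbr3-replace (proj₂ (proj₂ (proj₂ (K-cubic kY v))))
          (≢-sym (ends≢u r∈)) (≢-sym (ends≢u s∈)) r≢s (Adj-sym uv) (other N r∈ r≢p r≢q) (other N s∈ s≢p s≢q)

        flipped : Nbr3 Y u v p q → Nbr3 Y v u r s → Nbr3 Y′ u v r s × Nbr3 Y′ v u p q
        flipped {p} {q} {r} {s} N M =
            Nbr3-replace (proj₂ (proj₂ (proj₂ (K-cubic kY′ u)))) (Adj⇒≢ (~₂ M)) (Adj⇒≢ (~₃ M)) (≢₂₃ M)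
              uv′ (atU (~₂ M) (≢-sym (≢₁₂ M))) (atU (~₃ M) (≢-sym (≢₁₃ M)))
          , Nbr3-replace (proj₂ (proj₂ (proj₂ (K-cubic kY′ v)))) (Adj⇒≢ (~₂ N)) (Adj⇒≢ (~₃ N)) (≢₂₃ N)
              (Adj-sym uv′) (atV (~₂ N) (≢-sym (≢₁₂ N))) (atV (~₃ N) (≢-sym (≢₁₃ N)))
          where
          uv′ : Adj Y′ u v
          uv′ = edge (trans swapEnds-edge (adj≡true uv))
          atU : ∀ {z} → Adj Y v z → z ≢ u → Adj Y′ u z
          atU vz z≢u = Adj-sym (edge (trans (swapEnds-u z≢u (≢-sym (Adj⇒≢ vz))) (adj≡true (Adj-sym vz))))
          atV : ∀ {z} → Adj Y u z → z ≢ v → Adj Y′ v z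
          atV uz z≢v = Adj-sym (edge (trans (swapEnds-v (≢-sym (Adj⇒≢ uz)) z≢v) (adj≡true (Adj-sym uz))))

        1∈ : a ∈ ends
        1∈ = here refl
        2∈ : b ∈ ends
        2∈ = there (here refl)
        3∈ : c ∈ ends
        3∈ = there (there (here refl))
        4∈ : d ∈ ends
        4∈ = there (there (there (here refl)))

        -- The split `ab` against `cd` restores `X`, directly here and after interchanging `u` and
        -- `v` in `swappedAll`.
        kept : Nbr3 Y u v a b → ⊥
        kept N = X≇Y (matched-≅ {X = X} {Y} ag sameEdge λ _ _ → Nbr3-same Nu N ,
          Nbr3-same Nv (others N 3∈ 4∈ (≢₂₃ Nv) (≢-sym a≢c) (≢-sym b≢c) (≢-sym a≢d) (≢-sym b≢d)))

        swappedAll : Nbr3 Y u v c d → ⊥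
        swappedAll N = X≇Y (≅-trans {X = X} {Y = Y′} {Z = Y}
          (matched-≅ {X = X} {Y′} ag′ (trans sameEdge (≡-sym swapEnds-edge)) λ _ _ →
            Nbr3-same Nu (proj₁ crossed) , Nbr3-same Nv (proj₂ crossed))
          swapEnds-≅)
          where
          crossed : Nbr3 Y′ u v a b × Nbr3 Y′ v u c d
          crossed = flipped N (others N 1∈ 2∈ (≢₂₃ Nu) a≢c a≢d b≢c b≢d)

        with-ac : Nbr3 Y u v a c → Exchanged
        with-ac N = Y , kY , ag , inj₁ (N , others N 2∈ 4∈ b≢d (≢-sym (≢₂₃ Nu)) b≢c (≢-sym a≢d) (≢-sym (≢₂₃ Nv)))

        with-ad : Nbr3 Y u v a d → Exchanged
        with-ad N = Y , kY , ag , inj₂ (N , others N 2∈ 3∈ b≢c (≢-sym (≢₂₃ Nu)) b≢d (≢-sym a≢c) (≢₂₃ Nv))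

        -- `a` has moved to `v`; the isomorphic copy `Y′` with `u` and `v` interchanged has it at
        -- `u` again.
        with-bd : Nbr3 Y u v b d → Exchanged
        with-bd N = Y′ , kY′ , ag′ , inj₁ (flipped N (others N 1∈ 3∈ a≢c (≢₂₃ Nu) a≢d (≢-sym b≢c) (≢₂₃ Nv)))

        with-bc : Nbr3 Y u v b c → Exchanged
        with-bc N = Y′ , kY′ , ag′ , inj₂ (flipped N (others N 1∈ 4∈ a≢d (≢₂₃ Nu) a≢c (≢-sym b≢d) (≢-sym (≢₂₃ Nv))))

        dispatch : p ∈ ends → q ∈ ends → Nbr3 Y u v p q → Exchanged
        dispatch (here refl) (here refl) N = ⊥-elim (≢₂₃ N refl)
        dispatch (here refl) (there (here refl)) N = ⊥-elim (kept N)
        dispatch (here refl) (there (there (here refl))) N = with-ac N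
        dispatch (here refl) (there (there (there (here refl)))) N = with-ad N
        dispatch (there (here refl)) (here refl) N = ⊥-elim (kept (Nbr3-swap N))
        dispatch (there (here refl)) (there (here refl)) N = ⊥-elim (≢₂₃ N refl)
        dispatch (there (here refl)) (there (there (here refl))) N = with-bc N
        dispatch (there (here refl)) (there (there (there (here refl)))) N = with-bd N
        dispatch (there (there (here refl))) (here refl) N = with-ac (Nbr3-swap N)
        dispatch (there (there (here refl))) (there (here refl)) N = with-bc (Nbr3-swap N)
        dispatch (there (there (here refl))) (there (there (here refl))) N = ⊥-elim (≢₂₃ N refl)
        dispatch (there (there (here refl))) (there (there (there (here refl)))) N = ⊥-elim (swappedAll N)
        dispatch (there (there (there (here refl)))) (here refl) N = with-ad (Nbr3-swap N)
        dispatch (there (there (there (here refl)))) (there (here refl)) N = with-bd (Nbr3-swap N)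
        dispatch (there (there (there (here refl)))) (there (there (here refl))) N = ⊥-elim (swappedAll (Nbr3-swap N))
        dispatch (there (there (there (here refl)))) (there (there (there (here refl)))) N = ⊥-elim (≢₂₃ N refl)

        exchanged : (∃₂ λ p q → Nbr3 Y u v p q) → Exchanged
        exchanged (p , q , N) = dispatch
          (in-ends (≢-sym (Adj⇒≢ (~₂ N))) (≢-sym (≢₁₂ N)) (Adj-sym (~₂ N)))
          (in-ends (≢-sym (Adj⇒≢ (~₃ N))) (≢-sym (≢₁₃ N)) (Adj-sym (~₃ N))) N

    exchange : Exchanged
    exchange = let _ , kY , ag , X≇Y = mate _ kX u≢v
                   open Partner kY ag X≇Y
               in exchanged (Nbr3-extend (K-cubic kY u) uv)

-- Kelly's lemma

module _ {A B C : Set} where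

  dependentPairs : (A → B → C) → (A → List B) → List A → List C
  dependentPairs g f = concatMap (λ x → map (g x) (f x))

  module _ (g : A → B → C) (f : A → List B) where

    length-dependentPairs : ∀ xs → length (dependentPairs g f xs) ≡ sum (map (length ∘ f) xs)
    length-dependentPairs []       = refl
    length-dependentPairs (x ∷ xs) = trans (length-++ (map (g x) (f x)))
      (cong₂ _+_ (length-map (g x) (f x)) (length-dependentPairs xs))

    ∈-dependentPairs⁺ : ∀ {xs x y} → x ∈ xs → y ∈ f x → g x y ∈ dependentPairs g f xs
    ∈-dependentPairs⁺ {x = x} (here refl) y∈ = ∈-++⁺ˡ (∈-map⁺ (g x) y∈)
    ∈-dependentPairs⁺ {x₀ ∷ xs} (there x∈) y∈ = ∈-++⁺ʳ (map (g x₀) (f x₀)) (∈-dependentPairs⁺ x∈ y∈)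

    ∈-dependentPairs⁻ : ∀ xs {z} → z ∈ dependentPairs g f xs → ∃₂ λ x y → x ∈ xs × y ∈ f x × z ≡ g x y
    ∈-dependentPairs⁻ (x ∷ xs) z∈ with ∈-++⁻ (map (g x) (f x)) z∈
    ... | inj₁ z∈ˡ with y , y∈ , eq ← ∈-map⁻ (g x) z∈ˡ = x , y , here refl , y∈ , eq
    ... | inj₂ z∈ʳ with x′ , y , x∈ , y∈ , eq ← ∈-dependentPairs⁻ xs z∈ʳ = x′ , y , there x∈ , y∈ , eq

    dependentPairs-unique : (∀ {x y x′ y′} → g x y ≡ g x′ y′ → x ≡ x′ × y ≡ y′) → (∀ x → Unique (f x)) →
                            ∀ {xs} → Unique xs → Unique (dependentPairs g f xs)
    dependentPairs-unique inj uf {[]}     []      = []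
    dependentPairs-unique inj uf {x ∷ xs} u@(_ ∷ u′) =
      Unique-++⁺ (Unique-map⁺ (proj₂ ∘ inj) (uf x)) (dependentPairs-unique inj uf u′) λ (z∈ˡ , z∈ʳ) →
        let _ , _ , eq = ∈-map⁻ (g x) z∈ˡ
            _ , _ , x∈ , _ , eq′ = ∈-dependentPairs⁻ xs z∈ʳ
        in Unique[x∷xs]⇒x∉xs u (subst (_∈ xs) (≡-sym (proj₁ (inj (trans (≡-sym eq) eq′)))) x∈)

Unique-map-local : ∀ {A B : Set} {f : A → B} {xs} → (∀ {x y} → x ∈ xs → y ∈ xs → f x ≡ f y → x ≡ y) →
                   Unique xs → Unique (map f xs)
Unique-map-local {xs = []}     inj u = []
Unique-map-local {f = f} {x ∷ xs} inj u@(_ ∷ u′) =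
  Unique-∷ (λ fx∈ → let y , y∈ , eq = ∈-map⁻ f fx∈ in
             Unique[x∷xs]⇒x∉xs u (subst (_∈ xs) (≡-sym (inj (here refl) (there y∈) eq)) y∈))
           (Unique-map-local (λ x∈ y∈ → inj (there x∈) (there y∈)) u′)

sum-map-const : ∀ {A : Set} (f : A → ℕ) c → ∀ xs → (∀ {x} → x ∈ xs → f x ≡ c) → sum (map f xs) ≡ length xs * c
sum-map-const f c []       eq = refl
sum-map-const f c (x ∷ xs) eq = cong₂ _+_ (eq (here refl)) (sum-map-const f c xs (eq ∘ there))

-- Sets that contain a given set and miss exactly `j` vertices.

supersets : ∀ {n} → Subset n → ℕ → List (Subset n)
supersets []            zero    = [] ∷ []
supersets []            (suc j) = []
supersets (inside ∷ p)  j       = map (inside ∷_) (supersets p j)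
supersets (outside ∷ p) zero    = map (inside ∷_) (supersets p zero)
supersets (outside ∷ p) (suc j) = map (inside ∷_) (supersets p (suc j)) ++ map (outside ∷_) (supersets p j)

-- The binomial coefficient `q` over `j`, by Pascal's rule.
choices : ℕ → ℕ → ℕ
choices zero    zero    = 1
choices zero    (suc j) = 0
choices (suc q) zero    = choices q zero
choices (suc q) (suc j) = choices q (suc j) + choices q j

length-supersets : ∀ {n} (p : Subset n) j → length (supersets p j) ≡ choices ∣ ∁ p ∣ j
length-supersets []            zero    = refl
length-supersets []            (suc j) = refl
length-supersets (inside ∷ p)  j       = trans (length-map _ (supersets p j)) (length-supersets p j)
length-supersets (outside ∷ p) zero    = trans (length-map _ (supersets p zero)) (length-supersets p zero)
length-supersets (outside ∷ p) (suc j) = trans (length-++ (map (inside ∷_) (supersets p (suc j))))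
  (cong₂ _+_ (trans (length-map _ (supersets p (suc j))) (length-supersets p (suc j)))
             (trans (length-map _ (supersets p j)) (length-supersets p j)))

choices-positive : ∀ {q j} → j ≤ q → 0 < choices q j
choices-positive {zero}  z≤n = s≤s z≤n
choices-positive {suc q} {zero}  _ = choices-positive {q} z≤n
choices-positive {suc q} {suc j} (s≤s j≤q) = ≤-trans (choices-positive j≤q) (m≤n+m _ (choices q (suc j)))

supersets-unique : ∀ {n} (p : Subset n) j → Unique (supersets p j)
supersets-unique []            zero    = [] ∷ []
supersets-unique []            (suc j) = []
supersets-unique (inside ∷ p)  j       = Unique-map⁺ Vec.∷-injectiveʳ (supersets-unique p j)
supersets-unique (outside ∷ p) zero    = Unique-map⁺ Vec.∷-injectiveʳ (supersets-unique p zero)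
supersets-unique (outside ∷ p) (suc j) = Unique-++⁺
  (Unique-map⁺ Vec.∷-injectiveʳ (supersets-unique p (suc j))) (Unique-map⁺ Vec.∷-injectiveʳ (supersets-unique p j))
  λ (x∈ , y∈) → case (∈-map⁻ (inside ∷_) x∈) (∈-map⁻ (outside ∷_) y∈)
  where
  case : ∀ {v : Subset _} → ∃ (λ x → x ∈ supersets p (suc j) × v ≡ inside ∷ x) →
         ∃ (λ x → x ∈ supersets p j × v ≡ outside ∷ x) → ⊥
  case (_ , _ , refl) (_ , _ , ())

∈-supersets⁻ : ∀ {n} (p : Subset n) j {q} → q ∈ supersets p j → (∀ {x} → x ∈ₛ p → x ∈ₛ q) × j + ∣ q ∣ ≡ n
∈-supersets⁻ []            zero    (here refl) = (λ ()) , refl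
∈-supersets⁻ (inside ∷ p)  j       q∈ with ∈-map⁻ (inside ∷_) q∈
... | q , q∈′ , refl with ∈-supersets⁻ p j q∈′
...   | sub , eq = (λ { here → here ; (there x∈) → there (sub x∈) }) , trans (+-suc j ∣ q ∣) (cong suc eq)
∈-supersets⁻ (outside ∷ p) zero    q∈ with ∈-map⁻ (inside ∷_) q∈
... | q , q∈′ , refl with ∈-supersets⁻ p zero q∈′
...   | sub , eq = (λ { (there x∈) → there (sub x∈) }) , cong suc eq
∈-supersets⁻ (outside ∷ p) (suc j) q∈ with ∈-++⁻ (map (inside ∷_) (supersets p (suc j))) q∈
... | inj₁ q∈ˡ with ∈-map⁻ (inside ∷_) q∈ˡ
...   | q , q∈′ , refl with ∈-supersets⁻ p (suc j) q∈′
...     | sub , eq = (λ { (there x∈) → there (sub x∈) }) , trans (+-suc (suc j) ∣ q ∣) (cong suc eq)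
∈-supersets⁻ (outside ∷ p) (suc j) q∈ | inj₂ q∈ʳ with ∈-map⁻ (outside ∷_) q∈ʳ
...   | q , q∈′ , refl with ∈-supersets⁻ p j q∈′
...     | sub , eq = (λ { (there x∈) → there (sub x∈) }) , cong suc eq

∈-supersets⁺ : ∀ {n} (p : Subset n) j {q} → (∀ {x} → x ∈ₛ p → x ∈ₛ q) → j + ∣ q ∣ ≡ n → q ∈ supersets p j
∈-supersets⁺ []            zero    {[]}          sub eq = here refl
∈-supersets⁺ []            (suc j) {[]}          sub ()
∈-supersets⁺ (inside ∷ p)  j       {outside ∷ q} sub eq with () ← sub here
∈-supersets⁺ (inside ∷ p)  j       {inside ∷ q}  sub eq =
  ∈-map⁺ (inside ∷_) (∈-supersets⁺ p j (drop-there ∘ sub ∘ there) (suc-injective (trans (≡-sym (+-suc j ∣ q ∣)) eq)))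
∈-supersets⁺ (outside ∷ p) zero    {inside ∷ q}  sub eq =
  ∈-map⁺ (inside ∷_) (∈-supersets⁺ p zero (drop-there ∘ sub ∘ there) (suc-injective eq))
∈-supersets⁺ {suc n} (outside ∷ p) zero {outside ∷ q} sub eq = ⊥-elim (<-irrefl eq (s≤s (∣p∣≤n q)))
∈-supersets⁺ (outside ∷ p) (suc j) {inside ∷ q}  sub eq =
  ∈-++⁺ˡ (∈-map⁺ (inside ∷_) (∈-supersets⁺ p (suc j) (drop-there ∘ sub ∘ there)
    (suc-injective (trans (≡-sym (+-suc (suc j) ∣ q ∣)) eq))))
∈-supersets⁺ (outside ∷ p) (suc j) {outside ∷ q} sub eq =
  ∈-++⁺ʳ (map (inside ∷_) (supersets p (suc j))) (∈-map⁺ (outside ∷_)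
    (∈-supersets⁺ p j (drop-there ∘ sub ∘ there) (suc-injective eq)))

-- A property of tuples of k distinct vertices that only depends on the graph
-- induced on the tuple.
record Local {n : ℕ} (k : ℕ) (Q : Graph n → List (Fin n) → Set) : Set where
  field
    distinct : ∀ {X l} → Q X l → Unique l
    size     : ∀ {X l} → Q X l → length l ≡ k
    move     : ∀ {X Y l} (F : Fin n ↔ Fin n) →
               (∀ {x y} → x ∈ l → y ∈ l → adj Y (to F x) (to F y) ≡ adj X x y) →
               Q X l → Q Y (map (to F) l)

open Local

-- Kelly's lemma, obtained by counting pairs of a card and a tuple on that card.
module Kelly {n : ℕ} {G H : Graph n} (2≤n : 2 ≤ n) (deck : SameDeck (n ∸ 2) G H)
             {k : ℕ} {Q : Graph n → List (Fin n) → Set} (loc : Local k Q) (k+2≤n : k + 2 ≤ n) where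

  private
    V = Fin n
    φ = proj₁ deck

    cardAt : ∀ S → CardMap G H (proj₁ S) (proj₁ (to φ S))
    cardAt = cardMap {G = G} {H = H} 2≤n deck

    Object = Subset n × List V

    objects : List (List V) → List Object
    objects = dependentPairs (λ l S → S , l) (λ l → supersets (fromList l) 2)

    complementary : ∀ {k} → 2 + k ≡ n → k ≡ n ∸ 2
    complementary refl = refl

    -- The number of cards that contain a given set of `k` vertices: the two deleted ones are chosen
    -- among the others.
    cards : ℕ
    cards = choices (n ∸ k) 2

    length-objects : ∀ X cs → (∀ {l} → l ∈ cs → Q X l) → length (objects cs) ≡ length cs * cards
    length-objects X cs sound = trans (length-dependentPairs _ _ cs)
      (sum-map-const _ cards cs λ {l} l∈ → trans (length-supersets (fromList l) 2)
        (cong (λ m → choices m 2) (trans (∣∁p∣≡n∸∣p∣ (fromList l))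
          (cong (n ∸_) (trans (∣fromList∣ (distinct loc (sound l∈))) (size loc (sound l∈)))))))

    moveBy : (S : Subset n) → Dec (2 + ∣ S ∣ ≡ n) → List V → Object
    -- A default that makes the map total; in `objects` every set has the size of a card.
    moveBy S (no _)   l = S , l
    moveBy S (yes eq) l = proj₁ (to φ S′) , map (to (CardMap.F (cardAt S′))) l
      where
      S′ : KSubset n (n ∸ 2)
      S′ = S , complementary eq

    moved : Object → Object
    moved (S , l) = moveBy S (2 + ∣ S ∣ ≟ℕ n) l

    KSubset-≡ : ∀ {S T : KSubset n (n ∸ 2)} → proj₁ S ≡ proj₁ T → S ≡ T
    KSubset-≡ {_ , p} {_ , q} refl = cong (_ ,_) (≡-irrelevant p q)

    moveBy-injective : ∀ {S T l m} (d : Dec (2 + ∣ S ∣ ≡ n)) (e : Dec (2 + ∣ T ∣ ≡ n)) →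
                       2 + ∣ S ∣ ≡ n → 2 + ∣ T ∣ ≡ n → moveBy S d l ≡ moveBy T e m → (S , l) ≡ (T , m)
    moveBy-injective (no ¬p)  _        p q eq = ⊥-elim (¬p p)
    moveBy-injective (yes _)  (no ¬q)  p q eq = ⊥-elim (¬q q)
    moveBy-injective {S} {T} {l} {m} (yes p′) (yes q′) p q eq = same (to-inj φ (KSubset-≡ (cong proj₁ eq))) (cong proj₂ eq)
      where
      to-inj : ∀ {A B : Set} (F : A ↔ B) {x y} → to F x ≡ to F y → x ≡ y
      to-inj F eq = trans (≡-sym (Inverse.strictlyInverseʳ F _)) (trans (cong (from F) eq) (Inverse.strictlyInverseʳ F _))
      same : ∀ {S T : KSubset n (n ∸ 2)} → S ≡ T →
             map (to (CardMap.F (cardAt S))) l ≡ map (to (CardMap.F (cardAt T))) m →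
             (proj₁ S , l) ≡ (proj₁ T , m)
      same {S} refl eq = cong (_ ,_) (map-injective (to-injective (CardMap.F (cardAt S))) eq)

  module _ (cs ds : List (List V)) (unique : Unique cs) (sound : ∀ {l} → l ∈ cs → Q G l)
           (sound′ : ∀ {l} → l ∈ ds → Q H l) (complete′ : ∀ {l} → Q H l → l ∈ ds) where

    private
      object∈ : ∀ {S l} → (S , l) ∈ objects cs → Q G l × (∀ {x} → x ∈ l → x ∈ₛ S) × 2 + ∣ S ∣ ≡ n
      object∈ o∈ with ∈-dependentPairs⁻ _ _ cs o∈
      ... | l , S , l∈ , S∈ , refl with ∈-supersets⁻ (fromList l) 2 S∈
      ...   | sub , eq = sound l∈ , sub ∘ ∈-fromList⁺ , eq

      moveBy∈ : ∀ {S l} (d : Dec (2 + ∣ S ∣ ≡ n)) → Q G l → (∀ {x} → x ∈ l → x ∈ₛ S) → 2 + ∣ S ∣ ≡ n →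
                moveBy S d l ∈ objects ds
      moveBy∈ (no ¬p) q sub p = ⊥-elim (¬p p)
      moveBy∈ {S} {l} (yes p) q sub _ =
        ∈-dependentPairs⁺ _ _ (complete′ (move loc {X = G} {Y = H} F (λ x∈ y∈ → CardMap.preserves C (sub x∈) (sub y∈)) q))
          (∈-supersets⁺ (fromList (map (to F) l)) 2 into (size′ (proj₂ (to φ S′))))
        where
        S′ : KSubset n (n ∸ 2)
        S′ = S , complementary p
        C = cardAt S′
        F = CardMap.F C
        size′ : ∀ {m} → m ≡ n ∸ 2 → 2 + m ≡ n
        size′ refl = m+[n∸m]≡n 2≤n
        into : ∀ {x} → x ∈ₛ fromList (map (to F) l) → x ∈ₛ proj₁ (to φ S′)
        into x∈ with ∈-map⁻ (to F) (∈-fromList⁻ (map (to F) l) x∈)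
        ... | y , y∈ , refl = CardMap.into C (sub y∈)

      moved∈ : map moved (objects cs) ⊆ objects ds
      moved∈ o∈ with ∈-map⁻ moved o∈
      ... | (S , l) , o∈′ , refl with object∈ o∈′
      ...   | q , sub , eq = moveBy∈ (2 + ∣ S ∣ ≟ℕ n) q sub eq

      moved-unique : Unique (map moved (objects cs))
      moved-unique = Unique-map-local
        (λ {(S , l)} {(T , m)} s∈ t∈ → moveBy-injective (2 + ∣ S ∣ ≟ℕ n) (2 + ∣ T ∣ ≟ℕ n)
          (proj₂ (proj₂ (object∈ s∈))) (proj₂ (proj₂ (object∈ t∈))))
        (dependentPairs-unique _ _ (λ { refl → refl , refl }) (λ l → supersets-unique (fromList l) 2) unique)

    -- Carrying each pair along the bijection of its card is injective, which gives one inequality;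
    -- the reverse one comes from the reversed deck. By `k + 2 ≤ n` the common factor is positive
    -- and can be cancelled.
    kelly : length cs ≤ length ds
    kelly = *-cancelʳ-≤ (length cs) (length ds) cards {{>-nonZero (choices-positive 2≤)}} (begin
      length cs * cards                   ≡⟨ length-objects G cs sound ⟨
      length (objects cs)                 ≡⟨ length-map moved (objects cs) ⟨
      length (map moved (objects cs))     ≤⟨ Unique-⊆⇒length≤ moved-unique moved∈ ⟩
      length (objects ds)                 ≡⟨ length-objects H ds sound′ ⟩
      length ds * cards                   ∎)
      where
      open ≤-Reasoning
      2≤ : 2 ≤ n ∸ k
      2≤ = m+n≤o⇒n≤o∸m k+2≤n
        where
        m+n≤o⇒n≤o∸m : k + 2 ≤ n → 2 ≤ n ∸ k
        m+n≤o⇒n≤o∸m le = ≤-trans (≤-reflexive (≡-sym (m+n∸m≡n k 2))) (∸-monoˡ-≤ k le)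

-- Counting cycles, deciding isomorphism

module _ {n : ℕ} where

  private
    V = Fin n
    variable
      X Y : Graph n
      a b u v x : V
      l : List V

  length-distinct : Unique l → length l ≤ n
  length-distinct u = ≤-trans (Unique-⊆⇒length≤ u (λ {v} _ → ∈-allFin v)) (≤-reflexive (length-tabulate id))

  tuples : ℕ → List (List V)
  tuples zero    = [] ∷ []
  tuples (suc k) = dependentPairs _∷_ (λ _ → tuples k) (allFin n)

  tuples-unique : ∀ k → Unique (tuples k)
  tuples-unique zero    = [] ∷ []
  tuples-unique (suc k) = dependentPairs-unique _∷_ (λ _ → tuples k)
    (λ eq → ∷-injectiveˡ eq , ∷-injectiveʳ eq) (λ _ → tuples-unique k) (allFin⁺ n)

  ∈-tuples : ∀ l → l ∈ tuples (length l)
  ∈-tuples []      = here refl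
  ∈-tuples (x ∷ l) = ∈-dependentPairs⁺ _∷_ (λ _ → tuples (length l)) (∈-allFin x) (∈-tuples l)

  ∈-tuples-length : ∀ k {l} → l ∈ tuples k → length l ≡ k
  ∈-tuples-length zero    (here refl) = refl
  ∈-tuples-length (suc k) l∈ with ∈-dependentPairs⁻ _∷_ (λ _ → tuples k) (allFin n) l∈
  ... | x , l , _ , l∈′ , refl = cong suc (∈-tuples-length k l∈′)

  Path-map : (F : V ↔ V) → (∀ {x y} → x ∈ l → y ∈ l → adj Y (to F x) (to F y) ≡ adj X x y) →
             Path X a b l → Path Y (to F a) (to F b) (map (to F) l)
  Path-map F f (stop a) = stop (to F a)
  Path-map F f (e ∷ p)  = edge (trans (f (here refl) (there (Path-start∈ p))) (adj≡true e)) ∷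
                          Path-map F (λ x∈ y∈ → f (there x∈) (there y∈)) p

  CycleOn : ℕ → Graph n → List V → Set
  CycleOn k X l = Cyc X l × length l ≡ k

  cycle-local : ∀ k → Local k (CycleOn k)
  cycle-local k = record
    { distinct = λ ((_ , u , _) , _) → u
    ; size     = proj₂
    ; move     = λ {X} {Y} {l} F f ((3≤ , u , a , b , p , e) , len) →
        ( ≤-trans 3≤ (≤-reflexive (≡-sym (length-map (to F) l)))
        , Unique-map⁺ (to-injective F) u , to F a , to F b , Path-map F f p
        , edge (trans (f (Path-end∈ p) (Path-start∈ p)) (adj≡true e)))
        , trans (length-map (to F) l) len }

  cycles : ℕ → Graph n → List (List V)
  cycles k X = filter (Cyc? X) (tuples k)

  cycles-unique : ∀ k X → Unique (cycles k X)
  cycles-unique k X = filter⁺ (Cyc? X) (tuples-unique k)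

  ∈-cycles⁺ : ∀ {k} X → CycleOn k X l → l ∈ cycles k X
  ∈-cycles⁺ {l} X (c , refl) = ∈-filter⁺ (Cyc? X) (∈-tuples l) c

  ∈-cycles⁻ : ∀ {k} X → l ∈ cycles k X → CycleOn k X l
  ∈-cycles⁻ {k = k} X l∈ with ∈-filter⁻ (Cyc? X) {xs = tuples k} l∈
  ... | l∈′ , c = c , ∈-tuples-length k l∈′

  cycles-≅ : ∀ k → X ≅ Y → length (cycles k X) ≤ length (cycles k Y)
  cycles-≅ {X} {Y} k (F , iso) = ≤-trans (≤-reflexive (≡-sym (length-map (map (to F)) (cycles k X))))
    (Unique-⊆⇒length≤ (Unique-map⁺ (map-injective (to-injective F)) (cycles-unique k X)) sub)
    where
    sub : map (map (to F)) (cycles k X) ⊆ cycles k Y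
    sub l∈ with ∈-map⁻ (map (to F)) l∈
    ... | l , l∈′ , refl = ∈-cycles⁺ Y (move (cycle-local k) {X = X} {Y = Y} F (λ {x} {y} _ _ → iso x y) (∈-cycles⁻ {k = k} X l∈′))

  cycles-deck : ∀ k {G H : Graph n} → 2 ≤ n → k + 2 ≤ n → SameDeck (n ∸ 2) G H →
                length (cycles k G) ≤ length (cycles k H)
  cycles-deck k {G} {H} 2≤n k+2≤n deck = Kelly.kelly {G = G} {H} 2≤n deck (cycle-local k) k+2≤n
    (cycles k G) (cycles k H) (cycles-unique k G) (∈-cycles⁻ {k = k} G) (∈-cycles⁻ {k = k} H) (∈-cycles⁺ {k = k} H)

  -- A cycle of `X` missing in `Y` would make the cycles of `Y` a proper part of those of `X`, hence
  -- fewer.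
  cycles-same : ∀ k → length (cycles k X) ≤ length (cycles k Y) →
                (∀ {l} → length l ≡ k → Cyc Y l → Cyc X l) → ∀ {l} → length l ≡ k → Cyc X l → Cyc Y l
  cycles-same {X} {Y} k le sub {l} len c with Cyc? Y l
  ... | yes c′ = c′
  ... | no ¬c′ = contradiction (≤-trans (Unique-⊆⇒length≤ {ys = cycles k X}
          (Unique-∷ (λ l∈ → ¬c′ (proj₁ (∈-cycles⁻ {k = k} Y l∈))) (cycles-unique k Y)) into) le) (<-irrefl refl)
    where
    into : (l ∷ cycles k Y) ⊆ cycles k X
    into (here refl) = ∈-cycles⁺ X (c , len)
    into (there m∈) with ∈-cycles⁻ {k = k} Y m∈
    ... | c′ , len′ = ∈-cycles⁺ X (sub len′ c′ , len′)

  -- A path can always be prolonged at its start: a neighbour there that already lies on the path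
  -- would close a cycle, which has at most `n` vertices. So the path would outgrow the graph.
  cubic⇒cycle : (∀ v → ∃ λ a → ∃₂ λ b c → Nbr3 X v a b c) → V → ¬ Girth≥ (suc n) X
  cubic⇒cycle {X} cubic v₀ girth = <-irrefl refl (tooLong (grow n))
    where
    Long : ℕ → Set
    Long k = ∃₂ λ a b → ∃ λ l → Path X a b (a ∷ l) × Unique (a ∷ l) × length l ≡ k
    tooLong : Long n → suc n ≤ n
    tooLong (_ , _ , _ , _ , u , len) = subst (λ m → suc m ≤ n) len (length-distinct u)
    small : ∀ {l} → ¬ Cyc X l
    small c = <-irrefl refl (≤-trans (girth c) (length-distinct (proj₁ (proj₂ c))))
    extend : ∀ {a b l k z} → Path X a b (a ∷ l) → Unique (a ∷ l) → length l ≡ k → Adj X a z → z ∉ a ∷ l → Long (suc k)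
    extend p u len az z∉ = _ , _ , _ , Adj-sym az ∷ p , Unique-∷ z∉ u , cong suc len
    grow : ∀ k → Long k
    grow zero    = v₀ , v₀ , [] , stop v₀ , [] ∷ [] , refl
    grow (suc k) with grow k
    ... | a , _ , [] , p , u , len = extend p u len (~₁ N) λ { (here eq) → Adj⇒≢ (~₁ N) (≡-sym eq) }
      where N = proj₂ (proj₂ (proj₂ (cubic a)))
    ... | a , b , (c ∷ l) , p@(ac ∷ q) , u@(_ ∷ u′) , len with refl ← Path-head q with Nbr3-extend (cubic a) ac
    ...   | z , _ , N with z ∈? (a ∷ c ∷ l)
    ...     | no z∉ = extend p u len (~₂ N) z∉
    ...     | yes (here eq)         = ⊥-elim (Adj⇒≢ (~₂ N) (≡-sym eq))
    ...     | yes (there (here eq)) = ⊥-elim (≢₁₂ N (≡-sym eq))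
    ...     | yes (there (there z∈)) with ∈-∃++ z∈
    ...       | pre , post , refl with Path-split pre q
    ...         | _ , r , dz , _ = ⊥-elim (small (Cyc-intro (Path-++ r dz (stop z)) (~₁ N) (Adj-sym (~₂ N)) (≢₁₂ N)
                    (Unique[x∷xs]⇒x∉xs u ∘ sub)
                    (Unique-++⁻ˡ ((c ∷ pre) ++ z ∷ []) (subst Unique (≡-sym (++-assoc (c ∷ pre) (z ∷ []) post)) u′))))
      where
      sub : ∀ {x} → x ∈ (c ∷ pre) ++ z ∷ [] → x ∈ (c ∷ pre) ++ z ∷ post
      sub {x} x∈ = subst (x ∈_) (++-assoc (c ∷ pre) (z ∷ []) post) (∈-++⁺ˡ x∈)

  anyVec? : ∀ k {P : Vec V k → Set} → (∀ xs → Dec (P xs)) → Dec (∃ P)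
  anyVec? zero    P? = map′ ([] ,_) (λ { ([] , p) → p }) (P? [])
  anyVec? (suc k) P? = map′ (λ { (x , xs , p) → x ∷ xs , p }) (λ { (x ∷ xs , p) → x , xs , p })
    (any? λ x → anyVec? k λ xs → P? (x ∷ xs))

  -- Turns the refutation of non-isomorphism into an isomorphism. Tabulating a bijection and its
  -- inverse as vectors makes the search finite.
  ≅? : ∀ (G H : Graph n) → Dec (G ≅ H)
  ≅? G H = map′ build tabulated
    (anyVec? n λ fs → anyVec? n λ gs →
      all? (λ i → lookup fs (lookup gs i) ≟ i) ×-dec all? (λ i → lookup gs (lookup fs i) ≟ i) ×-dec
      all? (λ u → all? λ v → adj H (lookup fs u) (lookup fs v) Bool.≟ adj G u v))
    where
    Table : Set
    Table = ∃₂ λ (fs gs : Vec V n) → (∀ i → lookup fs (lookup gs i) ≡ i) × (∀ i → lookup gs (lookup fs i) ≡ i) ×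
            (∀ u v → adj H (lookup fs u) (lookup fs v) ≡ adj G u v)
    build : Table → G ≅ H
    build (fs , gs , inv , inv′ , iso) = mk↔ₛ′ (lookup fs) (lookup gs) inv inv′ , iso
    tabulated : G ≅ H → Table
    tabulated (F , iso) = tabulate (to F) , tabulate (from F)
      , (λ i → trans (lookup∘tabulate (to F) _) (trans (cong (to F) (lookup∘tabulate (from F) i)) (to∘from F i)))
      , (λ i → trans (lookup∘tabulate (from F) _) (trans (cong (from F) (lookup∘tabulate (to F) i)) (from∘to F i)))
      , (λ u v → trans (cong₂ (adj H) (lookup∘tabulate (to F) u) (lookup∘tabulate (to F) v)) (iso u v))

-- Regularity of the second graph

length-cartesianProduct : ∀ {A B : Set} (xs : List A) (ys : List B) →
                          length (cartesianProduct xs ys) ≡ length xs * length ys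
length-cartesianProduct []       ys = refl
length-cartesianProduct (x ∷ xs) ys = trans (length-++ (map (x ,_) ys))
  (cong₂ _+_ (length-map (x ,_) ys) (length-cartesianProduct xs ys))

length-filter-¬ : ∀ {A : Set} {P : A → Set} (P? : ∀ x → Dec (P x)) xs →
                  length (filter (λ x → ¬? (P? x)) xs) + length (filter P? xs) ≡ length xs
length-filter-¬ P? []       = refl
length-filter-¬ P? (x ∷ xs) with P? x
... | yes _ = trans (+-suc _ _) (cong suc (length-filter-¬ P? xs))
... | no _  = cong suc (length-filter-¬ P? xs)

sum-map-* : ∀ {A : Set} c (f : A → ℕ) xs → sum (map (λ x → c * f x) xs) ≡ c * sum (map f xs)
sum-map-* c f []       = ≡-sym (*-comm c 0)
sum-map-* c f (x ∷ xs) = trans (cong (c * f x +_) (sum-map-* c f xs)) (≡-sym (*-distribˡ-+ c (f x) _))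

sum-map-mono : ∀ {A : Set} (f g : A → ℕ) xs → (∀ x → f x ≤ g x) → sum (map f xs) ≤ sum (map g xs)
sum-map-mono f g []       le = z≤n
sum-map-mono f g (x ∷ xs) le = +-mono-≤ (le x) (sum-map-mono f g xs le)

sum-map-tight : ∀ {A : Set} (f g : A → ℕ) xs → (∀ x → f x ≤ g x) → sum (map g xs) ≤ sum (map f xs) →
                ∀ {x} → x ∈ xs → g x ≤ f x
sum-map-tight f g (x ∷ xs) le total (here refl) =
  +-cancelʳ-≤ (sum (map g xs)) _ _ (≤-trans total (+-monoʳ-≤ (f x) (sum-map-mono f g xs le)))
sum-map-tight f g (x ∷ xs) le total (there x∈) =
  sum-map-tight f g xs le (+-cancelˡ-≤ (f x) _ _ (≤-trans (+-monoˡ-≤ _ (le x)) total)) x∈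

-- 6d ≤ d² + 9 is (d - 3)² ≥ 0.
square-gap : ∀ d → 6 * d ≤ d * d + 9
square-gap 0 = z≤n
square-gap 1 = m≤m+n 6 4
square-gap 2 = m≤m+n 12 1
square-gap 3 = ≤-refl
square-gap (suc (suc (suc (suc m)))) = ≤-trans (m≤m+n _ (1 + (m * m + 2 * m))) (≤-reflexive (expand m))
  where
  expand : ∀ m → 6 * (4 + m) + (1 + (m * m + 2 * m)) ≡ (4 + m) * (4 + m) + 9
  expand = solve-∀

square-tight : ∀ d → d * d + 9 ≤ 6 * d → d ≡ 3
square-tight 0 ()
square-tight 1 le = contradiction le (<⇒≱ (m≤m+n 7 3))
square-tight 2 le = contradiction le (<⇒≱ (m≤m+n 13 0))
square-tight 3 _  = refl
square-tight (suc (suc (suc (suc m)))) le = contradiction le (<⇒≱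
  (≤-trans (m≤m+n _ (m * m + 2 * m)) (≤-reflexive (expand m))))
  where
  expand : ∀ m → suc (6 * (4 + m)) + (m * m + 2 * m) ≡ (4 + m) * (4 + m) + 9
  expand = solve-∀

module _ {n : ℕ} where

  private
    V = Fin n
    variable
      X Y : Graph n
      u v x : V
      l : List V

  distinctPairs : List V → List (V × V)
  distinctPairs l = filter (λ p → ¬? (proj₁ p ≟ proj₂ p)) (cartesianProduct l l)

  length-distinctPairs : Unique l → length (distinctPairs l) + length l ≡ length l * length l
  length-distinctPairs {l} u = trans (cong (length (distinctPairs l) +_) (≡-sym diagonal))
    (trans (length-filter-¬ (λ (p : V × V) → proj₁ p ≟ proj₂ p) (cartesianProduct l l)) (length-cartesianProduct l l))
    where
    D : List (V × V)
    D = filter (λ (p : V × V) → proj₁ p ≟ proj₂ p) (cartesianProduct l l)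
    into : D ⊆ map (λ x → x , x) l
    into p∈ with ∈-filter⁻ (λ (p : V × V) → proj₁ p ≟ proj₂ p) {xs = cartesianProduct l l} p∈
    ... | p∈′ , refl = ∈-map⁺ (λ x → x , x) (proj₁ (∈-cartesianProduct⁻ l l p∈′))
    onto : map (λ x → x , x) l ⊆ D
    onto p∈ with ∈-map⁻ (λ x → x , x) p∈
    ... | x , x∈ , refl = ∈-filter⁺ (λ (p : V × V) → proj₁ p ≟ proj₂ p) (∈-cartesianProduct⁺ x∈ x∈) refl
    diagonal : length D ≡ length l
    diagonal = trans (≤-antisym
      (Unique-⊆⇒length≤ (filter⁺ _ (cartesianProduct⁺ u u)) into)
      (Unique-⊆⇒length≤ (Unique-map⁺ (cong proj₁) u) onto)) (length-map (λ x → x , x) l)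

  IsEdge : Graph n → List V → Set
  IsEdge X l = ∃₂ λ y x → l ≡ y ∷ x ∷ [] × Adj X y x

  -- The ends are ordered and may be adjacent, so a vertex of degree `d` is the centre of exactly
  -- `d² - d` cherries.
  IsCherry : Graph n → List V → Set
  IsCherry X l = ∃ λ y → ∃₂ λ x z → l ≡ y ∷ x ∷ z ∷ [] × Adj X y x × Adj X y z × x ≢ z

  edge-local : Local 2 IsEdge
  edge-local = record
    { distinct = λ { (_ , _ , refl , e) → (Adj⇒≢ e ∷ []) ∷ [] ∷ [] }
    ; size     = λ { (_ , _ , refl , _) → refl }
    ; move     = λ { F f (y , x , refl , e) → to F y , to F x , refl ,
                     edge (trans (f (here refl) (there (here refl))) (adj≡true e)) } }

  cherry-local : Local 3 IsCherry
  cherry-local = record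
    { distinct = λ { (_ , _ , _ , refl , e , e′ , x≢z) → (Adj⇒≢ e ∷ Adj⇒≢ e′ ∷ []) ∷ (x≢z ∷ []) ∷ [] ∷ [] }
    ; size     = λ { (_ , _ , _ , refl , _) → refl }
    ; move     = λ { F f (y , x , z , refl , e , e′ , x≢z) → to F y , to F x , to F z , refl ,
                     edge (trans (f (here refl) (there (here refl))) (adj≡true e)) ,
                     edge (trans (f (here refl) (there (there (here refl)))) (adj≡true e′)) ,
                     x≢z ∘ to-injective F } }

  edges : Graph n → List (List V)
  edges X = dependentPairs (λ y x → y ∷ x ∷ []) (neighbours X) (allFin n)

  cherries : Graph n → List (List V)
  cherries X = dependentPairs (λ y p → y ∷ proj₁ p ∷ proj₂ p ∷ []) (distinctPairs ∘ neighbours X) (allFin n)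

  edges-unique : ∀ X → Unique (edges X)
  edges-unique X = dependentPairs-unique _ _ (λ { refl → refl , refl }) (neighbours-unique X) (allFin⁺ n)

  ∈-edges⁻ : ∀ X → l ∈ edges X → IsEdge X l
  ∈-edges⁻ X l∈ with ∈-dependentPairs⁻ _ _ (allFin n) l∈
  ... | y , x , _ , x∈ , refl = y , x , refl , ∈-neighbours⁻ X x∈

  ∈-edges⁺ : ∀ X → IsEdge X l → l ∈ edges X
  ∈-edges⁺ X (y , x , refl , e) = ∈-dependentPairs⁺ (λ y x → y ∷ x ∷ []) (neighbours X) (∈-allFin y) (∈-neighbours⁺ X e)

  cherries-unique : ∀ X → Unique (cherries X)
  cherries-unique X = dependentPairs-unique _ _ (λ { refl → refl , refl })
    (λ y → filter⁺ _ (cartesianProduct⁺ (neighbours-unique X y) (neighbours-unique X y))) (allFin⁺ n)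

  ∈-cherries⁻ : ∀ X → l ∈ cherries X → IsCherry X l
  ∈-cherries⁻ X l∈ with ∈-dependentPairs⁻ _ _ (allFin n) l∈
  ... | y , (x , z) , _ , p∈ , refl
    with ∈-filter⁻ (λ p → ¬? (proj₁ p ≟ proj₂ p)) {xs = cartesianProduct (neighbours X y) (neighbours X y)} p∈
  ...   | p∈′ , x≢z with ∈-cartesianProduct⁻ (neighbours X y) (neighbours X y) p∈′
  ...     | x∈ , z∈ = y , x , z , refl , ∈-neighbours⁻ X x∈ , ∈-neighbours⁻ X z∈ , x≢z

  ∈-cherries⁺ : ∀ X → IsCherry X l → l ∈ cherries X
  ∈-cherries⁺ X (y , x , z , refl , e , e′ , x≢z) =
    ∈-dependentPairs⁺ (λ y p → y ∷ proj₁ p ∷ proj₂ p ∷ []) (distinctPairs ∘ neighbours X) (∈-allFin y)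
      (∈-filter⁺ (λ p → ¬? (proj₁ p ≟ proj₂ p))
        (∈-cartesianProduct⁺ (∈-neighbours⁺ X e) (∈-neighbours⁺ X e′)) x≢z)

  degreeSum : Graph n → ℕ
  degreeSum X = ∑ (degree X)

  cherrySum : Graph n → ℕ
  cherrySum X = ∑ (λ v → length (distinctPairs (neighbours X v)))

  squares : ∀ X v → length (distinctPairs (neighbours X v)) + (degree X v + 9) ≡ degree X v * degree X v + 9
  squares X v = trans (≡-sym (+-assoc (length (distinctPairs (neighbours X v))) _ 9))
    (cong (_+ 9) (length-distinctPairs (neighbours-unique X v)))

  squareSum : ∀ X → ∑ (λ v → degree X v * degree X v + 9) ≡ cherrySum X + (degreeSum X + ∑ {n} (λ _ → 9))
  squareSum X = trans (sum-map-cong _ _ (allFin n) (λ {v} _ → ≡-sym (squares X v)))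
    (trans (sum-map-+ (λ v → length (distinctPairs (neighbours X v))) (λ v → degree X v + 9) (allFin n))
           (cong (cherrySum X +_) (sum-map-+ (degree X) (λ _ → 9) (allFin n))))

  module _ {G H : Graph n} (5≤n : 5 ≤ n) (deck : SameDeck (n ∸ 2) G H) where

    private
      2≤n : 2 ≤ n
      2≤n = ≤-trans (m≤m+n 2 3) 5≤n

    degreeSum-≤ : degreeSum G ≤ degreeSum H
    degreeSum-≤ = subst₂ _≤_ (length-dependentPairs _ (neighbours G) (allFin n)) (length-dependentPairs _ (neighbours H) (allFin n))
      (Kelly.kelly {G = G} {H} 2≤n deck edge-local (≤-trans (m≤m+n 4 1) 5≤n) (edges G) (edges H)
        (edges-unique G) (∈-edges⁻ G) (∈-edges⁻ H) (∈-edges⁺ H))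

    -- A cherry has three vertices and must fit on a card, which takes `n` at least 5; four vertices
    -- are treated separately.
    cherrySum-≤ : cherrySum G ≤ cherrySum H
    cherrySum-≤ = subst₂ _≤_ (length-dependentPairs _ (distinctPairs ∘ neighbours G) (allFin n))
                             (length-dependentPairs _ (distinctPairs ∘ neighbours H) (allFin n))
      (Kelly.kelly {G = G} {H} 2≤n deck cherry-local 5≤n (cherries G) (cherries H)
        (cherries-unique G) (∈-cherries⁻ G) (∈-cherries⁻ H) (∈-cherries⁺ H))

  -- The deck determines the sum of (d - 3)² over all degrees d.
  Regular-deck : ∀ {G H : Graph n} → 5 ≤ n → SameDeck (n ∸ 2) G H → Regular 3 G → Regular 3 H
  Regular-deck {G} {H} 5≤n deck rG v = square-tight (degree H v)
    (sum-map-tight (λ v → 6 * degree H v) (λ v → degree H v * degree H v + 9) (allFin n)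
      (λ v → square-gap (degree H v)) total (∈-allFin v))
    where
    open ≤-Reasoning
    deck′ : SameDeck (n ∸ 2) H G
    deck′ = SameDeck-sym {G = G} {H} deck
    -- This is the reverse of the sum of `square-gap`, so equality holds at every vertex. Cherries
    -- are compared in one direction, degree sums in both.
    total : ∑ (λ v → degree H v * degree H v + 9) ≤ ∑ (λ v → 6 * degree H v)
    total = begin
      ∑ (λ v → degree H v * degree H v + 9)          ≡⟨ squareSum H ⟩
      cherrySum H + (degreeSum H + ∑ {n} (λ _ → 9))      ≤⟨ +-mono-≤ (cherrySum-≤ {H} {G} 5≤n deck′)
                                                          (+-monoˡ-≤ _ (degreeSum-≤ {H} {G} 5≤n deck′)) ⟩
      cherrySum G + (degreeSum G + ∑ {n} (λ _ → 9))      ≡⟨ squareSum G ⟨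
      ∑ (λ v → degree G v * degree G v + 9)          ≡⟨ sum-map-cong _ _ (allFin n) (λ {v} _ → tight (rG v)) ⟩
      ∑ (λ v → 6 * degree G v)                       ≡⟨ sum-map-* 6 (degree G) (allFin n) ⟩
      6 * degreeSum G                                ≤⟨ *-monoʳ-≤ 6 (degreeSum-≤ {G} {H} 5≤n deck) ⟩
      6 * degreeSum H                                ≡⟨ sum-map-* 6 (degree H) (allFin n) ⟨
      ∑ (λ v → 6 * degree H v)                       ∎
      where
      tight : ∀ {d} → d ≡ 3 → d * d + 9 ≡ 6 * d
      tight refl = refl

-- The theorem

module _ {n : ℕ} where

  private
    variable
      X : Graph n

  -- The card of X without u and v is a card of H; pulling H back along the
  -- matching of these cards makes both graphs agree off u and v.
  cardMate : ∀ {G H : Graph n} {u v} → 2 ≤ n → SameDeck (n ∸ 2) G H → X ≅ G → u ≢ v →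
             ∃ λ Y → Y ≅ H × Agree X Y u v
  cardMate {X} {G} {H} {u} {v} 2≤n deck (π , iso) u≢v = pullback H (F ↔-∘ π) , pullback-≅ H (F ↔-∘ π) ,
    agreement λ p q r s → trans (proj₂ mate (p ∘ to-injective π) (q ∘ to-injective π) (r ∘ to-injective π) (s ∘ to-injective π))
      (iso _ _)
    where
    mate : ∃ λ (F : Fin n ↔ Fin n) → ∀ {x y} → x ≢ to π u → x ≢ to π v → y ≢ to π u → y ≢ to π v →
           adj H (to F x) (to F y) ≡ adj G x y
    mate = deckMate {G = G} {H = H} 2≤n deck (u≢v ∘ to-injective π)
    F = proj₁ mate

  module NonIsomorphic {G H : Graph n} (5≤n : 5 ≤ n) (rG : Regular 3 G) (deck : SameDeck (n ∸ 2) G H) (G≇H : ¬ G ≅ H) where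

    private
      2≤n : 2 ≤ n
      2≤n = ≤-trans (m≤m+n 2 3) 5≤n
      deck′ : SameDeck (n ∸ 2) H G
      deck′ = SameDeck-sym {G = G} {H} deck

    K : Graph n → Set
    K X = X ≅ G ⊎ X ≅ H

    regular : ∀ X → K X → Regular 3 X
    regular X (inj₁ I) = Regular-≅ {X = X} {Y = G} I rG
    regular X (inj₂ I) = Regular-≅ {X = X} {Y = H} I (Regular-deck {G = G} {H = H} 5≤n deck rG)

    K-resp-≅ : ∀ X Y → X ≅ Y → K Y → K X
    K-resp-≅ X Y I (inj₁ J) = inj₁ (≅-trans {X = X} {Y = Y} {Z = G} I J)
    K-resp-≅ X Y I (inj₂ J) = inj₂ (≅-trans {X = X} {Y = Y} {Z = H} I J)

    apart : ∀ {X Y} → X ≅ G → Y ≅ H → ¬ X ≅ Y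
    apart {X} {Y} I J E = G≇H (≅-trans {X = G} {Y = X} {Z = H} (≅-sym {X = X} {Y = G} I) (≅-trans {X = X} {Y = Y} {Z = H} E J))

    mate : ∀ X {u v} → K X → u ≢ v → ∃ λ Y → K Y × Agree X Y u v × ¬ X ≅ Y
    mate X (inj₁ I) u≢v =
      let Y , J , ag = cardMate {X = X} {G = G} {H = H} 2≤n deck I u≢v
      in Y , inj₂ J , ag , apart {X} {Y} I J
    mate X (inj₂ I) u≢v =
      let Y , J , ag = cardMate {X = X} {G = H} {H = G} 2≤n deck′ I u≢v
      in Y , inj₁ J , ag , λ E → apart {Y} {X} J I (≅-sym {X = X} {Y = Y} E)

    open Mates K regular K-resp-≅ mate

    cycles-K : ∀ k → k + 2 ≤ n → ∀ {X Y} → K X → K Y → length (cycles k X) ≤ length (cycles k Y)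
    cycles-K k k+2≤n {X} {Y} kX kY = ≤-trans (proj₁ (same {X} kX)) (proj₂ (same {Y} kY))
      where
      same : ∀ {X} → K X → length (cycles k X) ≤ length (cycles k G) × length (cycles k G) ≤ length (cycles k X)
      same {X} (inj₁ I) = cycles-≅ {X = X} {Y = G} k I , cycles-≅ {X = G} {Y = X} k (≅-sym {X = X} {Y = G} I)
      same {X} (inj₂ I) =
        ≤-trans (cycles-≅ {X = X} {Y = H} k I) (cycles-deck k {G = H} {H = G} 2≤n k+2≤n deck′) ,
        ≤-trans (cycles-deck k {G = G} {H = H} 2≤n k+2≤n deck) (cycles-≅ {X = H} {Y = X} k (≅-sym {X = X} {Y = H} I))

    -- Once the girth is at least `5 + j` throughout `K`, `noCycle` excludes equality and the bound
    -- rises by one.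
    large-girth : ∀ j {X} → K X → Girth≥ (5 + j) X
    large-girth zero    {X} kX = girth≥5 {X} kX
    large-girth (suc j) {X} kX {l} cyc = ≤∧≢⇒< (large-girth j {X} kX cyc) λ eq →
      Core.noCycle j K (λ {X} → K-cubic {X}) (λ {X} → large-girth j {X})
        (λ {X} kX → exchange {X} kX)
        (λ k+2≤n {X} {Y} kX kY → cycles-same {X = X} {Y = Y} (5 + j) (cycles-K (5 + j) k+2≤n {X} {Y} kX kY))
        {X} {l} kX cyc (≡-sym eq)

    -- `j = n` is more than enough: a girth of at least `5 + n` leaves no room for any cycle.
    contradictory : Fin n → ⊥
    contradictory v₀ = cubic⇒cycle {X = G} (K-cubic {G} kG) v₀ λ cyc →
      ≤-trans (s≤s (m≤n+m n 4)) (large-girth n {G} kG cyc)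
      where
      kG : K G
      kG = inj₁ (≅-refl {X = G})

fresh-vertex : ∀ {n} (l : List (Fin n)) → length l < n → ∃ λ v → v ∉ l
fresh-vertex {n} l lt with fresh _≟_ (allFin n) l (allFin⁺ n) (≤-trans lt (≤-reflexive (≡-sym (length-tabulate id))))
... | v , _ , v∉ = v , v∉

cubic⇒4≤n : ∀ {n} {X : Graph n} {v a b c} → Nbr3 X v a b c → 4 ≤ n
cubic⇒4≤n N = length-distinct (Unique-∷
  (λ { (here eq) → Adj⇒≢ (~₁ N) eq ; (there (here eq)) → Adj⇒≢ (~₂ N) eq ; (there (there (here eq))) → Adj⇒≢ (~₃ N) eq
     ; (there (there (there ()))) })
  (Nbr3-unique N))

-- `G` is complete, so all its cards with two vertices are edges. Any two vertices of `H` form the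
-- card left after deleting the other two, hence they are adjacent.
fourVertices : (G H : Graph 4) → Regular 3 G → SameDeck 2 G H → G ≅ H
fourVertices G H rG deck = ↔-id _ , same
  where
  completeG : ∀ {u v} → u ≢ v → Adj G u v
  completeG {u} {v} u≢v with Regular⇒Nbr3 {X = G} rG u
  ... | a , b , c , N with v ∈? (a ∷ b ∷ c ∷ [])
  ...   | yes v∈ = neighbour N v∈
  ...   | no v∉  = contradiction (length-distinct (Unique-∷ u∉ (Unique-∷ v∉ (Nbr3-unique N)))) (<-irrefl refl)
    where
    u∉ : u ∉ v ∷ a ∷ b ∷ c ∷ []
    u∉ (here eq)                         = u≢v eq
    u∉ (there (here eq))                 = Adj⇒≢ (~₁ N) eq
    u∉ (there (there (here eq)))         = Adj⇒≢ (~₂ N) eq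
    u∉ (there (there (there (here eq)))) = Adj⇒≢ (~₃ N) eq
  completeH : ∀ {u v} → u ≢ v → Adj H u v
  completeH {u} {v} u≢v =
    let p , p∉    = fresh-vertex (u ∷ v ∷ []) (s≤s (s≤s (s≤s z≤n)))
        q , q∉    = fresh-vertex (p ∷ u ∷ v ∷ []) (s≤s (s≤s (s≤s (s≤s z≤n))))
        F , agree = deckMate {G = H} {H = G} (s≤s (s≤s z≤n)) (SameDeck-sym {G = G} {H} deck) {p} {q}
                      (λ eq → q∉ (here (≡-sym eq)))
    in edge (trans
      (≡-sym (agree (λ eq → p∉ (here (≡-sym eq))) (λ eq → q∉ (there (here (≡-sym eq))))
                    (λ eq → p∉ (there (here (≡-sym eq)))) (λ eq → q∉ (there (there (here (≡-sym eq)))))))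
      (adj≡true (completeG (u≢v ∘ to-injective F))))
  same : ∀ u v → adj H u v ≡ adj G u v
  same u v with u ≟ v
  ... | yes refl = trans (irrefl H u) (≡-sym (irrefl G u))
  ... | no u≢v   = trans (adj≡true (completeH u≢v)) (≡-sym (adj≡true (completeG u≢v)))

theorem1p1 : (n : ℕ) (G H : Graph n) → Regular 3 G →
    SameDeck (n ∸ 2) G H → G ≅ H
theorem1p1 zero    G H rG deck = ↔-id _ , λ ()
theorem1p1 (suc m) G H rG deck = bySize G H rG deck (5 ≤? suc m)
  where
  bySize : ∀ {m} (G H : Graph (suc m)) → Regular 3 G → SameDeck (suc m ∸ 2) G H → Dec (5 ≤ suc m) → G ≅ H
  bySize G H rG deck (yes 5≤n) = decidable-stable (≅? G H) λ G≇H →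
    NonIsomorphic.contradictory {G = G} {H = H} 5≤n rG deck G≇H zero
  bySize {m} G H rG deck (no 5≰n) = small G H rG deck (≤-antisym (≤-pred (≰⇒> 5≰n)) 4≤n)
    where
    4≤n : 4 ≤ suc m
    4≤n = let _ , _ , _ , N = Regular⇒Nbr3 {X = G} rG zero in cubic⇒4≤n N
    small : ∀ {n} (G H : Graph n) → Regular 3 G → SameDeck (n ∸ 2) G H → n ≡ 4 → G ≅ H
    small G H rG deck refl = fourVertices G H rG deck
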